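{- Let $G$ be a subcubic planar graph with girth $g$. 1. If $g\geq 16$, then $\chi'_{\mathrm{inj}}(G)\leq 4$. 2. If $g\geq 10$, then $\chi'_{\mathrm{inj}}(G)\leq 5$ (due to Bu and Qi). 3. If $g\geq 8$, then $\chi'_{\mathrm{inj}}(G)\leq 6$. 4. If $g\geq 6$, then $\chi'_{\mathrm{inj}}(G)\leq 7$.
   Context: All graphs are finite and simple. A graph is subcubic if its maximum degree is at most $3$. The girth of a graph is the length of a shortest cycle contained in it. Three edges $e_1,e_2,e_3$ of a graph are consecutive if they form (in this order) a path of length three or a cycle of length three. An injective edge-coloring of $G$ with $k$ colors is a map $c:E(G)\to\{1,\dots,k\}$ (not necessarily a proper edge-coloring) such that $c(e_1)\neq c(e_3)$ whenever $e_1,e_2,e_3$ are consecutive edges in $G$. The injective chromatic index $\chi'_{\mathrm{inj}}(G)$ is the minimum $k$ such that $G$ has an injective edge-coloring with $k$ colors. -}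

module Defs where

open import Data.Bool.Base using (Bool; false; T)
open import Data.Bool.Properties using (T?)
open import Data.Empty using (⊥)
open import Data.Fin.Base as Fin using (Fin)
open import Data.List.Base
  using (List; []; _∷_; _∷ʳ_; length; filter; allFin)
open import Data.List.Relation.Unary.Linked using (Linked)
open import Data.List.Relation.Unary.Unique.Propositional using (Unique)
open import Data.Nat.Base as ℕ using (ℕ)
open import Data.Product.Base using (_×_; _,_; ∃; ∃-syntax)
open import Data.Rational.Base as ℚ using (ℚ; 0ℚ; 1ℚ)
open import Data.Sum.Base using (_⊎_)
open import Function.Definitions using (Injective)
open import Relation.Binary.PropositionalEquality.Core using (_≡_; _≢_)
open import Relation.Nullary.Construct.Add.Supremum using (_⁺; [_]; ⊤⁺)
open import Relation.Nullary.Negation.Core using (¬_)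

IsMinimum : (ℕ → Set) → ℕ → Set
IsMinimum P k = P k × (∀ m → P m → k ℕ.≤ m)

record Graph : Set where
  field
    order      : ℕ
    adj        : Fin order → Fin order → Bool
    adj-sym    : ∀ u v → adj u v ≡ adj v u
    adj-irrefl : ∀ v → adj v v ≡ false

  Vertex : Set
  Vertex = Fin order

  Adj : Vertex → Vertex → Set
  Adj u v = T (adj u v)

  degree : Vertex → ℕ
  degree v = length (filter (λ u → T? (adj v u)) (allFin order))

  -- An undirected edge is stored once, with its smaller endpoint first.
  -- The two proof fields are propositions, so edges are equal as soon as
  -- their endpoints are.
  record Edge : Set where
    constructor edge
    field
      src tgt  : Vertex
      src<tgt  : src Fin.< tgt
      adjacent : Adj src tgt

  open Edge public

  Joins : Edge → Vertex → Vertex → Set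
  Joins e u v = (src e ≡ u × tgt e ≡ v) ⊎ (src e ≡ v × tgt e ≡ u)

  Incident : Vertex → Edge → Set
  Incident v e = (src e ≡ v) ⊎ (tgt e ≡ v)

  -- A cycle is listed by its vertices, without repeating the first one.
  IsCycle : List Vertex → Set
  IsCycle []       = ⊥
  IsCycle (v ∷ vs) =
    3 ℕ.≤ length (v ∷ vs) × Unique (v ∷ vs) × Linked Adj (v ∷ vs ∷ʳ v)

  HasCycleOfLength : ℕ → Set
  HasCycleOfLength k = ∃[ vs ] (IsCycle vs × length vs ≡ k)

  Consecutive : Edge → Edge → Edge → Set
  Consecutive e₁ e₂ e₃ =
    ∃[ a ] ∃[ b ] ∃[ c ] ∃[ d ]
      ( Joins e₁ a b × Joins e₂ b c × Joins e₃ c d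
      × ( Unique (a ∷ b ∷ c ∷ d ∷ [])
        ⊎ (Unique (a ∷ b ∷ c ∷ []) × d ≡ a)))

open Graph using (Vertex; Edge)

Subcubic : Graph → Set
Subcubic G = ∀ v → Graph.degree G v ℕ.≤ 3

-- A graph without cycles has infinite girth.
IsGirth : Graph → ℕ ⁺ → Set
IsGirth G [ k ] = IsMinimum (Graph.HasCycleOfLength G) k
IsGirth G ⊤⁺    = ∀ k → ¬ Graph.HasCycleOfLength G k

open import Relation.Binary.Construct.Add.Supremum.NonStrict ℕ._≤_ public
  using () renaming (_≤⁺_ to _≤∞_)

IsInjectiveEdgeColoring : (G : Graph) {k : ℕ} → (Edge G → Fin k) → Set
IsInjectiveEdgeColoring G c =
  ∀ e₁ e₂ e₃ → Graph.Consecutive G e₁ e₂ e₃ → c e₁ ≢ c e₃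

InjectivelyEdgeColorable : Graph → ℕ → Set
InjectivelyEdgeColorable G k =
  ∃[ c ] IsInjectiveEdgeColoring G {k} c

IsInjectiveChromaticIndex : Graph → ℕ → Set
IsInjectiveChromaticIndex G = IsMinimum (InjectivelyEdgeColorable G)

-- Planarity is the existence of a drawing in the plane without crossings,
-- edges being drawn as simple polygonal arcs.  All points are rational: a
-- finite planar graph has a polygonal drawing, whose corners can be moved to
-- nearby rational points; and as rational segments that meet over ℝ already
-- meet in a rational point, the conditions below over ℚ are the same as over ℝ.

Point : Set
Point = ℚ × ℚ

along : Point → Point → ℚ → Point
along (x₁ , y₁) (x₂ , y₂) t =
    (1ℚ ℚ.- t) ℚ.* x₁ ℚ.+ t ℚ.* x₂
  , (1ℚ ℚ.- t) ℚ.* y₁ ℚ.+ t ℚ.* y₂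

-- `At ps s p`: traversing the polygonal line with corners ps at one segment
-- per unit of time, one is at p at time s.  A corner is reached both at the
-- end of one segment and at the start of the next, at the same time s.
data At : List Point → ℚ → Point → Set where
  here  : ∀ {a b ps t p} → 0ℚ ℚ.≤ t → t ℚ.≤ 1ℚ → p ≡ along a b t →
          At (a ∷ b ∷ ps) t p
  there : ∀ {a ps s p} → At ps s p → At (a ∷ ps) (1ℚ ℚ.+ s) p

On : List Point → Point → Set
On ps p = ∃[ s ] At ps s p

IsSimple : List Point → Set
IsSimple ps = ∀ {s t p} → At ps s p → At ps t p → s ≡ t

record Planar (G : Graph) : Set where
  open Graph G using (src; tgt; Incident)
  field
    position : Vertex G → Point
    bends    : Edge G → List Point

  arc : Edge G → List Point
  arc e = position (src e) ∷ bends e ∷ʳ position (tgt e)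

  field
    position-injective : Injective _≡_ _≡_ position
    arcs-simple        : ∀ e → IsSimple (arc e)
    arcs-avoid-others  : ∀ e v → On (arc e) (position v) → Incident v e
    arcs-cross-free    : ∀ e f p → e ≢ f → On (arc e) p → On (arc f) p →
                         ∃[ v ] (Incident v e × Incident v f × p ≡ position v)

{-# OPTIONS --safe #-}
-- Planarity enters through Euler's inequality, obtained without faces or the
-- Jordan curve theorem.  For an even set S of edges, the parity of the number
-- of edges of S crossed by an upward ray changes exactly across S, so it gives
-- a function on darts that is constant along the orbits of "turn at the next
-- vertex".  Only S = ∅ gives zero on all orbits, so by linear algebra over 𝔽₂
-- a plane graph with n vertices, m edges and F orbits has m ≤ n - 1 + F, and
-- girth g gives g F ≤ 2 m.
--
-- For maximum degree 3, minimum degree 2 and g = 2 s + 6 it follows that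
-- s n₃ < 2 n₂.  If every 2-vertex collects two units from the nearby
-- 3-vertices, some 3-vertex has to give more than s, or three consecutive
-- vertices have degree two.  For s = 5, 2, 1, 0 such a configuration can be
-- deleted and a colouring of the rest extended with 4, 5, 6, 7 colours.  With
-- four colours a pendant edge is not always removable, so the discharging is
-- done on the graph without its leaves.
module Submission where

-- Of Euler's formula the discharging uses only an inequality, which holds for disconnected graphs
-- as well. Its term -1 is essential, because it makes `s n₃ < 2 n₂` strict; it comes from leaving
-- out one vertex condition, which follows from the others since every edge has two ends. Crossing
-- parities are read off next to corners. A shear that gives all corners distinct abscissae leaves
-- one ambiguous place, the common end of several segments, where slopes decide. A dart never turns
-- back, because all degrees are at least two, so every orbit is a closed walk that contains a
-- cycle. Each neighbour of a 3-vertex demands at most 2 units. So a load above 5 is the full 6: all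
-- three neighbours begin threads of at least two 2-vertices. With four colours a pendant edge can
-- see four edges. Leaves that see at most three are deleted beforehand, and then two adjacent
-- 2-vertices of the remaining core carry leaves both or not at all, which keeps the number of
-- configurations small.

open import Defs hiding (here; there)

-- Orientation determinants and crossing segments in the rational plane.

module Geometry where

  import Data.Integer.Base as ℤ
  open import Data.Nat.Base using (s≤s; z≤n)
  open import Data.Product.Base using (_×_; _,_; proj₁; proj₂; ∃-syntax)
  open import Data.Rational.Base
  open import Data.Rational.Properties
  open import Data.Rational.Solver using (module +-*-Solver)
  open import Data.Sum.Base using (_⊎_; inj₁; inj₂)
  open import Relation.Binary.PropositionalEquality
  open import Relation.Nullary using (¬_)
  open +-*-Solver using (Polynomial; solve; _:=_; _:+_; _:*_; _:-_; :-_; con)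

  x y : Point → ℚ
  x = proj₁
  y = proj₂

  pos+ : ∀ {p q} → 0ℚ < p → 0ℚ < q → 0ℚ < p + q
  pos+ {p} {q} 0<p 0<q = subst (_< p + q) (+-identityˡ 0ℚ) (+-mono-< 0<p 0<q)

  pos* : ∀ {p q} → 0ℚ < p → 0ℚ < q → 0ℚ < p * q
  pos* {p} {q} 0<p 0<q =
    positive⁻¹ (p * q) {{pos*pos⇒pos p {{positive 0<p}} q {{positive 0<q}}}}

  pos-factor : ∀ {p q} → 0ℚ < p → 0ℚ < p * q → 0ℚ < q
  pos-factor {p} {q} 0<p 0<pq =
    *-cancelˡ-<-nonNeg p {{pos⇒nonNeg p {{positive 0<p}}}} (subst (_< p * q) (sym (*-zeroʳ p)) 0<pq)

  <⇒0<- : ∀ {p q} → p < q → 0ℚ < q - p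
  <⇒0<- {p} {q} p<q = subst (_< q - p) (+-inverseʳ p) (+-monoˡ-< (- p) p<q)

  0<-⇒< : ∀ {p q} → 0ℚ < q - p → p < q
  0<-⇒< {p} {q} h = subst₂ _<_ (+-identityˡ p) (solve 2 (λ p q → (q :- p) :+ p := q) refl p q) (+-monoˡ-< p h)

  ≤⇒0≤- : ∀ {p q} → p ≤ q → 0ℚ ≤ q - p
  ≤⇒0≤- {p} {q} p≤q = subst (_≤ q - p) (+-inverseʳ p) (+-monoˡ-≤ (- p) p≤q)

  neg⇒pos : ∀ {p} → p < 0ℚ → 0ℚ < - p
  neg⇒pos = neg-antimono-<

  pos⇒neg : ∀ {p} → 0ℚ < p → - p < 0ℚ
  pos⇒neg = neg-antimono-<

  det : Point → Point → Point → ℚ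
  det a b c = (x b - x a) * (y c - y a) - (y b - y a) * (x c - x a)

  private
    :det : ∀ {n} (a₁ a₂ b₁ b₂ c₁ c₂ : Polynomial n) → Polynomial n
    :det a₁ a₂ b₁ b₂ c₁ c₂ = (b₁ :- a₁) :* (c₂ :- a₂) :- (b₂ :- a₂) :* (c₁ :- a₁)

  det-swap₁₂ : ∀ a b c → det b a c ≡ - det a b c
  det-swap₁₂ (a₁ , a₂) (b₁ , b₂) (c₁ , c₂) = solve 6
    (λ a₁ a₂ b₁ b₂ c₁ c₂ → :det b₁ b₂ a₁ a₂ c₁ c₂ := :- :det a₁ a₂ b₁ b₂ c₁ c₂)
    refl a₁ a₂ b₁ b₂ c₁ c₂

  det-swap₂₃ : ∀ a b c → det a c b ≡ - det a b c
  det-swap₂₃ (a₁ , a₂) (b₁ , b₂) (c₁ , c₂) = solve 6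
    (λ a₁ a₂ b₁ b₂ c₁ c₂ → :det a₁ a₂ c₁ c₂ b₁ b₂ := :- :det a₁ a₂ b₁ b₂ c₁ c₂)
    refl a₁ a₂ b₁ b₂ c₁ c₂

  det-degenerate : ∀ a b → det a b b ≡ 0ℚ
  det-degenerate (a₁ , a₂) (b₁ , b₂) = solve 4
    (λ a₁ a₂ b₁ b₂ → :det a₁ a₂ b₁ b₂ b₁ b₂ := con 0ℚ) refl a₁ a₂ b₁ b₂

  OnSegment : Point → Point → Point → Set
  OnSegment a b z = ∃[ t ] (0ℚ ≤ t × t ≤ 1ℚ × z ≡ along a b t)

  along-0 : ∀ a b → along a b 0ℚ ≡ a
  along-0 (a₁ , a₂) (b₁ , b₂) = cong₂ _,_ (lemma a₁ b₁) (lemma a₂ b₂)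
    where
    lemma : ∀ a b → (1ℚ - 0ℚ) * a + 0ℚ * b ≡ a
    lemma = solve 2 (λ a b → (con 1ℚ :- con 0ℚ) :* a :+ con 0ℚ :* b := a) refl

  along-1 : ∀ a b → along a b 1ℚ ≡ b
  along-1 (a₁ , a₂) (b₁ , b₂) = cong₂ _,_ (lemma a₁ b₁) (lemma a₂ b₂)
    where
    lemma : ∀ a b → (1ℚ - 1ℚ) * a + 1ℚ * b ≡ b
    lemma = solve 2 (λ a b → (con 1ℚ :- con 1ℚ) :* a :+ con 1ℚ :* b := b) refl

  0≤1 : 0ℚ ≤ 1ℚ
  0≤1 = <⇒≤ (positive⁻¹ 1ℚ)

  source-on : ∀ a b → OnSegment a b a
  source-on a b = 0ℚ , ≤-refl , 0≤1 , sym (along-0 a b)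

  target-on : ∀ a b → OnSegment a b b
  target-on a b = 1ℚ , 0≤1 , ≤-refl , sym (along-1 a b)

  OnSegment-reverse : ∀ {a b z} → OnSegment a b z → OnSegment b a z
  OnSegment-reverse {a} {b} (t , 0≤t , t≤1 , refl) =
    1ℚ - t , ≤⇒0≤- t≤1 , 1-t≤1 , cong₂ _,_ (lemma (x a) (x b) t) (lemma (y a) (y b) t)
    where
    1-t≤1 : 1ℚ - t ≤ 1ℚ
    1-t≤1 = subst (1ℚ - t ≤_) (+-identityʳ 1ℚ) (+-monoʳ-≤ 1ℚ (neg-antimono-≤ 0≤t))
    lemma : ∀ a b t → (1ℚ - t) * a + t * b ≡ (1ℚ - (1ℚ - t)) * b + (1ℚ - t) * a
    lemma = solve 3 (λ a b t → (con 1ℚ :- t) :* a :+ t :* b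
              := (con 1ℚ :- (con 1ℚ :- t)) :* b :+ (con 1ℚ :- t) :* a) refl

  -- Division by the common total weight `σ` turns both weighted sums into convex combinations. No
  -- intersection point has to be solved for: the crossing lemmas only supply positive determinants
  -- as weights.
  common-mean : ∀ {a b p q} {α β γ δ : ℚ} → 0ℚ < α → 0ℚ < β → 0ℚ < γ → 0ℚ < δ →
    α + β ≡ γ + δ →
    α * x a + β * x b ≡ γ * x p + δ * x q →
    α * y a + β * y b ≡ γ * y p + δ * y q →
    ∃[ z ] (OnSegment a b z × OnSegment p q z)
  common-mean {a} {b} {p} {q} {α} {β} {γ} {δ} 0<α 0<β 0<γ 0<δ α+β≡γ+δ ex ey =
    along a b (β * ρ) , (β * ρ , side 0<β , below 0<α refl , refl)
                      , (δ * ρ , side 0<δ , below 0<γ α+β≡γ+δ , cong₂ _,_ (coord ex) (coord ey))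
    where
    σ = α + β
    0<σ : 0ℚ < σ
    0<σ = pos+ 0<α 0<β
    instance
      _ = positive 0<σ
      _ = pos⇒nonZero σ
    ρ = 1/ σ
    0<ρ : 0ℚ < ρ
    0<ρ = positive⁻¹ ρ {{1/pos⇒pos σ}}
    σρ≡1 : σ * ρ ≡ 1ℚ
    σρ≡1 = *-inverseʳ σ
    side : ∀ {τ} → 0ℚ < τ → 0ℚ ≤ τ * ρ
    side 0<τ = <⇒≤ (pos* 0<τ 0<ρ)
    complement : ∀ ε τ → σ ≡ ε + τ → ε * ρ ≡ 1ℚ - τ * ρ
    complement ε τ eq = begin
      ε * ρ               ≡⟨ solve 3 (λ ε τ ρ → ε :* ρ := (ε :+ τ) :* ρ :- τ :* ρ) refl ε τ ρ ⟩
      (ε + τ) * ρ - τ * ρ ≡⟨ cong (λ s → s * ρ - τ * ρ) eq ⟨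
      σ * ρ - τ * ρ       ≡⟨ cong (_- τ * ρ) σρ≡1 ⟩
      1ℚ - τ * ρ          ∎ where open ≡-Reasoning
    below : ∀ {ε τ} → 0ℚ < ε → σ ≡ ε + τ → τ * ρ ≤ 1ℚ
    below {ε} {τ} 0<ε eq = <⇒≤ (0<-⇒< (subst (0ℚ <_) (complement ε τ eq) (pos* 0<ε 0<ρ)))
    coord : ∀ {a b p q} → α * a + β * b ≡ γ * p + δ * q →
            (1ℚ - β * ρ) * a + (β * ρ) * b ≡ (1ℚ - δ * ρ) * p + (δ * ρ) * q
    coord {a} {b} {p} {q} eq = begin
      (1ℚ - β * ρ) * a + (β * ρ) * b ≡⟨ cong (λ c → c * a + (β * ρ) * b) (complement α β refl) ⟨
      (α * ρ) * a + (β * ρ) * b       ≡⟨ scaled α β a b ρ ⟩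
      ρ * (α * a + β * b)             ≡⟨ cong (ρ *_) eq ⟩
      ρ * (γ * p + δ * q)             ≡⟨ scaled γ δ p q ρ ⟨
      (γ * ρ) * p + (δ * ρ) * q       ≡⟨ cong (λ c → c * p + (δ * ρ) * q) (complement γ δ α+β≡γ+δ) ⟩
      (1ℚ - δ * ρ) * p + (δ * ρ) * q ∎
      where
      open ≡-Reasoning
      scaled : ∀ α β a b ρ → (α * ρ) * a + (β * ρ) * b ≡ ρ * (α * a + β * b)
      scaled = solve 5 (λ α β a b ρ → (α :* ρ) :* a :+ (β :* ρ) :* b := ρ :* (α :* a :+ β :* b)) refl

  along-const : ∀ z t → along z z t ≡ z
  along-const (z₁ , z₂) t = cong₂ _,_ (lemma z₁ t) (lemma z₂ t)
    where
    lemma : ∀ z t → (1ℚ - t) * z + t * z ≡ z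
    lemma = solve 2 (λ z t → (con 1ℚ :- t) :* z :+ t :* z := z) refl

  -- The weights are the horizontal distances of `z` from the two ends. With them the abscissae
  -- balance identically, and the ordinates differ by `det a z b`. The second segment is the single
  -- point `z`.
  collinear-on : ∀ {a z b} → x a < x z → x z < x b → det a z b ≡ 0ℚ → OnSegment a b z
  collinear-on {a} {z} {b} a<z z<b flat
    = at-z (common-mean {a} {b} {z} {z} (<⇒0<- z<b) (<⇒0<- a<z) (<⇒0<- z<b) (<⇒0<- a<z) refl ex ey)
    where
    at-z : ∃[ w ] (OnSegment a b w × OnSegment z z w) → OnSegment a b z
    at-z (w , w∈ab , (t , _ , _ , refl)) = subst (OnSegment a b) (along-const z t) w∈ab
    ex : (x b - x z) * x a + (x z - x a) * x b ≡ (x b - x z) * x z + (x z - x a) * x z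
    ex = solve 3 (λ a z b → (b :- z) :* a :+ (z :- a) :* b := (b :- z) :* z :+ (z :- a) :* z)
           refl (x a) (x z) (x b)
    ey : (x b - x z) * y a + (x z - x a) * y b ≡ (x b - x z) * y z + (x z - x a) * y z
    ey = begin
      (x b - x z) * y a + (x z - x a) * y b
        ≡⟨ solve 6 (λ a a′ z z′ b b′ → (b :- z) :* a′ :+ (z :- a) :* b′
              := ((b :- z) :* z′ :+ (z :- a) :* z′) :+ :det a a′ z z′ b b′)
             refl (x a) (y a) (x z) (y z) (x b) (y b) ⟩
      (x b - x z) * y z + (x z - x a) * y z + det a z b
        ≡⟨ cong ((x b - x z) * y z + (x z - x a) * y z +_) flat ⟩
      (x b - x z) * y z + (x z - x a) * y z + 0ℚ
        ≡⟨ +-identityʳ _ ⟩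
      (x b - x z) * y z + (x z - x a) * y z ∎ where open ≡-Reasoning

  record Disjoint (a b p q : Point) : Set where
    constructor disjoint
    field no-common : ∀ z → OnSegment a b z → ¬ OnSegment p q z

  open Disjoint

  -- The scalar k = ± 1 treats a configuration together with its mirror image.
  module _ {a b c d : Point} (a<b : x a < x b) (b<c : x b < x c) (c<d : x c < x d) (k : ℚ) where
    private
      a<c = <-trans a<b b<c
      b<d = <-trans b<c c<d
      a<d = <-trans a<c c<d

    -- For `k = 1` the point `b` is above `ac` and `c` is above `bd`, so the vertical order of the
    -- two segments is reversed between the abscissae of `b` and `c`. The weights are those of the
    -- affine relation among four points of the plane, the weight of a point being the determinant
    -- of the other three.
    interleaved-cross : Disjoint a c b d → 0ℚ < k * det a c b → ¬ 0ℚ < k * det b d c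
    interleaved-cross apart acb bdc
      = apart′ (common-mean {a} {c} {b} {d} bdc adb adc acb
             (balance (x a) (y a) (x b) (y b) (x c) (y c) (x d) (y d) k)
             (coord₁ (x a) (y a) (x b) (y b) (x c) (y c) (x d) (y d) k)
             (coord₂ (x a) (y a) (x b) (y b) (x c) (y c) (x d) (y d) k))
      where
      apart′ : ¬ (∃[ z ] (OnSegment a c z × OnSegment b d z))
      apart′ (z , z∈ac , z∈bd) = no-common apart z z∈ac z∈bd
      -- The two weights that are not hypotheses become, after multiplication by `x c - x b`,
      -- combinations of the two given ones with positive coefficients.
      adb : 0ℚ < k * det a d b
      adb = pos-factor (<⇒0<- b<c) (subst (0ℚ <_)
        (sym (solve 9 (λ a a′ b b′ c c′ d d′ k →
           (c :- b) :* (k :* :det a a′ d d′ b b′)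
             := (d :- b) :* (k :* :det a a′ c c′ b b′) :+ (b :- a) :* (k :* :det b b′ d d′ c c′)) refl
           (x a) (y a) (x b) (y b) (x c) (y c) (x d) (y d) k))
        (pos+ (pos* (<⇒0<- b<d) acb) (pos* (<⇒0<- a<b) bdc)))
      adc : 0ℚ < k * det a d c
      adc = pos-factor (<⇒0<- b<c) (subst (0ℚ <_)
        (sym (solve 9 (λ a a′ b b′ c c′ d d′ k →
           (c :- b) :* (k :* :det a a′ d d′ c c′)
             := (d :- c) :* (k :* :det a a′ c c′ b b′) :+ (c :- a) :* (k :* :det b b′ d d′ c c′)) refl
           (x a) (y a) (x b) (y b) (x c) (y c) (x d) (y d) k))
        (pos+ (pos* (<⇒0<- c<d) acb) (pos* (<⇒0<- a<c) bdc)))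
      balance : _
      balance = solve 9 (λ a a′ b b′ c c′ d d′ k →
        k :* :det b b′ d d′ c c′ :+ k :* :det a a′ d d′ b b′
          := k :* :det a a′ d d′ c c′ :+ k :* :det a a′ c c′ b b′) refl
      coord₁ : _
      coord₁ = solve 9 (λ a a′ b b′ c c′ d d′ k →
        k :* :det b b′ d d′ c c′ :* a :+ k :* :det a a′ d d′ b b′ :* c
          := k :* :det a a′ d d′ c c′ :* b :+ k :* :det a a′ c c′ b b′ :* d) refl
      coord₂ : _
      coord₂ = solve 9 (λ a a′ b b′ c c′ d d′ k →
        k :* :det b b′ d d′ c c′ :* a′ :+ k :* :det a a′ d d′ b b′ :* c′
          := k :* :det a a′ d d′ c c′ :* b′ :+ k :* :det a a′ c c′ b b′ :* d′) refl

    -- The ends of the inner segment `bc` would lie on different sides of `ad`; the condition on `c`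
    -- is written as the position of `d` relative to `ac`. It is the same affine relation, with `a`
    -- and `d` grouped against `b` and `c`.
    nested-cross : Disjoint a d b c → 0ℚ < k * det a d b → ¬ 0ℚ < k * det a c d
    nested-cross apart adb acd
      = apart′ (common-mean {a} {d} {b} {c} bcd abc acd adb
             (balance (x a) (y a) (x b) (y b) (x c) (y c) (x d) (y d) k)
             (coord₁ (x a) (y a) (x b) (y b) (x c) (y c) (x d) (y d) k)
             (coord₂ (x a) (y a) (x b) (y b) (x c) (y c) (x d) (y d) k))
      where
      apart′ : ¬ (∃[ z ] (OnSegment a d z × OnSegment b c z))
      apart′ (z , z∈ad , z∈bc) = no-common apart z z∈ad z∈bc
      abc : 0ℚ < k * det a c b
      abc = pos-factor (<⇒0<- a<d) (subst (0ℚ <_)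
        (sym (solve 9 (λ a a′ b b′ c c′ d d′ k →
           (d :- a) :* (k :* :det a a′ c c′ b b′)
             := (c :- a) :* (k :* :det a a′ d d′ b b′) :+ (b :- a) :* (k :* :det a a′ c c′ d d′)) refl
           (x a) (y a) (x b) (y b) (x c) (y c) (x d) (y d) k))
        (pos+ (pos* (<⇒0<- a<c) adb) (pos* (<⇒0<- a<b) acd)))
      bcd : 0ℚ < k * det b c d
      bcd = pos-factor (<⇒0<- a<d) (subst (0ℚ <_)
        (sym (solve 9 (λ a a′ b b′ c c′ d d′ k →
           (d :- a) :* (k :* :det b b′ c c′ d d′)
             := (d :- c) :* (k :* :det a a′ d d′ b b′) :+ (d :- b) :* (k :* :det a a′ c c′ d d′)) refl
           (x a) (y a) (x b) (y b) (x c) (y c) (x d) (y d) k))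
        (pos+ (pos* (<⇒0<- c<d) adb) (pos* (<⇒0<- b<d) acd)))
      balance : _
      balance = solve 9 (λ a a′ b b′ c c′ d d′ k →
        k :* :det b b′ c c′ d d′ :+ k :* :det a a′ c c′ b b′
          := k :* :det a a′ c c′ d d′ :+ k :* :det a a′ d d′ b b′) refl
      coord₁ : _
      coord₁ = solve 9 (λ a a′ b b′ c c′ d d′ k →
        k :* :det b b′ c c′ d d′ :* a :+ k :* :det a a′ c c′ b b′ :* d
          := k :* :det a a′ c c′ d d′ :* b :+ k :* :det a a′ d d′ b b′ :* c) refl
      coord₂ : _
      coord₂ = solve 9 (λ a a′ b b′ c c′ d d′ k →
        k :* :det b b′ c c′ d d′ :* a′ :+ k :* :det a a′ c c′ b b′ :* d′
          := k :* :det a a′ c c′ d d′ :* b′ :+ k :* :det a a′ d d′ b b′ :* c′) refl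

  -- The three determinants, each weighted by the abscissa relative to `v` of the point that it
  -- leaves out, add up to zero identically. So slopes seen from `v` cannot increase cyclically on
  -- one side of `v`.
  fan-acyclic : ∀ v p q r k →
    0ℚ < k * (x p - x v) → 0ℚ < k * (x q - x v) → 0ℚ < k * (x r - x v) →
    0ℚ < k * det v p q → 0ℚ < k * det v q r → ¬ 0ℚ < k * det v r p
  fan-acyclic v p q r k vp vq vr pq qr rp = <-irrefl (sym vanishing)
    (pos+ (pos+ (pos* qr vp) (pos* rp vq)) (pos* pq vr))
    where
    vanishing : k * det v q r * (k * (x p - x v)) + k * det v r p * (k * (x q - x v))
                + k * det v p q * (k * (x r - x v)) ≡ 0ℚ
    vanishing = solve 9 (λ v v′ p p′ q q′ r r′ k →
      k :* :det v v′ q q′ r r′ :* (k :* (p :- v)) :+ k :* :det v v′ r r′ p p′ :* (k :* (q :- v))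
        :+ k :* :det v v′ p p′ q q′ :* (k :* (r :- v)) := con 0ℚ)
      refl (x v) (y v) (x p) (y p) (x q) (y q) (x r) (y r) k

  -- This serves to show that a proper segment does not meet itself in its ends only.
  midpoint-end : ∀ a b → along a b ½ ≡ a ⊎ along a b ½ ≡ b → a ≡ b
  midpoint-end a b (inj₁ e) = sym (cong₂ _,_
    (trans (lemma (x a) (x b)) (trans (cong (λ z → (1ℚ + 1ℚ) * x z - x a) e) (double (x a))))
    (trans (lemma (y a) (y b)) (trans (cong (λ z → (1ℚ + 1ℚ) * y z - y a) e) (double (y a)))))
    where
    lemma : ∀ a b → b ≡ (1ℚ + 1ℚ) * ((1ℚ - ½) * a + ½ * b) - a
    lemma = solve 2 (λ a b → b := con (1ℚ + 1ℚ) :* (con (1ℚ - ½) :* a :+ con ½ :* b) :- a) refl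
    double : ∀ a → (1ℚ + 1ℚ) * a - a ≡ a
    double = solve 1 (λ a → con (1ℚ + 1ℚ) :* a :- a := a) refl
  midpoint-end a b (inj₂ e) = cong₂ _,_
    (trans (lemma (x a) (x b)) (trans (cong (λ z → (1ℚ + 1ℚ) * x z - x b) e) (double (x b))))
    (trans (lemma (y a) (y b)) (trans (cong (λ z → (1ℚ + 1ℚ) * y z - y b) e) (double (y b))))
    where
    lemma : ∀ a b → a ≡ (1ℚ + 1ℚ) * ((1ℚ - ½) * a + ½ * b) - b
    lemma = solve 2 (λ a b → a := con (1ℚ + 1ℚ) :* (con (1ℚ - ½) :* a :+ con ½ :* b) :- b) refl
    double : ∀ a → (1ℚ + 1ℚ) * a - a ≡ a
    double = solve 1 (λ a → con (1ℚ + 1ℚ) :* a :- a := a) refl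

  midpoint-on : ∀ a b → OnSegment a b (along a b ½)
  midpoint-on a b = ½ , <⇒≤ (positive⁻¹ ½) , *≤* (ℤ.+≤+ (s≤s z≤n)) , refl

-- The relation "above" for points and segments, and its parity for disjoint segments.

module Above where

  open Geometry
  open import Data.Bool.Base using (Bool; true; false; _∧_; _∨_; _xor_)
  open import Data.Bool.Properties using (xor-comm; ∨-comm; ∧-zeroʳ)
  open import Data.Empty using (⊥-elim)
  open import Data.Product.Base using (_×_; _,_; proj₁; proj₂)
  open import Data.Product.Properties using (≡-dec)
  open import Data.Rational.Base
  open import Data.Rational.Properties
  open import Data.Sum.Base using (_⊎_; inj₁; inj₂)
  open Disjoint
  open import Function.Base using (_∘_)
  open import Function.Bundles using (mk⇔)
  open import Relation.Binary.Definitions using (tri<; tri≈; tri>; DecidableEquality)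
  open import Relation.Binary.PropositionalEquality
  open import Relation.Nullary using (¬_; Dec; yes; contradiction)
  open import Relation.Nullary.Decidable using (does; dec-true; dec-false; does-⇔)

  _≟ᵖ_ : DecidableEquality Point
  _≟ᵖ_ = ≡-dec _≟_ _≟_

  true-does : ∀ {A : Set} (a? : Dec A) → does a? ≡ true → A
  true-does (yes a) _ = a

  infix 4 _≺_
  infix 5 _◁_ _≈ᵇ_

  -- Opaque: unfolded rational arithmetic makes with-abstraction intractable.
  opaque
    _≈ᵇ_ : Point → Point → Bool
    a ≈ᵇ b = does (a ≟ᵖ b)

    ≈ᵇ-refl : ∀ a → a ≈ᵇ a ≡ true
    ≈ᵇ-refl a = dec-true (a ≟ᵖ a) refl

    ≈ᵇ-false : ∀ {a b} → a ≢ b → a ≈ᵇ b ≡ false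
    ≈ᵇ-false {a} {b} = dec-false (a ≟ᵖ b)

    _≺_ : Point → Point → Set
    a ≺ b = x a < x b

    _◁_ : Point → Point → Bool
    a ◁ b = does (x a <? x b)

    left right flat : Point → Point → Point → Set
    left a b c = 0ℚ < det a b c
    right a b c = det a b c < 0ℚ
    flat a b c = det a b c ≡ 0ℚ

    leftᵇ rightᵇ : Point → Point → Point → Bool
    leftᵇ a b c = does (0ℚ <? det a b c)
    rightᵇ a b c = does (det a b c <? 0ℚ)

    ≺-trans : ∀ {a b c} → a ≺ b → b ≺ c → a ≺ c
    ≺-trans = <-trans

    ≺-irrefl : ∀ {a} → ¬ a ≺ a
    ≺-irrefl = <-irrefl refl

    ≺-cmp : ∀ {a b} → x a ≢ x b → a ≺ b ⊎ b ≺ a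
    ≺-cmp {a} {b} a≢b with <-cmp (x a) (x b)
    ... | tri< a<b _ _ = inj₁ a<b
    ... | tri≈ _ e _ = contradiction e a≢b
    ... | tri> _ _ b<a = inj₂ b<a

    ◁-true : ∀ {a b} → a ≺ b → a ◁ b ≡ true
    ◁-true {a} {b} = dec-true (x a <? x b)

    ◁-false : ∀ {a b} → b ≺ a → a ◁ b ≡ false
    ◁-false {a} {b} b<a = dec-false (x a <? x b) (<-asym b<a)

    ◁-irrefl : ∀ a → a ◁ a ≡ false
    ◁-irrefl a = dec-false (x a <? x a) (<-irrefl refl)

    side : ∀ a b c → ¬ flat a b c → left a b c ⊎ right a b c
    side a b c ¬flat with <-cmp (det a b c) 0ℚ
    ... | tri< h _ _ = inj₂ h
    ... | tri≈ _ e _ = contradiction e ¬flat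
    ... | tri> _ _ h = inj₁ h

    left-true : ∀ {a b c} → left a b c → leftᵇ a b c ≡ true
    left-true = dec-true (0ℚ <? _)

    left-false : ∀ {a b c} → right a b c → leftᵇ a b c ≡ false
    left-false h = dec-false (0ℚ <? _) (<-asym h)

    right-true : ∀ {a b c} → right a b c → rightᵇ a b c ≡ true
    right-true = dec-true (_ <? 0ℚ)

    right-false : ∀ {a b c} → left a b c → rightᵇ a b c ≡ false
    right-false h = dec-false (_ <? 0ℚ) (<-asym h)

    leftᵇ-degenerate : ∀ a b → leftᵇ a b b ≡ false
    leftᵇ-degenerate a b = dec-false (0ℚ <? _) (λ h → <-irrefl (sym (det-degenerate a b)) h)

    rightᵇ-degenerate : ∀ a b → rightᵇ a b b ≡ false
    rightᵇ-degenerate a b = dec-false (_ <? 0ℚ) (λ h → <-irrefl (det-degenerate a b) h)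

    leftᵇ-swap₂₃ : ∀ a b c → leftᵇ a c b ≡ rightᵇ a b c
    leftᵇ-swap₂₃ a b c = does-⇔ (mk⇔
      (λ h → subst (_< 0ℚ) (sym (det-swap₂₃ a c b)) (pos⇒neg h))
      (λ h → subst (0ℚ <_) (sym (det-swap₂₃ a b c)) (neg⇒pos h))) (0ℚ <? det a c b) (det a b c <? 0ℚ)

    leftᵇ-swap₁₂ : ∀ a b c → leftᵇ b a c ≡ rightᵇ a b c
    leftᵇ-swap₁₂ a b c = does-⇔ (mk⇔
      (λ h → subst (_< 0ℚ) (sym (det-swap₁₂ b a c)) (pos⇒neg h))
      (λ h → subst (0ℚ <_) (sym (det-swap₁₂ a b c)) (neg⇒pos h))) (0ℚ <? det b a c) (det a b c <? 0ℚ)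

    flat-on : ∀ {a z b} → a ≺ z → z ≺ b → flat a z b → OnSegment a b z
    flat-on = collinear-on

    flat-swap₂₃ : ∀ a b c → flat a b c → flat a c b
    flat-swap₂₃ a b c e = trans (det-swap₂₃ a b c) (cong -_ e)

    flat-cycle : ∀ {a b c} → flat a b c → flat b c a
    flat-cycle {a} {b} {c} e = trans (det-swap₂₃ b a c) (cong -_ (trans (det-swap₁₂ a b c) (cong -_ e)))

    leftᵇ⇒left : ∀ {a b c} → leftᵇ a b c ≡ true → left a b c
    leftᵇ⇒left {a} {b} {c} = true-does (0ℚ <? det a b c)

    rightᵇ⇒right : ∀ {a b c} → rightᵇ a b c ≡ true → right a b c
    rightᵇ⇒right {a} {b} {c} = true-does (det a b c <? 0ℚ)

    private
      scale⁺ : ∀ {r} → 0ℚ < r → 0ℚ < 1ℚ * r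
      scale⁺ {r} = subst (0ℚ <_) (sym (*-identityˡ r))
      scale⁻ : ∀ {r} → r < 0ℚ → 0ℚ < - 1ℚ * r
      scale⁻ {r} h = subst (0ℚ <_) (trans (cong -_ (sym (*-identityˡ r))) (neg-distribˡ-* 1ℚ r)) (neg⇒pos h)

    interleaved-left : ∀ {a b c d} → a ≺ b → b ≺ c → c ≺ d → Disjoint a c b d →
      left a c b → ¬ left b d c
    interleaved-left a<b b<c c<d apart p q = interleaved-cross a<b b<c c<d 1ℚ apart (scale⁺ p) (scale⁺ q)

    interleaved-right : ∀ {a b c d} → a ≺ b → b ≺ c → c ≺ d → Disjoint a c b d →
      right a c b → ¬ right b d c
    interleaved-right a<b b<c c<d apart p q = interleaved-cross a<b b<c c<d (- 1ℚ) apart (scale⁻ p) (scale⁻ q)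

    nested-left-right : ∀ {a b c d} → a ≺ b → b ≺ c → c ≺ d → Disjoint a d b c →
      left a d b → ¬ right a d c
    nested-left-right {a} {b} {c} {d} a<b b<c c<d apart p q = nested-cross a<b b<c c<d 1ℚ apart (scale⁺ p)
      (scale⁺ (subst (0ℚ <_) (sym (det-swap₂₃ a d c)) (neg⇒pos q)))

    nested-right-left : ∀ {a b c d} → a ≺ b → b ≺ c → c ≺ d → Disjoint a d b c →
      right a d b → ¬ left a d c
    nested-right-left {a} {b} {c} {d} a<b b<c c<d apart p q = nested-cross a<b b<c c<d (- 1ℚ) apart (scale⁻ p)
      (scale⁻ (subst (_< 0ℚ) (sym (det-swap₂₃ a d c)) (pos⇒neg q)))

  opaque
    unfolding left

    no-left-cycle : ∀ {v p q r} → v ≺ p → v ≺ q → v ≺ r → left v p q → left v q r → ¬ left v r p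
    no-left-cycle {v} {p} {q} {r} vp vq vr pq qr rp = fan-acyclic v p q r 1ℚ
      (scale⁺ (<⇒0<- {x v} {x p} vp)) (scale⁺ (<⇒0<- {x v} {x q} vq)) (scale⁺ (<⇒0<- {x v} {x r} vr)) (scale⁺ pq) (scale⁺ qr) (scale⁺ rp)

    no-right-cycle : ∀ {v p q r} → p ≺ v → q ≺ v → r ≺ v → right v p q → right v q r → ¬ right v r p
    no-right-cycle {v} {p} {q} {r} pv qv rv pq qr rp = fan-acyclic v p q r (- 1ℚ)
      (back {p} pv) (back {q} qv) (back {r} rv) (scale⁻ pq) (scale⁻ qr) (scale⁻ rp)
      where
      back : ∀ {z} → z ≺ v → 0ℚ < - 1ℚ * (x z - x v)
      back {z} zv = scale⁻ (subst (x z - x v <_) (+-inverseʳ (x v)) (+-monoˡ-< (- x v) zv))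

  between : Point → Point → Point → Bool
  between a p b = (a ◁ p) ∧ (p ◁ b)

  passesAbove : Point → Point → Point → Bool
  passesAbove p a b = (between a p b ∧ rightᵇ a b p) ∨ (between b p a ∧ rightᵇ b a p)

  liesAbove : Point → Point → Point → Bool
  liesAbove z p q = (between p z q ∧ leftᵇ p q z) ∨ (between q z p ∧ leftᵇ q p z)

  -- The segment from p to b runs above the segment from p to q near p.
  startsAbove : Point → Point → Point → Bool
  startsAbove p b q = ((p ◁ b) ∧ (p ◁ q) ∧ leftᵇ p q b) ∨ ((b ◁ p) ∧ (q ◁ p) ∧ rightᵇ p q b)

  -- The segment ab runs above the points of the segment pq near p.
  over : (a b p q : Point) → Bool
  over a b p q = passesAbove p a b xor
    (((a ≈ᵇ p) ∧ startsAbove p b q) xor ((b ≈ᵇ p) ∧ startsAbove p a q))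

  passesAbove-sym : ∀ p a b → passesAbove p a b ≡ passesAbove p b a
  passesAbove-sym p a b = ∨-comm (between a p b ∧ _) _

  liesAbove-sym : ∀ z p q → liesAbove z p q ≡ liesAbove z q p
  liesAbove-sym z p q = ∨-comm (between p z q ∧ _) _

  over-sym : ∀ a b p q → over a b p q ≡ over b a p q
  over-sym a b p q = cong₂ _xor_ (passesAbove-sym p a b)
    (xor-comm ((a ≈ᵇ p) ∧ startsAbove p b q) _)

  startsAbove-refl : ∀ p q → startsAbove p q q ≡ false
  startsAbove-refl p q rewrite leftᵇ-degenerate p q | rightᵇ-degenerate p q
    | ∧-zeroʳ (p ◁ q) | ∧-zeroʳ (p ◁ q) | ∧-zeroʳ (q ◁ p) | ∧-zeroʳ (q ◁ p) = refl

  not-between₁ : ∀ p a → between p p a ≡ false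
  not-between₁ p a rewrite ◁-irrefl p = refl

  not-between₂ : ∀ p a → between a p p ≡ false
  not-between₂ p a rewrite ◁-irrefl p = ∧-zeroʳ _

  passesAbove-end : ∀ p b → passesAbove p p b ≡ false
  passesAbove-end p b rewrite not-between₁ p b | not-between₂ p b = refl

  liesAbove-end : ∀ p q → liesAbove p p q ≡ false
  liesAbove-end p q rewrite not-between₁ p q | not-between₂ p q = refl

  over-self : ∀ p q → p ≢ q → over p q p q ≡ false
  over-self p q p≢q rewrite passesAbove-end p q | ≈ᵇ-refl p | startsAbove-refl p q
    | ≈ᵇ-false (p≢q ∘ sym) = refl

  -- If `vb` leaves `v` above `vq`, it either still passes over `q` or ends before, and then its end
  -- `b` lies above `vq`. When `b` and `q` are on different sides of `v`, all three terms are false.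
  fork : ∀ v q b → x v ≢ x q → x v ≢ x b → x q ≢ x b →
         startsAbove v b q xor passesAbove q v b ≡ liesAbove b v q
  fork v q b v≢q v≢b q≢b with ≺-cmp {v} {q} v≢q | ≺-cmp {v} {b} v≢b | ≺-cmp {q} {b} q≢b
  fork v q b v≢q v≢b q≢b | inj₁ vq | inj₁ vb | inj₁ qb
    rewrite ◁-true vq | ◁-true vb | ◁-true qb | ◁-false vq | ◁-false vb | ◁-false qb | leftᵇ-swap₂₃ v b q
    with rightᵇ v b q
  ... | true = refl
  ... | false = refl
  fork v q b v≢q v≢b q≢b | inj₁ vq | inj₁ vb | inj₂ bq
    rewrite ◁-true vq | ◁-true vb | ◁-true bq | ◁-false vq | ◁-false vb | ◁-false bq
    with leftᵇ v q b
  ... | true = refl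
  ... | false = refl
  fork v q b v≢q v≢b q≢b | inj₁ vq | inj₂ bv | inj₂ bq
    rewrite ◁-true vq | ◁-true bv | ◁-true bq | ◁-false vq | ◁-false bv | ◁-false bq = refl
  fork v q b v≢q v≢b q≢b | inj₂ qv | inj₁ vb | inj₁ qb
    rewrite ◁-true qv | ◁-true vb | ◁-true qb | ◁-false qv | ◁-false vb | ◁-false qb = refl
  fork v q b v≢q v≢b q≢b | inj₂ qv | inj₂ bv | inj₁ qb
    rewrite ◁-true qv | ◁-true bv | ◁-true qb | ◁-false qv | ◁-false bv | ◁-false qb | leftᵇ-swap₁₂ v q b
    with rightᵇ v q b
  ... | true = refl
  ... | false = refl
  fork v q b v≢q v≢b q≢b | inj₂ qv | inj₂ bv | inj₂ bq
    rewrite ◁-true qv | ◁-true bv | ◁-true bq | ◁-false qv | ◁-false bv | ◁-false bq | trans (sym (leftᵇ-swap₁₂ b v q)) (leftᵇ-swap₂₃ v q b)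
    with rightᵇ v q b
  ... | true = refl
  ... | false = refl
  fork v q b v≢q v≢b q≢b | inj₁ vq | inj₂ bv | inj₁ qb =
    ⊥-elim (≺-irrefl (≺-trans (≺-trans vq qb) bv))
  fork v q b v≢q v≢b q≢b | inj₂ qv | inj₁ vb | inj₂ bq =
    ⊥-elim (≺-irrefl (≺-trans (≺-trans qv vb) bq))

  Disjoint-swap : ∀ {a b p q} → Disjoint a b p q → Disjoint p q a b
  Disjoint-swap apart = disjoint (λ z u v → no-common apart z v u)

  opaque
    -- A zero determinant would place an inner end on the other segment, contrary to disjointness,
    -- and of the four remaining sign patterns the crossing lemmas exclude two.
    interleaved-signs : ∀ {a b c d} → a ≺ b → b ≺ c → c ≺ d → Disjoint a c b d →
      rightᵇ a c b ≡ leftᵇ b d c × rightᵇ b d c ≡ leftᵇ a c b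
    interleaved-signs {a} {b} {c} {d} a<b b<c c<d apart = signs (side a c b acb) (side b d c bdc)
      where
      acb : ¬ flat a c b
      acb e = no-common apart b (flat-on a<b b<c (flat-swap₂₃ a c b e)) (source-on b d)
      bdc : ¬ flat b d c
      bdc e = no-common apart c (target-on a c) (flat-on b<c c<d (flat-swap₂₃ b d c e))
      signs : left a c b ⊎ right a c b → left b d c ⊎ right b d c →
              rightᵇ a c b ≡ leftᵇ b d c × rightᵇ b d c ≡ leftᵇ a c b
      signs (inj₁ p) (inj₁ q) = contradiction q (interleaved-left a<b b<c c<d apart p)
      signs (inj₂ p) (inj₂ q) = contradiction q (interleaved-right a<b b<c c<d apart p)
      signs (inj₁ p) (inj₂ q) = trans (right-false p) (sym (left-false q)) , trans (right-true q) (sym (left-true p))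
      signs (inj₂ p) (inj₁ q) = trans (right-true p) (sym (left-true q)) , trans (right-false q) (sym (left-false p))

    nested-signs : ∀ {a b c d} → a ≺ b → b ≺ c → c ≺ d → Disjoint a d b c →
      rightᵇ a d b ≡ rightᵇ a d c × leftᵇ a d b ≡ leftᵇ a d c
    nested-signs {a} {b} {c} {d} a<b b<c c<d apart = signs (side a d b adb) (side a d c adc)
      where
      adb : ¬ flat a d b
      adb e = no-common apart b (flat-on a<b (≺-trans b<c c<d) (flat-swap₂₃ a d b e)) (source-on b c)
      adc : ¬ flat a d c
      adc e = no-common apart c (flat-on (≺-trans a<b b<c) c<d (flat-swap₂₃ a d c e)) (target-on b c)
      signs : left a d b ⊎ right a d b → left a d c ⊎ right a d c →
              rightᵇ a d b ≡ rightᵇ a d c × leftᵇ a d b ≡ leftᵇ a d c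
      signs (inj₁ p) (inj₂ q) = contradiction q (nested-left-right a<b b<c c<d apart p)
      signs (inj₂ p) (inj₁ q) = contradiction q (nested-right-left a<b b<c c<d apart p)
      signs (inj₁ p) (inj₁ q) = trans (right-false p) (sym (right-false q)) , trans (left-true p) (sym (left-true q))
      signs (inj₂ p) (inj₂ q) = trans (right-true p) (sym (right-true q)) , trans (left-false p) (sym (left-false q))

  -- Of the sixteen patterns of comparisons six are consistent: the segments are separated,
  -- interleaved or nested in abscissa, in either order. When they are separated every term is
  -- false; otherwise exactly two terms depend on a sign, and these are the two that
  -- `interleaved-signs` or `nested-signs` identifies.
  apart-parity : ∀ {a b p q} → a ≺ b → p ≺ q →
    x a ≢ x p → x a ≢ x q → x b ≢ x p → x b ≢ x q → Disjoint a b p q →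
    passesAbove p a b xor passesAbove q a b ≡ liesAbove a p q xor liesAbove b p q
  apart-parity {a} {b} {p} {q} ab pq a≢p a≢q b≢p b≢q apart
    with ≺-cmp {a} {p} a≢p | ≺-cmp {a} {q} a≢q | ≺-cmp {b} {p} b≢p | ≺-cmp {b} {q} b≢q
  apart-parity {a} {b} {p} {q} ab pq a≢p a≢q b≢p b≢q apart | inj₁ ap | inj₁ aq | inj₁ bp | inj₁ bq
    rewrite ◁-true ap | ◁-true aq | ◁-true bp | ◁-true bq | ◁-false ap | ◁-false aq | ◁-false bp | ◁-false bq = refl
  apart-parity {a} {b} {p} {q} ab pq a≢p a≢q b≢p b≢q apart | inj₁ ap | inj₁ aq | inj₁ bp | inj₂ qb =
    ⊥-elim (≺-irrefl (≺-trans (≺-trans pq qb) bp))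
  apart-parity {a} {b} {p} {q} ab pq a≢p a≢q b≢p b≢q apart | inj₁ ap | inj₁ aq | inj₂ pb | inj₁ bq
    rewrite ◁-true ap | ◁-true aq | ◁-true pb | ◁-true bq | ◁-false ap | ◁-false aq | ◁-false pb | ◁-false bq | proj₁ (interleaved-signs ap pb bq apart)
    with leftᵇ p q b
  ... | true = refl
  ... | false = refl
  apart-parity {a} {b} {p} {q} ab pq a≢p a≢q b≢p b≢q apart | inj₁ ap | inj₁ aq | inj₂ pb | inj₂ qb
    rewrite ◁-true ap | ◁-true aq | ◁-true pb | ◁-true qb | ◁-false ap | ◁-false aq | ◁-false pb | ◁-false qb | proj₁ (nested-signs ap pq qb apart)
    with rightᵇ a b q
  ... | true = refl
  ... | false = refl
  apart-parity {a} {b} {p} {q} ab pq a≢p a≢q b≢p b≢q apart | inj₁ ap | inj₂ qa | inj₁ bp | inj₁ bq =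
    ⊥-elim (≺-irrefl (≺-trans (≺-trans pq qa) ap))
  apart-parity {a} {b} {p} {q} ab pq a≢p a≢q b≢p b≢q apart | inj₁ ap | inj₂ qa | inj₁ bp | inj₂ qb =
    ⊥-elim (≺-irrefl (≺-trans (≺-trans pq qa) ap))
  apart-parity {a} {b} {p} {q} ab pq a≢p a≢q b≢p b≢q apart | inj₁ ap | inj₂ qa | inj₂ pb | inj₁ bq =
    ⊥-elim (≺-irrefl (≺-trans (≺-trans pq qa) ap))
  apart-parity {a} {b} {p} {q} ab pq a≢p a≢q b≢p b≢q apart | inj₁ ap | inj₂ qa | inj₂ pb | inj₂ qb =
    ⊥-elim (≺-irrefl (≺-trans (≺-trans pq qa) ap))
  apart-parity {a} {b} {p} {q} ab pq a≢p a≢q b≢p b≢q apart | inj₂ pa | inj₁ aq | inj₁ bp | inj₁ bq =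
    ⊥-elim (≺-irrefl (≺-trans (≺-trans ab bp) pa))
  apart-parity {a} {b} {p} {q} ab pq a≢p a≢q b≢p b≢q apart | inj₂ pa | inj₁ aq | inj₁ bp | inj₂ qb =
    ⊥-elim (≺-irrefl (≺-trans (≺-trans ab bp) pa))
  apart-parity {a} {b} {p} {q} ab pq a≢p a≢q b≢p b≢q apart | inj₂ pa | inj₁ aq | inj₂ pb | inj₁ bq
    rewrite ◁-true pa | ◁-true aq | ◁-true pb | ◁-true bq | ◁-false pa | ◁-false aq | ◁-false pb | ◁-false bq | proj₂ (nested-signs pa ab bq (Disjoint-swap apart))
    with leftᵇ p q b
  ... | true = refl
  ... | false = refl
  apart-parity {a} {b} {p} {q} ab pq a≢p a≢q b≢p b≢q apart | inj₂ pa | inj₁ aq | inj₂ pb | inj₂ qb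
    rewrite ◁-true pa | ◁-true aq | ◁-true pb | ◁-true qb | ◁-false pa | ◁-false aq | ◁-false pb | ◁-false qb | proj₂ (interleaved-signs pa aq qb (Disjoint-swap apart))
    with leftᵇ p q a
  ... | true = refl
  ... | false = refl
  apart-parity {a} {b} {p} {q} ab pq a≢p a≢q b≢p b≢q apart | inj₂ pa | inj₂ qa | inj₁ bp | inj₁ bq =
    ⊥-elim (≺-irrefl (≺-trans (≺-trans ab bp) pa))
  apart-parity {a} {b} {p} {q} ab pq a≢p a≢q b≢p b≢q apart | inj₂ pa | inj₂ qa | inj₁ bp | inj₂ qb =
    ⊥-elim (≺-irrefl (≺-trans (≺-trans ab bp) pa))
  apart-parity {a} {b} {p} {q} ab pq a≢p a≢q b≢p b≢q apart | inj₂ pa | inj₂ qa | inj₂ pb | inj₁ bq =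
    ⊥-elim (≺-irrefl (≺-trans (≺-trans ab bq) qa))
  apart-parity {a} {b} {p} {q} ab pq a≢p a≢q b≢p b≢q apart | inj₂ pa | inj₂ qa | inj₂ pb | inj₂ qb
    rewrite ◁-true pa | ◁-true qa | ◁-true pb | ◁-true qb | ◁-false pa | ◁-false qa | ◁-false pb | ◁-false qb = refl

-- Segments that meet only in their ends, and their order around a common end.

module Segments where

  open Geometry
  open Above
  open import Data.Bool.Base using (true; false; not; _∧_; _∨_; _xor_)
  open import Data.Bool.Properties using (xor-comm; ∧-zeroʳ; xor-identityʳ)
  open import Data.Empty using (⊥-elim)
  open import Data.Product.Base using (_×_; _,_; proj₁; proj₂)
  open import Data.Rational.Base
  open import Data.Sum.Base using (_⊎_; inj₁; inj₂; swap; [_,_]′)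
  open import Function.Base using (_∘_)
  open import Relation.Binary.PropositionalEquality
  open import Relation.Nullary using (¬_; yes; no; contradiction)

  record MeetAtEnds (a b p q : Point) : Set where
    constructor meetAtEnds
    field common-ends : ∀ {z} → OnSegment a b z → OnSegment p q z → (z ≡ a ⊎ z ≡ b) × (z ≡ p ⊎ z ≡ q)

  open MeetAtEnds public

  MeetAtEnds-reverse : ∀ {a b p q} → MeetAtEnds a b p q → MeetAtEnds b a p q
  MeetAtEnds-reverse m = meetAtEnds λ u v →
    let (e , f) = common-ends m (OnSegment-reverse u) v in swap e , f

  MeetAtEnds-sym : ∀ {a b p q} → MeetAtEnds a b p q → MeetAtEnds p q a b
  MeetAtEnds-sym m = meetAtEnds λ u v →
    let (e , f) = common-ends m v u in f , e

  -- Otherwise the segment would meet itself, and its midpoint would have to be one of its ends.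
  MeetAtEnds-distinct : ∀ {p q r} → MeetAtEnds p q p r → p ≢ q → q ≢ r
  MeetAtEnds-distinct {p} {q} m p≢q refl =
    p≢q (midpoint-end p q (proj₁ (common-ends m (midpoint-on p q) (midpoint-on p q))))

  module _ (Corner : Point → Set) (x-injective : ∀ {p q} → Corner p → Corner q → x p ≡ x q → p ≡ q) where

    shared-parity : ∀ {v b q} → Corner v → Corner b → Corner q → v ≢ b → v ≢ q → b ≢ q →
      over v b v q xor over v b q v ≡ liesAbove v v q xor liesAbove b v q
    shared-parity {v} {b} {q} cv cb cq v≢b v≢q b≢q
      rewrite passesAbove-end v b | ≈ᵇ-refl v | ≈ᵇ-false (v≢b ∘ sym) | ≈ᵇ-false v≢q | ≈ᵇ-false b≢q
            | liesAbove-end v q | xor-identityʳ (startsAbove v b q) | xor-identityʳ (passesAbove q v b)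
      = fork v q b (v≢q ∘ x-injective cv cq) (v≢b ∘ x-injective cv cb) (b≢q ∘ x-injective cb cq ∘ sym)

    self-parity : ∀ {p q} → p ≢ q → over p q p q xor over p q q p ≡ liesAbove p p q xor liesAbove q p q
    self-parity {p} {q} p≢q
      rewrite over-self p q p≢q | over-sym p q q p | over-self q p (p≢q ∘ sym)
            | liesAbove-end p q | liesAbove-sym q p q | liesAbove-end q p = refl

    joined-parity : ∀ {v b q} → Corner v → Corner b → Corner q → v ≢ b → v ≢ q →
      over v b v q xor over v b q v ≡ liesAbove v v q xor liesAbove b v q
    joined-parity {v} {b} {q} cv cb cq v≢b v≢q with b ≟ᵖ q
    ... | yes refl = self-parity v≢b
    ... | no b≢q = shared-parity cv cb cq v≢b v≢q b≢q

    swap₁ : ∀ {a b p q} → over b a p q xor over b a q p ≡ liesAbove b p q xor liesAbove a p q →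
            over a b p q xor over a b q p ≡ liesAbove a p q xor liesAbove b p q
    swap₁ {a} {b} {p} {q} e = trans (cong₂ _xor_ (over-sym a b p q) (over-sym a b q p))
      (trans e (xor-comm (liesAbove b p q) _))

    swap₂ : ∀ {a b p q} → over a b q p xor over a b p q ≡ liesAbove a q p xor liesAbove b q p →
            over a b p q xor over a b q p ≡ liesAbove a p q xor liesAbove b p q
    swap₂ {a} {b} {p} {q} e = trans (xor-comm (over a b p q) _)
      (trans e (cong₂ _xor_ (liesAbove-sym a q p) (liesAbove-sym b q p)))

    disjoint-parity : ∀ {a b p q} → Corner a → Corner b → Corner p → Corner q → a ≢ b → p ≢ q →
      a ≢ p → a ≢ q → b ≢ p → b ≢ q → Disjoint a b p q →
      over a b p q xor over a b q p ≡ liesAbove a p q xor liesAbove b p q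
    disjoint-parity {a} {b} {p} {q} ca cb cp cq a≢b p≢q a≢p a≢q b≢p b≢q apart =
      [ (λ ab → [ (λ pq → oriented ca cb cp cq ab pq a≢p a≢q b≢p b≢q apart)
                , (λ qp → swap₂ (oriented ca cb cq cp ab qp a≢q a≢p b≢q b≢p (rev₂ apart))) ]′ pq?)
      , (λ ba → [ (λ pq → swap₁ (oriented cb ca cp cq ba pq b≢p b≢q a≢p a≢q (rev₁ apart)))
                , (λ qp → swap₁ (swap₂ (oriented cb ca cq cp ba qp b≢q b≢p a≢q a≢p (rev₂ (rev₁ apart))))) ]′ pq?) ]′
      (≺-cmp {a} {b} (a≢b ∘ x-injective ca cb))
      where
      pq? = ≺-cmp {p} {q} (p≢q ∘ x-injective cp cq)
      rev₁ : ∀ {a b p q} → Disjoint a b p q → Disjoint b a p q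
      rev₁ apart = disjoint λ z u v → Disjoint.no-common apart z (OnSegment-reverse u) v
      rev₂ : ∀ {a b p q} → Disjoint a b p q → Disjoint a b q p
      rev₂ apart = disjoint λ z u v → Disjoint.no-common apart z u (OnSegment-reverse v)
      oriented : ∀ {a b p q} → Corner a → Corner b → Corner p → Corner q → a ≺ b → p ≺ q →
        a ≢ p → a ≢ q → b ≢ p → b ≢ q → Disjoint a b p q →
        over a b p q xor over a b q p ≡ liesAbove a p q xor liesAbove b p q
      oriented {a} {b} {p} {q} ca cb cp cq ab pq a≢p a≢q b≢p b≢q apart
        rewrite ≈ᵇ-false a≢p | ≈ᵇ-false a≢q | ≈ᵇ-false b≢p | ≈ᵇ-false b≢q
              | xor-identityʳ (passesAbove p a b) | xor-identityʳ (passesAbove q a b) =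
        apart-parity ab pq (a≢p ∘ x-injective ca cp) (a≢q ∘ x-injective ca cq)
          (b≢p ∘ x-injective cb cp) (b≢q ∘ x-injective cb cq) apart

    -- The boundary of the region above pq consists of pq and two vertical rays.
    segment-parity : ∀ {a b p q} → Corner a → Corner b → Corner p → Corner q → a ≢ b → p ≢ q →
      MeetAtEnds a b p q → over a b p q xor over a b q p ≡ liesAbove a p q xor liesAbove b p q
    segment-parity {a} {b} {p} {q} ca cb cp cq a≢b p≢q m
      with a ≟ᵖ p | a ≟ᵖ q | b ≟ᵖ p | b ≟ᵖ q
    ... | yes refl | _ | _ | _ = joined-parity ca cb cq a≢b p≢q
    ... | no _ | yes refl | _ | _ = swap₂ (joined-parity ca cb cp a≢b (p≢q ∘ sym))
    ... | no _ | no _ | yes refl | _ = swap₁ (joined-parity cb ca cq (a≢b ∘ sym) p≢q)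
    ... | no _ | no _ | no _ | yes refl = swap₁ (swap₂ (joined-parity cb ca cp (a≢b ∘ sym) (p≢q ∘ sym)))
    ... | no a≢p | no a≢q | no b≢p | no b≢q = disjoint-parity ca cb cp cq a≢b p≢q a≢p a≢q b≢p b≢q
      (disjoint λ z u v → clash (common-ends m u v))
      where
      clash : ∀ {z} → ¬ ((z ≡ a ⊎ z ≡ b) × (z ≡ p ⊎ z ≡ q))
      clash (inj₁ refl , inj₁ e) = a≢p e
      clash (inj₁ refl , inj₂ e) = a≢q e
      clash (inj₂ refl , inj₁ e) = b≢p e
      clash (inj₂ refl , inj₂ e) = b≢q e

    -- Segments that leave `p` to different sides are incomparable near `p`. On the same side a zero
    -- determinant would put the nearer end on the other segment, which meeting only in ends
    -- forbids, so the sign of the determinant decides.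
    startsAbove-total : ∀ {p q r} → Corner p → Corner q → Corner r → p ≢ q → p ≢ r → MeetAtEnds p q p r →
      startsAbove p r q xor startsAbove p q r ≡ not ((p ◁ q) xor (p ◁ r))
    startsAbove-total {p} {q} {r} cp cq cr p≢q p≢r m =
      cases (≺-cmp {p} {q} (p≢q ∘ x-injective cp cq)) (≺-cmp {p} {r} (p≢r ∘ x-injective cp cr))
      where
      q≢r : q ≢ r
      q≢r = MeetAtEnds-distinct m p≢q
      q∉pr : ¬ OnSegment p r q
      q∉pr h = [ p≢q ∘ sym , q≢r ]′ (proj₂ (common-ends m (target-on p q) h))
      r∉pq : ¬ OnSegment p q r
      r∉pq h = [ p≢r ∘ sym , q≢r ∘ sym ]′ (proj₁ (common-ends m h (target-on p r)))
      qr? = ≺-cmp {q} {r} (q≢r ∘ x-injective cq cr)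
      cases : p ≺ q ⊎ q ≺ p → p ≺ r ⊎ r ≺ p → startsAbove p r q xor startsAbove p q r ≡ not ((p ◁ q) xor (p ◁ r))
      cases (inj₁ pq) (inj₂ rp) rewrite ◁-true pq | ◁-false pq | ◁-true rp | ◁-false rp = refl
      cases (inj₂ qp) (inj₁ pr) rewrite ◁-true qp | ◁-false qp | ◁-true pr | ◁-false pr = refl
      cases (inj₁ pq) (inj₁ pr)
        rewrite ◁-true pq | ◁-false pq | ◁-true pr | ◁-false pr | leftᵇ-swap₂₃ p q r =
        [ (λ h → cong₂ (λ u v → (u ∨ false) xor (v ∨ false)) (left-true h) (right-false h))
        , (λ h → cong₂ (λ u v → (u ∨ false) xor (v ∨ false)) (left-false h) (right-true h)) ]′
        (side p q r λ f → [ (λ qr → q∉pr (flat-on pq qr f)) , (λ rq → r∉pq (flat-on pr rq (flat-swap₂₃ p q r f))) ]′ qr?)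
      cases (inj₂ qp) (inj₂ rp)
        rewrite ◁-true qp | ◁-false qp | ◁-true rp | ◁-false rp | sym (leftᵇ-swap₂₃ p r q) =
        [ (λ h → cong₂ _xor_ (right-false h) (left-true h))
        , (λ h → cong₂ _xor_ (right-true h) (left-false h)) ]′
        (side p q r λ f → [ (λ qr → r∉pq (OnSegment-reverse (flat-on qr rp (flat-cycle f))))
                          , (λ rq → q∉pr (OnSegment-reverse (flat-on rq qp (flat-cycle (flat-swap₂₃ p q r f))))) ]′ qr?)

    startsAbove-opposite-sides : ∀ {p q r} → Corner p → Corner q → Corner r → p ≢ q → p ≢ r →
      (p ◁ q) xor (p ◁ r) ≡ true → startsAbove p r q ≡ false
    startsAbove-opposite-sides {p} {q} {r} cp cq cr p≢q p≢r opp
      with ≺-cmp {p} {q} (p≢q ∘ x-injective cp cq) | ≺-cmp {p} {r} (p≢r ∘ x-injective cp cr)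
    ... | inj₁ pq | inj₂ rp rewrite ◁-true pq | ◁-false pq | ◁-true rp | ◁-false rp = refl
    ... | inj₂ qp | inj₁ pr rewrite ◁-true qp | ◁-false qp | ◁-true pr | ◁-false pr = refl
    ... | inj₁ pq | inj₁ pr rewrite ◁-true pq | ◁-true pr = contradiction opp λ ()
    ... | inj₂ qp | inj₂ rp rewrite ◁-false qp | ◁-false rp = contradiction opp λ ()

    -- The three terms together force all ends to one side of `v`, where segments are ordered by
    -- slope. Without this fact the truth table in `cyclic-order` would also have to deal with
    -- cyclic patterns.
    startsAbove-acyclic : ∀ {v p q r} → Corner v → Corner p → Corner q → Corner r → v ≢ p → v ≢ q → v ≢ r →
      startsAbove v q p ∧ startsAbove v r q ∧ startsAbove v p r ≡ false
    startsAbove-acyclic {v} {p} {q} {r} cv cp cq cr v≢p v≢q v≢r =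
      cases (≺-cmp {v} {p} (v≢p ∘ x-injective cv cp)) (≺-cmp {v} {q} (v≢q ∘ x-injective cv cq))
            (≺-cmp {v} {r} (v≢r ∘ x-injective cv cr))
      where
      cases : v ≺ p ⊎ p ≺ v → v ≺ q ⊎ q ≺ v → v ≺ r ⊎ r ≺ v →
              startsAbove v q p ∧ startsAbove v r q ∧ startsAbove v p r ≡ false
      cases (inj₁ vp) (inj₁ vq) (inj₁ vr)
        rewrite ◁-true vp | ◁-false vp | ◁-true vq | ◁-false vq | ◁-true vr | ◁-false vr
        with leftᵇ v p q in e₁ | leftᵇ v q r in e₂ | leftᵇ v r p in e₃
      ... | true | true | true = ⊥-elim (no-left-cycle vp vq vr (leftᵇ⇒left e₁) (leftᵇ⇒left e₂) (leftᵇ⇒left e₃))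
      ... | false | _ | _ = refl
      ... | true | false | _ = refl
      ... | true | true | false = refl
      cases (inj₂ pv) (inj₂ qv) (inj₂ rv)
        rewrite ◁-true pv | ◁-false pv | ◁-true qv | ◁-false qv | ◁-true rv | ◁-false rv
        with rightᵇ v p q in e₁ | rightᵇ v q r in e₂ | rightᵇ v r p in e₃
      ... | true | true | true = ⊥-elim (no-right-cycle pv qv rv (rightᵇ⇒right e₁) (rightᵇ⇒right e₂) (rightᵇ⇒right e₃))
      ... | false | _ | _ = refl
      ... | true | false | _ = refl
      ... | true | true | false = refl
      cases (inj₁ vp) (inj₂ qv) _ rewrite ◁-true vp | ◁-false vp | ◁-true qv | ◁-false qv = refl
      cases (inj₂ pv) (inj₁ vq) _ rewrite ◁-true pv | ◁-false pv | ◁-true vq | ◁-false vq = refl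
      cases (inj₁ vp) (inj₁ vq) (inj₂ rv)
        rewrite ◁-true vp | ◁-false vp | ◁-true vq | ◁-false vq | ◁-true rv | ◁-false rv = ∧-zeroʳ _
      cases (inj₂ pv) (inj₂ qv) (inj₁ vr)
        rewrite ◁-true pv | ◁-false pv | ◁-true qv | ◁-false qv | ◁-true vr | ◁-false vr = ∧-zeroʳ _

-- From a drawing to polygonal arcs whose corners have distinct abscissae.

module Drawing where

  open Defs using (here; there)
  open Geometry
  open Segments using (MeetAtEnds; meetAtEnds; common-ends)
  open import Data.Bool.Properties using (T?; T-irrelevant)
  open import Data.Empty using (⊥-elim)
  open import Data.Fin.Base as Fin using (Fin)
  import Data.Fin.Properties as Finₚ
  open import Data.List.Base using (List; []; _∷_; _∷ʳ_; map; concatMap; allFin; cartesianProduct)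
  open import Data.List.Membership.Propositional using (_∈_; _∉_; lose)
  open import Data.List.Membership.Propositional.Properties
    using (∈-map⁻; ∈-concatMap⁺; ∈-allFin; ∈-cartesianProduct⁺)
  open import Data.List.Properties using (map-++)
  open import Data.List.Relation.Unary.All as All using (All; []; _∷_)
  open import Data.List.Relation.Unary.Any using (here; there)
  open import Data.List.Relation.Unary.AllPairs using ([]; _∷_)
  open import Data.List.Relation.Unary.Unique.Propositional using (Unique)
  import Data.List.Relation.Unary.Unique.Propositional.Properties as Uniqueₚ
  import Data.Nat.Properties as ℕₚ
  open import Data.Product.Base using (_×_; _,_; proj₁; proj₂; ∃-syntax)
  open import Data.Rational.Base
  open import Data.Rational.Properties
  open import Data.Rational.Solver using (module +-*-Solver)
  open import Data.Sum.Base using (_⊎_; inj₁; inj₂; [_,_]′)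
  open import Function.Base using (_∘_; case_of_)
  open import Relation.Binary.PropositionalEquality
  open import Relation.Nullary using (¬_; Dec; yes; no; contradiction)
  open +-*-Solver using (solve; _:=_; _:+_; _:*_; _:-_; :-_; con)
  open Graph using (Vertex; Edge; src; tgt)

  segments : List Point → List (Point × Point)
  segments (a ∷ ps@(b ∷ _)) = (a , b) ∷ segments ps
  segments _ = []

  -- The index is the time at which the traversal `At` enters the segment. Simplicity is a statement
  -- about times, so it is through these indices that it separates segments.
  data Segment : List Point → ℚ → Point → Point → Set where
    first : ∀ {a b ps} → Segment (a ∷ b ∷ ps) 0ℚ a b
    next  : ∀ {a ps i p q} → Segment ps i p q → Segment (a ∷ ps) (1ℚ + i) p q

  segment-of : ∀ ps {p q} → (p , q) ∈ segments ps → ∃[ i ] Segment ps i p q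
  segment-of (a ∷ b ∷ ps) (here refl) = 0ℚ , first
  segment-of (a ∷ b ∷ ps) (there h) = let (i , s) = segment-of (b ∷ ps) h in 1ℚ + i , next s

  1+-nonneg : ∀ {i} → 0ℚ ≤ i → 0ℚ ≤ 1ℚ + i
  1+-nonneg 0≤i = +-mono-≤ 0≤1 0≤i

  segment-nonneg : ∀ {ps i p q} → Segment ps i p q → 0ℚ ≤ i
  segment-nonneg first = ≤-refl
  segment-nonneg (next s) = 1+-nonneg (segment-nonneg s)

  segment-At : ∀ {ps i p q t z} → Segment ps i p q → 0ℚ ≤ t → t ≤ 1ℚ → z ≡ along p q t → At ps (i + t) z
  segment-At {t = t} first 0≤t t≤1 e = subst (λ s → At _ s _) (sym (+-identityˡ t)) (here 0≤t t≤1 e)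
  segment-At {t = t} (next {i = i} s) 0≤t t≤1 e =
    subst (λ s → At _ s _) (sym (+-assoc 1ℚ i t)) (there (segment-At s 0≤t t≤1 e))

  1≤1+ : ∀ {i} → 0ℚ ≤ i → 0ℚ + 1ℚ ≤ 1ℚ + i
  1≤1+ {i} 0≤i = subst (_≤ 1ℚ + i) (trans (+-identityʳ 1ℚ) (sym (+-identityˡ 1ℚ))) (+-monoʳ-≤ 1ℚ 0≤i)

  shift≤ : ∀ i {j} → i + 1ℚ ≤ j → 1ℚ + i + 1ℚ ≤ 1ℚ + j
  shift≤ i {j} h = subst (_≤ 1ℚ + j) (sym (+-assoc 1ℚ i 1ℚ)) (+-monoʳ-≤ 1ℚ h)

  segment-order : ∀ {ps i j p q a b} → Segment ps i p q → Segment ps j a b →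
    ((p , q) ≡ (a , b)) ⊎ (i + 1ℚ ≤ j ⊎ j + 1ℚ ≤ i)
  segment-order first first = inj₁ refl
  segment-order first (next t) = inj₂ (inj₁ (1≤1+ (segment-nonneg t)))
  segment-order (next s) first = inj₂ (inj₂ (1≤1+ (segment-nonneg s)))
  segment-order (next {i = i} s) (next {i = j} t) with segment-order s t
  ... | inj₁ e = inj₁ e
  ... | inj₂ (inj₁ h) = inj₂ (inj₁ (shift≤ i h))
  ... | inj₂ (inj₂ h) = inj₂ (inj₂ (shift≤ j h))

  duration : List Point → ℚ
  duration (a ∷ ps@(b ∷ _)) = 1ℚ + duration ps
  duration _ = 0ℚ

  duration-nonneg : ∀ ps → 0ℚ ≤ duration ps
  duration-nonneg [] = ≤-refl
  duration-nonneg (a ∷ []) = ≤-refl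
  duration-nonneg (a ∷ b ∷ ps) = 1+-nonneg (duration-nonneg (b ∷ ps))

  segment-within : ∀ {ps i p q} → Segment ps i p q → i + 1ℚ ≤ duration ps
  segment-within (first {b = b} {ps}) = 1≤1+ (duration-nonneg (b ∷ ps))
  segment-within (next {ps = b ∷ ps} {i} s) = shift≤ i (segment-within s)

  At-start : ∀ a ps b → At (a ∷ ps ∷ʳ b) 0ℚ a
  At-start a [] b = here ≤-refl 0≤1 (sym (along-0 a b))
  At-start a (c ∷ ps) b = here ≤-refl 0≤1 (sym (along-0 a c))

  At-end : ∀ a ps b → At (a ∷ ps ∷ʳ b) (duration (a ∷ ps ∷ʳ b)) b
  At-end a [] b = here 0≤1 (≤-reflexive (+-identityʳ 1ℚ)) (sym (along-1 a b))
  At-end a (c ∷ ps) b = there (At-end c ps b)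

  corner-At : ∀ {a b ps z} → z ∈ b ∷ ps → ∃[ s ] (1ℚ ≤ s × At (a ∷ b ∷ ps) s z)
  corner-At {a} {b} (here refl) = 1ℚ , ≤-refl , here 0≤1 ≤-refl (sym (along-1 a b))
  corner-At {ps = c ∷ ps} (there h) =
    let (s , 1≤s , at) = corner-At h
    in 1ℚ + s , subst (_≤ 1ℚ + s) (+-identityʳ 1ℚ) (+-monoʳ-≤ 1ℚ (≤-trans 0≤1 1≤s)) , there at

  corner-On : ∀ {a b ps z} → z ∈ a ∷ b ∷ ps → On (a ∷ b ∷ ps) z
  corner-On {a} {b} (here refl) = 0ℚ , here ≤-refl 0≤1 (sym (along-0 a b))
  corner-On (there h) = let (s , _ , at) = corner-At h in s , at

  simple-unique : ∀ a b ps → IsSimple (a ∷ b ∷ ps) → Unique (a ∷ b ∷ ps)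
  simple-unique a b ps simple = All.tabulate (λ { h refl → fresh h }) ∷ rest ps simple
    where
    fresh : a ∉ b ∷ ps
    fresh h = let (s , 1≤s , at) = corner-At h
                  0≡s = simple (here ≤-refl 0≤1 (sym (along-0 a b))) at
              in <-irrefl 0≡s (<-≤-trans (positive⁻¹ 1ℚ) 1≤s)
    rest : ∀ ps → IsSimple (a ∷ b ∷ ps) → Unique (b ∷ ps)
    rest [] _ = [] ∷ []
    rest (c ∷ ps) simple = simple-unique b c ps λ u v → +-cancelˡ′ (simple (there u) (there v))
      where
      +-cancelˡ′ : ∀ {s t} → 1ℚ + s ≡ 1ℚ + t → s ≡ t
      +-cancelˡ′ {s} {t} e = trans (lemma s) (trans (cong (_- 1ℚ) e) (sym (lemma t)))
        where
        lemma : ∀ s → s ≡ 1ℚ + s - 1ℚ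
        lemma = solve 1 (λ s → s := con 1ℚ :+ s :- con 1ℚ) refl

  sum-cancel : ∀ {i t r} → i + t ≡ i + r → t ≡ r
  sum-cancel {i} {t} {r} e = trans (lemma i t) (trans (cong (_- i) e) (sym (lemma i r)))
    where
    lemma : ∀ i t → t ≡ i + t - i
    lemma = solve 2 (λ i t → t := i :+ t :- i) refl

  -- The chain `j ≤ j + r ≡ i + t ≤ i + 1ℚ ≤ j` collapses. So of two segments of a simple arc the
  -- earlier one can only contribute its last point, and the later one its first.
  squeeze : ∀ i {j t r} → i + 1ℚ ≤ j → t ≤ 1ℚ → 0ℚ ≤ r → i + t ≡ j + r → t ≡ 1ℚ × r ≡ 0ℚ
  squeeze i {j} {t} {r} i+1≤j t≤1 0≤r e = t≡1 , r≡0
    where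
    j≤ : j ≤ i + t
    j≤ = subst₂ _≤_ (+-identityʳ j) (sym e) (+-monoʳ-≤ j 0≤r)
    t≡1 : t ≡ 1ℚ
    t≡1 = sum-cancel {i} (≤-antisym (+-monoʳ-≤ i t≤1) (≤-trans i+1≤j j≤))
    r≡0 : r ≡ 0ℚ
    r≡0 = sum-cancel {j} (≤-antisym
      (≤-trans (≤-reflexive (sym e)) (≤-trans (+-monoʳ-≤ i t≤1)
        (≤-trans i+1≤j (≤-reflexive (sym (+-identityʳ j))))))
      (+-monoʳ-≤ j 0≤r))

  module _ {ps : List Point} (simple : IsSimple ps) where

    start-only : ∀ {i p q z} → Segment ps i p q → OnSegment p q z → At ps 0ℚ z → z ≡ p
    start-only {i} {p} {q} s (t , 0≤t , t≤1 , refl) at = trans (cong (along p q) t≡0) (along-0 p q)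
      where
      i+t≡0 : i + t ≡ 0ℚ
      i+t≡0 = simple (segment-At s 0≤t t≤1 refl) at
      t≡0 : t ≡ 0ℚ
      t≡0 = ≤-antisym (subst₂ _≤_ (+-identityˡ t) i+t≡0 (+-monoˡ-≤ t (segment-nonneg s))) 0≤t

    end-only : ∀ {i p q z} → Segment ps i p q → OnSegment p q z → At ps (duration ps) z → z ≡ q
    end-only {i} {p} {q} s (t , 0≤t , t≤1 , refl) at =
      trans (cong (along p q) (proj₁ (squeeze i (segment-within s) t≤1 ≤-refl
        (trans (simple (segment-At s 0≤t t≤1 refl) at) (sym (+-identityʳ _)))))) (along-1 p q)

    successive-meet : ∀ {i j p q a b} → Segment ps i p q → Segment ps j a b → i + 1ℚ ≤ j → MeetAtEnds p q a b
    successive-meet {i} {j} {p} {q} {a} {b} s s′ h = meetAtEnds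
      λ { (t , 0≤t , t≤1 , refl) (t′ , 0≤t′ , t′≤1 , e) →
        let (t≡1 , t′≡0) = squeeze i h t≤1 0≤t′ (simple (segment-At s 0≤t t≤1 refl) (segment-At s′ 0≤t′ t′≤1 e))
        in inj₂ (trans (cong (along p q) t≡1) (along-1 p q))
         , inj₁ (trans e (trans (cong (along a b) t′≡0) (along-0 a b))) }

    simple-segments : ∀ {p q a b} → (p , q) ∈ segments ps → (a , b) ∈ segments ps →
      (p , q) ≡ (a , b) ⊎ MeetAtEnds p q a b
    simple-segments h h′ with segment-of ps h | segment-of ps h′
    ... | i , s | j , s′ with segment-order s s′
    ... | inj₁ e = inj₁ e
    ... | inj₂ (inj₁ l) = inj₂ (successive-meet s s′ l)
    ... | inj₂ (inj₂ l) = inj₂ (meetAtEnds λ u v →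
            let (e , f) = common-ends (successive-meet s′ s l) v u in f , e)

  shear : ℚ → Point → Point
  shear t p = x p + t * y p , y p

  -- For points at different heights, equality of the sheared abscissae is a linear equation in `t`
  -- with one root, which serves as the bound. At equal heights the shear leaves the difference of
  -- the abscissae unchanged.
  shear-separates : ∀ p q → ∃[ r ] (∀ t → r < t → x (shear t p) ≡ x (shear t q) → p ≡ q)
  shear-separates p q with y p ≟ y q
  ... | yes yp≡yq = 0ℚ , λ t _ e → cong₂ _,_ (xs t (trans e (cong (λ z → x q + t * z) (sym yp≡yq)))) yp≡yq
    where
    xs : ∀ t → x p + t * y p ≡ x q + t * y p → x p ≡ x q
    xs t e = trans (lemma (x p) (t * y p)) (trans (cong (_- t * y p) e) (sym (lemma (x q) (t * y p))))
      where
      lemma : ∀ a b → a ≡ a + b - b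
      lemma = solve 2 (λ a b → a := a :+ b :- b) refl
  ... | no yp≢yq = (x q - x p) * 1/ d , λ t r<t e → ⊥-elim (<-irrefl (sym (forced t e)) r<t)
    where
    d = y p - y q
    d≢0 : d ≢ 0ℚ
    d≢0 e = yp≢yq (trans (lemma (y p) (y q)) (trans (cong (_+ y q) e) (+-identityˡ (y q))))
      where
      lemma : ∀ a b → a ≡ a - b + b
      lemma = solve 2 (λ a b → a := a :- b :+ b) refl
    instance _ = ≢-nonZero d≢0
    forced : ∀ t → x p + t * y p ≡ x q + t * y q → t ≡ (x q - x p) * 1/ d
    forced t e = begin
      t                    ≡⟨ *-identityʳ t ⟨
      t * 1ℚ               ≡⟨ cong (t *_) (*-inverseʳ d) ⟨
      t * (d * 1/ d)       ≡⟨ lemma (x p) (y p) (y q) t (1/ d) ⟩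
      ((x p + t * y p) - t * y q - x p) * 1/ d ≡⟨ cong (λ z → (z - t * y q - x p) * 1/ d) e ⟩
      ((x q + t * y q) - t * y q - x p) * 1/ d ≡⟨ lemma′ (x p) (x q) (t * y q) (1/ d) ⟩
      (x q - x p) * 1/ d   ∎
      where
      open ≡-Reasoning
      lemma : ∀ p p′ q′ t w → t * ((p′ - q′) * w) ≡ ((p + t * p′) - t * q′ - p) * w
      lemma = solve 5 (λ p p′ q′ t w → t :* ((p′ :- q′) :* w) := ((p :+ t :* p′) :- t :* q′ :- p) :* w) refl
      lemma′ : ∀ p q s w → ((q + s) - s - p) * w ≡ (q - p) * w
      lemma′ = solve 4 (λ p q s w → ((q :+ s) :- s :- p) :* w := (q :- p) :* w) refl

  shear-separates-pairs : ∀ (pairs : List (Point × Point)) →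
    ∃[ r ] (∀ t → r < t → ∀ {p q} → (p , q) ∈ pairs → x (shear t p) ≡ x (shear t q) → p ≡ q)
  shear-separates-pairs [] = 0ℚ , λ _ _ ()
  shear-separates-pairs ((p , q) ∷ pairs) with shear-separates p q | shear-separates-pairs pairs
  ... | r , sep | r′ , sep′ = r ⊔ r′ , λ where
    t h (here refl) → sep t (≤-<-trans (p≤p⊔q r r′) h)
    t h (there m) → sep′ t (≤-<-trans (p≤q⊔p r r′) h) m

  -- The parameter lies beyond the bounds of all pairs, of which there are finitely many. Distinct
  -- abscissae exclude vertical segments and corners vertically above one another.
  generic-shear : ∀ (ps : List Point) →
    ∃[ t ] (∀ {p q} → p ∈ ps → q ∈ ps → x (shear t p) ≡ x (shear t q) → p ≡ q)
  generic-shear ps with shear-separates-pairs (cartesianProduct ps ps)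
  ... | r , sep = r + 1ℚ , λ p∈ q∈ → sep (r + 1ℚ) r<r+1 (∈-cartesianProduct⁺ p∈ q∈)
    where
    r<r+1 : r < r + 1ℚ
    r<r+1 = subst (_< r + 1ℚ) (+-identityʳ r) (+-monoʳ-< r (positive⁻¹ 1ℚ))

  shear-along : ∀ s a b t → along (shear s a) (shear s b) t ≡ shear s (along a b t)
  shear-along s (a₁ , a₂) (b₁ , b₂) t = cong (_, _) (lemma s a₁ a₂ b₁ b₂ t)
    where
    lemma : ∀ s a₁ a₂ b₁ b₂ t → (1ℚ - t) * (a₁ + s * a₂) + t * (b₁ + s * b₂)
              ≡ ((1ℚ - t) * a₁ + t * b₁) + s * ((1ℚ - t) * a₂ + t * b₂)
    lemma = solve 6 (λ s a₁ a₂ b₁ b₂ t → (con 1ℚ :- t) :* (a₁ :+ s :* a₂) :+ t :* (b₁ :+ s :* b₂)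
              := ((con 1ℚ :- t) :* a₁ :+ t :* b₁) :+ s :* ((con 1ℚ :- t) :* a₂ :+ t :* b₂)) refl

  shear-injective : ∀ s {a b} → shear s a ≡ shear s b → a ≡ b
  shear-injective s {a} {b} e = cong₂ _,_
    (trans (lemma (x a) (y a) s) (trans (cong (λ z → x z - s * y z) e) (sym (lemma (x b) (y b) s))))
    (cong y e)
    where
    lemma : ∀ a a′ s → a ≡ a + s * a′ - s * a′
    lemma = solve 3 (λ a a′ s → a := a :+ s :* a′ :- s :* a′) refl

  shear-meet : ∀ s {a b p q} → MeetAtEnds a b p q → MeetAtEnds (shear s a) (shear s b) (shear s p) (shear s q)
  shear-meet s {a} {b} {p} {q} m = meetAtEnds
    λ { (t , 0≤t , t≤1 , refl) (t′ , 0≤t′ , t′≤1 , e) →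
      let e′ = shear-injective s (trans (sym (shear-along s a b t)) (trans e (shear-along s p q t′)))
          (u , v) = common-ends m (t , 0≤t , t≤1 , refl) (t′ , 0≤t′ , t′≤1 , e′)
          back : ∀ {w} → along a b t ≡ w → along (shear s a) (shear s b) t ≡ shear s w
          back = λ e → trans (shear-along s a b t) (cong (shear s) e)
      in [ inj₁ ∘ back , inj₂ ∘ back ]′ u , [ inj₁ ∘ back , inj₂ ∘ back ]′ v }

  segments-map : ∀ (f : Point → Point) ps {p q} → (p , q) ∈ segments (map f ps) →
    ∃[ a ] ∃[ b ] ((a , b) ∈ segments ps × p ≡ f a × q ≡ f b)
  segments-map f (a ∷ b ∷ ps) (here refl) = a , b , here refl , refl , refl
  segments-map f (a ∷ b ∷ ps) (there h) =
    let (c , d , m , e , e′) = segments-map f (b ∷ ps) h in c , d , there m , e , e′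

  edge-≡ : ∀ {G} (e f : Edge G) → src e ≡ src f → tgt e ≡ tgt f → e ≡ f
  edge-≡ (Graph.edge u v p a) (Graph.edge .u .v q b) refl refl =
    cong₂ (Graph.edge u v) (ℕₚ.<-irrelevant p q) (T-irrelevant a b)

  -- The arc of the edge with ends u < v is listed from u to v.
  record PlaneArcs (G : Graph) : Set where
    open Graph G using (Adj)
    field
      place         : Vertex G → Point
      arc         : Vertex G → Vertex G → List Point
      arc-empty   : ∀ {u v} → ¬ (u Fin.< v × Adj u v) → arc u v ≡ []
      arc-ends    : ∀ {u v} → u Fin.< v → Adj u v → ∃[ ps ] arc u v ≡ place u ∷ ps ∷ʳ place v
      arc-unique  : ∀ u v → Unique (arc u v)
      arc-vertex  : ∀ {u v w} → place w ∈ arc u v → w ≡ u ⊎ w ≡ v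
      arc-bend    : ∀ {u v u′ v′ z} → z ∈ arc u v → z ∈ arc u′ v′ →
                    (u ≡ u′ × v ≡ v′) ⊎ (z ≡ place u ⊎ z ≡ place v)
      x-separates : ∀ {u v u′ v′ z z′} → z ∈ arc u v → z′ ∈ arc u′ v′ → x z ≡ x z′ → z ≡ z′
      arc-meet    : ∀ {u v u′ v′ p q a b} → (p , q) ∈ segments (arc u v) → (a , b) ∈ segments (arc u′ v′) →
                    (u ≡ u′ × v ≡ v′ × (p , q) ≡ (a , b)) ⊎ MeetAtEnds p q a b

  module _ {G : Graph} (P : Planar G) where
    open Graph G using (Adj; Incident)
    open Planar P hiding (arc)

    private
      arcₑ : Edge G → List Point
      arcₑ = Planar.arc P

      edge? : ∀ u v → Dec (u Fin.< v × Adj u v)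
      edge? u v with u Finₚ.<? v | T? (Graph.adj G u v)
      ... | yes u<v | yes a = yes (u<v , a)
      ... | no ¬u<v | _ = no (¬u<v ∘ proj₁)
      ... | _ | no ¬a = no (¬a ∘ proj₂)

      raw : ∀ u v → Dec (u Fin.< v × Adj u v) → List Point
      raw u v (yes (u<v , a)) = arcₑ (Graph.edge u v u<v a)
      raw u v (no _) = []

      arc₀ : Vertex G → Vertex G → List Point
      arc₀ u v = raw u v (edge? u v)

      raw-edge : ∀ u v d {z} → z ∈ raw u v d → ∃[ e ] (src e ≡ u × tgt e ≡ v × raw u v d ≡ arcₑ e)
      raw-edge u v (yes (u<v , a)) _ = Graph.edge u v u<v a , refl , refl , refl

      nonempty-edge : ∀ {u v z} → z ∈ arc₀ u v → ∃[ e ] (src e ≡ u × tgt e ≡ v × arc₀ u v ≡ arcₑ e)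
      nonempty-edge {u} {v} = raw-edge u v (edge? u v)

      segments-∈ : ∀ ps {p q} → (p , q) ∈ segments ps → p ∈ ps
      segments-∈ (a ∷ b ∷ ps) (here refl) = here refl
      segments-∈ (a ∷ b ∷ ps) (there h) = there (segments-∈ (b ∷ ps) h)

      arcₑ-On : ∀ e {z} → z ∈ arcₑ e → On (arcₑ e) z
      arcₑ-On e h with bends e
      ... | [] = corner-On h
      ... | _ ∷ _ = corner-On h

      arcₑ-unique : ∀ e → Unique (arcₑ e)
      arcₑ-unique e with bends e | arcs-simple e
      ... | [] | simple = simple-unique _ _ _ simple
      ... | _ ∷ _ | simple = simple-unique _ _ _ simple

      -- The two ends of the arc are reached at time zero and at time `duration`, and by simplicity
      -- at no other time. A segment that contains such a point does so at its own first or last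
      -- moment.
      vertex-end : ∀ e {v p q z} → (p , q) ∈ segments (arcₑ e) → OnSegment p q z → Incident v e →
        z ≡ position v → z ≡ p ⊎ z ≡ q
      vertex-end e {p = p} {q} h z∈ (inj₁ refl) refl = let (_ , s) = segment-of (arcₑ e) h in
        inj₁ (start-only (arcs-simple e) s z∈ (At-start _ (bends e) _))
      vertex-end e {p = p} {q} h z∈ (inj₂ refl) refl = let (_ , s) = segment-of (arcₑ e) h in
        inj₂ (end-only (arcs-simple e) s z∈ (At-end _ (bends e) _))

      distinct-meet : ∀ e f → e ≢ f → ∀ {p q a b} → (p , q) ∈ segments (arcₑ e) → (a , b) ∈ segments (arcₑ f) →
        MeetAtEnds p q a b
      distinct-meet e f e≢f h h′ = meetAtEnds λ { {z} u u′ →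
        let (v , inc , inc′ , z≡v) = arcs-cross-free e f z e≢f (on e h u) (on f h′ u′)
        in vertex-end e h u inc z≡v , vertex-end f h′ u′ inc′ z≡v }
        where
        on : ∀ e {p q z} → (p , q) ∈ segments (arcₑ e) → OnSegment p q z → On (arcₑ e) z
        on e h (t , 0≤t , t≤1 , eq) = let (i , s) = segment-of (arcₑ e) h in i + t , segment-At s 0≤t t≤1 eq

      same? : ∀ (u v u′ v′ : Vertex G) → Dec (u ≡ u′ × v ≡ v′)
      same? u v u′ v′ with u Finₚ.≟ u′ | v Finₚ.≟ v′
      ... | yes p | yes q = yes (p , q)
      ... | no ¬p | _ = no (¬p ∘ proj₁)
      ... | _ | no ¬q = no (¬q ∘ proj₂)

      meet₀ : ∀ {u v u′ v′ p q a b} → (p , q) ∈ segments (arc₀ u v) → (a , b) ∈ segments (arc₀ u′ v′) →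
        (u ≡ u′ × v ≡ v′ × (p , q) ≡ (a , b)) ⊎ MeetAtEnds p q a b
      meet₀ {u} {v} {u′} {v′} h h′
        with nonempty-edge {u} {v} (segments-∈ _ h) | nonempty-edge {u′} {v′} (segments-∈ _ h′) | same? u v u′ v′
      ... | e , refl , refl , eq | f , refl , refl , eq′ | no d =
        inj₂ (distinct-meet e f (λ { refl → d (refl , refl) }) (subst (λ l → _ ∈ segments l) eq h) (subst (λ l → _ ∈ segments l) eq′ h′))
      ... | e , refl , refl , eq | f , _ , _ , eq′ | yes (refl , refl)
        with simple-segments (arcs-simple e) (subst (λ l → _ ∈ segments l) eq h) (subst (λ l → _ ∈ segments l) eq h′)
      ... | inj₁ same = inj₁ (refl , refl , same)
      ... | inj₂ m = inj₂ m

      pairs : List (Vertex G × Vertex G)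
      pairs = cartesianProduct (allFin _) (allFin _)

      corners : List Point
      corners = concatMap (λ (u , v) → arc₀ u v) pairs

      corner-∈ : ∀ {u v z} → z ∈ arc₀ u v → z ∈ corners
      corner-∈ {u} {v} h = ∈-concatMap⁺ (λ (u , v) → arc₀ u v)
        (lose (∈-cartesianProduct⁺ (∈-allFin u) (∈-allFin v)) h)

      t = proj₁ (generic-shear corners)

      unsheared : ∀ {u v z} → z ∈ map (shear t) (arc₀ u v) → ∃[ w ] (w ∈ arc₀ u v × z ≡ shear t w)
      unsheared = ∈-map⁻ (shear t)

      ends₀ : ∀ {u v} (d : Dec (u Fin.< v × Adj u v)) → u Fin.< v → Adj u v →
        ∃[ ps ] map (shear t) (raw u v d) ≡ shear t (position u) ∷ ps ∷ʳ shear t (position v)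
      ends₀ {u} {v} (yes (u<v , a)) _ _ = map (shear t) (bends (Graph.edge u v u<v a)) ,
        cong (_ ∷_) (map-++ (shear t) (bends (Graph.edge u v u<v a)) _)
      ends₀ (no ¬e) u<v a = contradiction (u<v , a) ¬e

      empty₀ : ∀ {u v} (d : Dec (u Fin.< v × Adj u v)) → ¬ (u Fin.< v × Adj u v) → map (shear t) (raw u v d) ≡ []
      empty₀ (yes e) ¬e = contradiction e ¬e
      empty₀ (no _) _ = refl

      unique₀ : ∀ {u v} (d : Dec (u Fin.< v × Adj u v)) → Unique (raw u v d)
      unique₀ {u} {v} (yes (u<v , a)) = arcₑ-unique (Graph.edge u v u<v a)
      unique₀ (no _) = []

      vertex₀ : ∀ {u v w} → position w ∈ arc₀ u v → w ≡ u ⊎ w ≡ v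
      vertex₀ {u} {v} {w} h with nonempty-edge {u} {v} h
      ... | e , refl , refl , eq with arcs-avoid-others e w (arcₑ-On e (subst (_ ∈_) eq h))
      ... | inj₁ r = inj₁ (sym r)
      ... | inj₂ r = inj₂ (sym r)

      bend₀ : ∀ {u v u′ v′ z} → z ∈ arc₀ u v → z ∈ arc₀ u′ v′ →
        (u ≡ u′ × v ≡ v′) ⊎ (z ≡ position u ⊎ z ≡ position v)
      bend₀ {u} {v} {u′} {v′} h h′ with nonempty-edge {u} {v} h | nonempty-edge {u′} {v′} h′ | same? u v u′ v′
      ... | _ | _ | yes s = inj₁ s
      ... | e , refl , refl , eq | f , refl , refl , eq′ | no d
        with arcs-cross-free e f _ (λ { refl → d (refl , refl) }) (arcₑ-On e (subst (_ ∈_) eq h)) (arcₑ-On f (subst (_ ∈_) eq′ h′))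
      ... | _ , inj₁ refl , _ , r = inj₂ (inj₁ r)
      ... | _ , inj₂ refl , _ , r = inj₂ (inj₂ r)

    planeArcs : PlaneArcs G
    planeArcs = record
      { place = λ v → shear t (position v)
      ; arc = λ u v → map (shear t) (arc₀ u v)
      ; arc-empty = λ {u} {v} → empty₀ (edge? u v)
      ; arc-ends = λ {u} {v} → ends₀ (edge? u v)
      ; arc-unique = λ u v → Uniqueₚ.map⁺ (shear-injective t) (unique₀ (edge? u v))
      ; arc-vertex = λ {u} {v} h → case unsheared {u} {v} h of λ (_ , h′ , e) →
          vertex₀ (subst (_∈ arc₀ u v) (sym (shear-injective t e)) h′)
      ; arc-bend = λ {u} {v} {u′} {v′} h h′ → case unsheared {u} {v} h of λ { (w , m , refl) →
          case unsheared {u′} {v′} h′ of λ (w′ , m′ , e) →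
            [ inj₁ , (λ r → inj₂ ([ inj₁ ∘ cong (shear t) , inj₂ ∘ cong (shear t) ]′ r)) ]′
              (bend₀ m (subst (_∈ arc₀ u′ v′) (sym (shear-injective t e)) m′)) }
      ; x-separates = λ {u} {v} {u′} {v′} h h′ e → case unsheared {u} {v} h of λ { (w , m , refl) →
          case unsheared {u′} {v′} h′ of λ { (w′ , m′ , refl) →
            cong (shear t) (proj₂ (generic-shear corners) (corner-∈ {u} {v} m) (corner-∈ {u′} {v′} m′) e) } }
      ; arc-meet = λ {u} {v} {u′} {v′} h h′ →
          case segments-map (shear t) (arc₀ u v) h of λ { (p , q , m , refl , refl) →
          case segments-map (shear t) (arc₀ u′ v′) h′ of λ { (a , b , m′ , refl , refl) →
            [ (λ (e , f , g) → inj₁ (e , f , cong (λ (p , q) → shear t p , shear t q) g)) , inj₂ ∘ shear-meet t ]′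
              (meet₀ {u} {v} {u′} {v′} m m′) } }
      }

-- Finite sums in a commutative monoid.

module Sums where

  open import Algebra.Structures using (IsCommutativeMonoid)
  open import Data.Bool.Base using (if_then_else_)
  open import Data.List.Base using (List; []; _∷_; filter)
  open import Data.List.Membership.Propositional using (_∈_)
  open import Data.List.Relation.Unary.All as All using (All)
  open import Data.List.Relation.Unary.Any using (here; there)
  open import Data.List.Relation.Unary.AllPairs using ([]; _∷_)
  open import Data.List.Relation.Unary.Unique.Propositional using (Unique)
  open import Relation.Binary.PropositionalEquality
  open import Relation.Nullary using (does; yes; no)
  open import Relation.Unary using (Pred; Decidable)
  open import Function.Base using (_∘_)
  open import Level using (0ℓ)

  module Sum {A : Set} (_∙_ : A → A → A) (ε : A) (isCM : IsCommutativeMonoid _≡_ _∙_ ε) where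
    open IsCommutativeMonoid isCM using (assoc; comm; identityˡ; identityʳ)
    open ≡-Reasoning

    module _ {I : Set} where

      ∑ : List I → (I → A) → A
      ∑ [] f = ε
      ∑ (i ∷ is) f = f i ∙ ∑ is f

      ∑-cong : ∀ is {f g : I → A} → (∀ {i} → i ∈ is → f i ≡ g i) → ∑ is f ≡ ∑ is g
      ∑-cong [] e = refl
      ∑-cong (i ∷ is) e = cong₂ _∙_ (e (here refl)) (∑-cong is (e ∘ there))

      ∑-zero : ∀ is {f : I → A} → (∀ {i} → i ∈ is → f i ≡ ε) → ∑ is f ≡ ε
      ∑-zero [] e = refl
      ∑-zero (i ∷ is) e = trans (cong₂ _∙_ (e (here refl)) (∑-zero is (e ∘ there))) (identityˡ ε)

      ∑-∙ : ∀ is (f g : I → A) → ∑ is (λ i → f i ∙ g i) ≡ ∑ is f ∙ ∑ is g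
      ∑-∙ [] f g = sym (identityˡ ε)
      ∑-∙ (i ∷ is) f g = begin
        (f i ∙ g i) ∙ ∑ is (λ i → f i ∙ g i) ≡⟨ cong ((f i ∙ g i) ∙_) (∑-∙ is f g) ⟩
        (f i ∙ g i) ∙ (∑ is f ∙ ∑ is g)       ≡⟨ assoc (f i) (g i) _ ⟩
        f i ∙ (g i ∙ (∑ is f ∙ ∑ is g))       ≡⟨ cong (f i ∙_) (assoc (g i) _ _) ⟨
        f i ∙ ((g i ∙ ∑ is f) ∙ ∑ is g)       ≡⟨ cong (λ z → f i ∙ (z ∙ ∑ is g)) (comm (g i) _) ⟩
        f i ∙ ((∑ is f ∙ g i) ∙ ∑ is g)       ≡⟨ cong (f i ∙_) (assoc _ (g i) _) ⟩
        f i ∙ (∑ is f ∙ (g i ∙ ∑ is g))       ≡⟨ assoc (f i) _ _ ⟨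
        (f i ∙ ∑ is f) ∙ (g i ∙ ∑ is g)       ∎

      ∑-single : ∀ {is i} {f : I → A} → Unique is → i ∈ is → (∀ {j} → j ≢ i → f j ≡ ε) → ∑ is f ≡ f i
      ∑-single {i ∷ is} {f = f} (fresh ∷ _) (here refl) e = trans
        (cong (f i ∙_) (∑-zero is (λ j∈ → e (λ { refl → All.lookup fresh j∈ refl })))) (identityʳ (f i))
      ∑-single {j ∷ is} {i} {f} (fresh ∷ u) (there i∈) e = trans
        (cong (_∙ ∑ is f) (e (λ { refl → All.lookup fresh i∈ refl }))) (trans (identityˡ _) (∑-single u i∈ e))

      ∑-filter : ∀ {P : Pred I 0ℓ} (P? : Decidable P) is (f : I → A) →
        ∑ (filter P? is) f ≡ ∑ is (λ i → if does (P? i) then f i else ε)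
      ∑-filter P? [] f = refl
      ∑-filter P? (i ∷ is) f with P? i
      ... | yes _ = cong (f i ∙_) (∑-filter P? is f)
      ... | no _ = trans (∑-filter P? is f) (sym (identityˡ _))

    ∑-comm : ∀ {I J : Set} (is : List I) (js : List J) (f : I → J → A) →
      ∑ is (λ i → ∑ js (f i)) ≡ ∑ js (λ j → ∑ is (λ i → f i j))
    ∑-comm [] js f = sym (∑-zero js {f = λ _ → ε} (λ _ → refl))
    ∑-comm (i ∷ is) js f = trans (cong (∑ js (f i) ∙_) (∑-comm is js f)) (sym (∑-∙ js (f i) (λ j → ∑ is (λ i → f i j))))

-- Neighbours within a set of vertices.

module Induced where

  open import Data.Bool.Base using (Bool; T; _∧_)
  open import Data.Bool.Properties using (T?; T-∧)
  open import Data.List.Base using (List; filter; allFin)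
  open import Data.List.Membership.Propositional using (_∈_)
  open import Data.List.Membership.Propositional.Properties using (∈-filter⁺; ∈-filter⁻; ∈-allFin)
  open import Data.List.Relation.Unary.Unique.Propositional using (Unique)
  open import Data.List.Relation.Unary.Unique.Propositional.Properties using (allFin⁺; filter⁺)
  open import Data.Product.Base using (_×_; _,_; proj₂)
  open import Function.Bundles using (Equivalence)
  open import Relation.Binary.PropositionalEquality using (subst)

  module _ (G : Graph) where
    open Graph G using (Vertex; Adj; adj; adj-sym; order)

    -- A subgraph is represented by the set `C` of its vertices inside the fixed graph `G`. Deletion
    -- changes only `C`, so the drawing and the girth bound of `G` serve for all induced subgraphs.
    nbrs : (Vertex → Bool) → Vertex → List Vertex
    nbrs C v = filter (λ u → T? (C u ∧ adj v u)) (allFin order)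

    ∈-nbrs⁺ : ∀ C {u v} → T (C u) → Adj v u → u ∈ nbrs C v
    ∈-nbrs⁺ C {u} {v} c a = ∈-filter⁺ (λ u → T? (C u ∧ adj v u)) (∈-allFin u) (Equivalence.from T-∧ (c , a))

    ∈-nbrs⁻ : ∀ C {u v} → u ∈ nbrs C v → T (C u) × Adj v u
    ∈-nbrs⁻ C {u} {v} h = Equivalence.to T-∧ (proj₂ (∈-filter⁻ (λ u → T? (C u ∧ adj v u)) {xs = allFin order} h))

    Adj-sym : ∀ {u v} → Adj u v → Adj v u
    Adj-sym {u} {v} = subst T (adj-sym u v)

    nbrs-unique : ∀ C v → Unique (nbrs C v)
    nbrs-unique C v = filter⁺ _ (allFin⁺ order)

-- Cycles contained in walks without backtracking.

module Walks where

  open import Data.Bool.Base using (T)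
  open import Data.Empty using (⊥-elim)
  open import Data.Fin.Properties using (_≟_)
  open import Data.List.Base using (List; []; _∷_; _++_; _∷ʳ_; length; applyUpTo)
  open import Data.List.Membership.Propositional using (_∈_; _∉_)
  open import Data.List.Membership.Propositional.Properties
    using (∈-∃++; ∈-++⁺ˡ; ∈-++⁺ʳ; ∈-applyUpTo⁺)
  open import Data.List.Properties using (length-++; length-applyUpTo)
  open import Data.List.Relation.Unary.All as All using (All; []; _∷_)
  open import Data.List.Relation.Unary.Any as Any using (here; there)
  open import Data.List.Relation.Unary.AllPairs using ([]; _∷_)
  open import Data.List.Relation.Unary.Linked using (Linked; []; [-]; _∷_)
  open import Data.List.Relation.Unary.Unique.Propositional using (Unique)
  open import Data.Nat.Base
  open import Data.Nat.Properties hiding (_≟_)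
  open import Data.Product.Base using (_×_; _,_; proj₁; proj₂; ∃-syntax)
  open import Data.Sum.Base using (_⊎_; inj₁; inj₂)
  open import Data.Unit.Base using (⊤; tt)
  open import Function.Base using (_∘_)
  open import Relation.Binary.PropositionalEquality
  open import Relation.Nullary using (¬_; yes; no)

  module _ (G : Graph) where
    open Graph G

    NoBacktrack : List Vertex → Set
    NoBacktrack (a ∷ ws@(_ ∷ c ∷ _)) = a ≢ c × NoBacktrack ws
    NoBacktrack _ = ⊤

    no-backtrack-tail : ∀ a ws → NoBacktrack (a ∷ ws) → NoBacktrack ws
    no-backtrack-tail a [] _ = tt
    no-backtrack-tail a (_ ∷ []) _ = tt
    no-backtrack-tail a (_ ∷ _ ∷ _) (_ , h) = h

    linked-prefix : ∀ {v} pre {post} → Linked Adj (pre ++ v ∷ post) → Linked Adj (pre ∷ʳ v)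
    linked-prefix [] _ = [-]
    linked-prefix (_ ∷ []) (a ∷ l) = a ∷ [-]
    linked-prefix (_ ∷ b ∷ pre) (a ∷ l) = a ∷ linked-prefix (b ∷ pre) l

    loopless : ∀ {v} → ¬ Adj v v
    loopless {v} = subst T (adj-irrefl v)

    unique-prefix : ∀ pre {v : Vertex} {post} → Unique (pre ++ v ∷ post) → Unique pre × v ∉ pre
    unique-prefix [] _ = [] , λ ()
    unique-prefix (c ∷ pre) (fresh ∷ u) = let (u′ , v∉) = unique-prefix pre u in
      (All.tabulate (λ h → All.lookup fresh (∈-++⁺ˡ h)) ∷ u′)
      , λ { (here refl) → All.lookup fresh (∈-++⁺ʳ pre (here refl)) refl ; (there h) → v∉ h }

    -- The tail is treated first. If its vertices are distinct and the head recurs among them, the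
    -- stretch up to the recurrence closes into a cycle; it has at least three vertices because
    -- there are no loops and no backtracking.
    walk-cycle : ∀ ws → Linked Adj ws → NoBacktrack ws →
      Unique ws ⊎ ∃[ c ] (IsCycle c × length c < length ws)
    walk-cycle [] _ _ = inj₁ []
    walk-cycle (v ∷ []) _ _ = inj₁ ([] ∷ [])
    walk-cycle (v ∷ ws@(w ∷ _)) l@(_ ∷ l′) nb with walk-cycle ws l′ (no-backtrack-tail v ws nb)
    ... | inj₂ (c , cyc , le) = inj₂ (c , cyc , <-trans le (n<1+n _))
    ... | inj₁ u with Any.any? (v ≟_) ws
    ... | no v∉ = inj₁ (All.tabulate (λ { h refl → v∉ h }) ∷ u)
    ... | yes v∈ with ∈-∃++ v∈
    ... | pre , post , eq = inj₂ (v ∷ pre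
      , (long pre (subst (λ r → Linked Adj (v ∷ r)) eq l) (subst (λ r → NoBacktrack (v ∷ r)) eq nb)
        , (All.tabulate (λ { h refl → proj₂ fresh h }) ∷ proj₁ fresh)
        , linked-prefix (v ∷ pre) (subst (λ r → Linked Adj (v ∷ r)) eq l))
      , s≤s (subst (λ r → suc (length pre) ≤ length r) (sym eq)
          (≤-trans (m<m+n (length pre) (s≤s z≤n)) (≤-reflexive (sym (length-++ pre))))))
      where
      fresh = unique-prefix pre (subst Unique eq u)
      long : ∀ pre {post} → Linked Adj (v ∷ pre ++ v ∷ post) → NoBacktrack (v ∷ pre ++ v ∷ post) → 3 ≤ length (v ∷ pre)
      long [] (a ∷ _) _ = ⊥-elim (loopless a)
      long (_ ∷ []) _ (v≢v , _) = ⊥-elim (v≢v refl)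
      long (_ ∷ _ ∷ _) _ _ = s≤s (s≤s (s≤s z≤n))

    applyUpTo-linked : ∀ (w : ℕ → Vertex) k → (∀ i → Adj (w i) (w (suc i))) → Linked Adj (applyUpTo w k)
    applyUpTo-linked w 0 _ = []
    applyUpTo-linked w 1 _ = [-]
    applyUpTo-linked w (suc (suc k)) a = a 0 ∷ applyUpTo-linked (w ∘ suc) (suc k) (a ∘ suc)

    applyUpTo-no-backtrack : ∀ (w : ℕ → Vertex) k → (∀ i → w i ≢ w (suc (suc i))) → NoBacktrack (applyUpTo w k)
    applyUpTo-no-backtrack w 0 _ = tt
    applyUpTo-no-backtrack w 1 _ = tt
    applyUpTo-no-backtrack w 2 _ = tt
    applyUpTo-no-backtrack w (suc (suc (suc k))) h = h 0 , applyUpTo-no-backtrack (w ∘ suc) (suc (suc k)) (h ∘ suc)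

    -- Listed up to and including its return, the walk has `suc p` entries and repeats its start, so
    -- the alternative of distinct vertices fails. Applied to an orbit of darts, this bounds its
    -- length below by the girth.
    closed-walk-cycle : ∀ (w : ℕ → Vertex) p → 0 < p → (∀ i → Adj (w i) (w (suc i))) →
      (∀ i → w i ≢ w (suc (suc i))) → w p ≡ w 0 → ∃[ c ] (IsCycle c × length c ≤ p)
    closed-walk-cycle w (suc p) _ a nb e
      with walk-cycle (applyUpTo w (suc (suc p))) (applyUpTo-linked w _ a) (applyUpTo-no-backtrack w _ nb)
    ... | inj₂ (c , cyc , le) = c , cyc , s≤s⁻¹ (≤-trans le (≤-reflexive (length-applyUpTo w (suc (suc p)))))
    ... | inj₁ (fresh ∷ _) = ⊥-elim (All.lookup fresh (subst (_∈ applyUpTo (w ∘ suc) (suc p)) e (∈-applyUpTo⁺ (w ∘ suc) (n<1+n p))) refl)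

-- Crossing parities of an even set of edges.

module Parity where

  open Geometry using (x)
  open Above
  open Segments
  open Drawing using (PlaneArcs; segments)
  open Sums
  open import Algebra.Bundles using (CommutativeRing; CommutativeMonoid)
  open import Data.Bool.Base using (Bool; true; false; _∧_; _xor_; T)
  open import Data.Bool.Properties
  open import Data.Bool.Solver using (module xor-∧-Solver)
  open import Data.Empty using (⊥-elim)
  import Data.Fin.Properties as Finₚ
  open import Data.List.Base using (List; []; _∷_; _++_; _∷ʳ_; allFin)
  open import Data.List.Membership.Propositional using (_∈_; _∉_)
  open import Data.List.Membership.Propositional.Properties using (∈-++⁺ʳ)
  open import Data.List.Relation.Unary.All as All using (All; []; _∷_)
  open import Data.List.Relation.Unary.Any using (here; there)
  open import Data.List.Relation.Unary.AllPairs using ([]; _∷_)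
  open import Data.List.Relation.Unary.Unique.Propositional using (Unique)
  open import Data.List.Relation.Unary.Unique.Propositional.Properties using (allFin⁺)
  open import Data.Product.Base using (_×_; _,_; proj₁; ∃-syntax)
  open import Data.Rational.Base using (0ℚ)
  open import Data.Sum.Base using (inj₁; inj₂)
  open import Function.Base using (_∘_)
  open import Relation.Binary.PropositionalEquality
  open import Relation.Nullary using (yes; no; does)
  open import Relation.Nullary.Decidable using (dec-true; dec-false)
  open import Relation.Binary.Definitions using (tri<; tri≈; tri>)
  open xor-∧-Solver using (solve; _:=_; _:+_; _:*_)
  open Sum _xor_ false (CommutativeMonoid.isCommutativeMonoid (CommutativeRing.+-commutativeMonoid xor-∧-commutativeRing)) public

  ∑-scale : ∀ {I : Set} is (b : Bool) (f : I → Bool) → ∑ is (λ i → b ∧ f i) ≡ b ∧ ∑ is f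
  ∑-scale is true f = ∑-cong is (λ _ → refl)
  ∑-scale is false f = ∑-zero is (λ _ → refl)

  xor-cancel : ∀ {a b} → a xor b ≡ false → a ≡ b
  xor-cancel {false} {false} _ = refl
  xor-cancel {true} {true} _ = refl

  -- This is the part of `over` that looks at the direction towards `q`. The other part,
  -- `passesAbove`, sees only `p`.
  localOver : (a b p q : Point) → Bool
  localOver a b p q = ((a ≈ᵇ p) ∧ startsAbove p b q) xor ((b ≈ᵇ p) ∧ startsAbove p a q)

  ∑ₛ : List Point → (Point → Point → Bool) → Bool
  ∑ₛ ps f = ∑ (segments ps) (λ (a , b) → f a b)

  segment-ends : ∀ ps {a b} → (a , b) ∈ segments ps → a ∈ ps × b ∈ ps
  segment-ends (a ∷ b ∷ ps) (here refl) = here refl , there (here refl)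
  segment-ends (a ∷ b ∷ ps) (there h) = let (u , v) = segment-ends (b ∷ ps) h in there u , there v

  segment-proper : ∀ {ps a b} → Unique ps → (a , b) ∈ segments ps → a ≢ b
  segment-proper {a ∷ b ∷ ps} (fresh ∷ _) (here refl) = All.head fresh
  segment-proper {a ∷ b ∷ ps} (_ ∷ u) (there h) = segment-proper u h

  telescope : ∀ (h : Point → Bool) a ps b → ∑ₛ (a ∷ ps ∷ʳ b) (λ p q → h p xor h q) ≡ h a xor h b
  telescope h a [] b = xor-identityʳ _
  telescope h a (c ∷ ps) b = trans (cong ((h a xor h c) xor_) (telescope h c ps b))
    (solve 3 (λ a c b → (a :+ c) :+ (c :+ b) := a :+ b) refl (h a) (h c) (h b))

  module _ (p q : Point) where
    local-absent : ∀ ps → p ∉ ps → ∑ₛ ps (λ a b → localOver a b p q) ≡ false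
    local-absent ps p∉ = ∑-zero (segments ps) λ { {a , b} h → let (a∈ , b∈) = segment-ends ps h in
      cong₂ (λ u v → (u ∧ startsAbove p b q) xor (v ∧ startsAbove p a q)) (≈ᵇ-false (λ { refl → p∉ a∈ })) (≈ᵇ-false (λ { refl → p∉ b∈ })) }

    local-first : ∀ {b ps} → Unique (p ∷ b ∷ ps) → ∑ₛ (p ∷ b ∷ ps) (λ a b → localOver a b p q) ≡ startsAbove p b q
    local-first {b} {ps} (fresh ∷ _)
      rewrite ≈ᵇ-refl p | ≈ᵇ-false (All.head fresh ∘ sym)
            | local-absent (b ∷ ps) (λ h → All.lookup fresh h refl) =
      trans (xor-identityʳ _) (xor-identityʳ _)

    local-inner : ∀ l {a b r} → Unique (l ++ a ∷ p ∷ b ∷ r) →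
      ∑ₛ (l ++ a ∷ p ∷ b ∷ r) (λ a b → localOver a b p q) ≡ startsAbove p a q xor startsAbove p b q
    local-inner [] {a} {b} {r} (fresh ∷ u)
      rewrite local-first u | ≈ᵇ-refl p | ≈ᵇ-false (All.head fresh) = refl
    local-inner (c ∷ []) {a} {b} {r} (fresh ∷ u@(fresh′ ∷ _))
      rewrite local-inner [] u | ≈ᵇ-false (All.head (All.tail fresh)) | ≈ᵇ-false (All.head fresh′) = refl
    local-inner (c ∷ d ∷ l) {a} {b} {r} (fresh ∷ u@(fresh′ ∷ _))
      rewrite local-inner (d ∷ l) u
            | ≈ᵇ-false (λ e → All.lookup fresh (there (∈-++⁺ʳ l (there (here refl)))) e)
            | ≈ᵇ-false (λ e → All.lookup fresh′ (∈-++⁺ʳ l (there (here refl))) e) = refl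

    local-last : ∀ l {a} → Unique (l ++ a ∷ p ∷ []) →
      ∑ₛ (l ++ a ∷ p ∷ []) (λ a b → localOver a b p q) ≡ startsAbove p a q
    local-last [] {a} (fresh ∷ u) rewrite ≈ᵇ-refl p | ≈ᵇ-false (All.head fresh) = xor-identityʳ _
    local-last (c ∷ []) {a} (fresh ∷ u@(fresh′ ∷ _))
      rewrite local-last [] u | ≈ᵇ-false (All.head (All.tail fresh)) | ≈ᵇ-false (All.head fresh′) = refl
    local-last (c ∷ d ∷ l) {a} (fresh ∷ u@(fresh′ ∷ _))
      rewrite local-last (d ∷ l) u
            | ≈ᵇ-false (λ e → All.lookup fresh (there (∈-++⁺ʳ l (there (here refl)))) e)
            | ≈ᵇ-false (λ e → All.lookup fresh′ (∈-++⁺ʳ l (there (here refl))) e) = refl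

  -- The origin is a filler for lists with fewer than two entries. The arc of an edge contains at
  -- least its two end vertices.
  second penultimate : List Point → Point
  second (_ ∷ b ∷ _) = b
  second _ = 0ℚ , 0ℚ
  penultimate (a ∷ _ ∷ []) = a
  penultimate (_ ∷ ps@(_ ∷ _ ∷ _)) = penultimate ps
  penultimate _ = 0ℚ , 0ℚ

  module _ {G : Graph} (PA : PlaneArcs G) where
    open Graph G using (Vertex; Adj; adj; adj-sym; adj-irrefl; order)
    open PlaneArcs PA

    private
      V = allFin order
      V-unique = allFin⁺ order

    Corner : Point → Set
    Corner z = ∃[ u ] ∃[ v ] z ∈ arc u v

    x-injective : ∀ {p q} → Corner p → Corner q → x p ≡ x q → p ≡ q
    x-injective (_ , _ , h) (_ , _ , h′) = x-separates h h′

    -- A symmetric `S` holds for both orientations of an edge, but `arc u v` is empty unless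
    -- `u < v`, so every edge is counted once.
    overAll : (Vertex → Vertex → Bool) → Point → Point → Bool
    overAll S p q = ∑ V λ u → ∑ V λ v → S u v ∧ ∑ₛ (arc u v) (λ a b → over a b p q)

    localAll : (Vertex → Vertex → Bool) → Point → Point → Bool
    localAll S p q = ∑ V λ u → ∑ V λ v → S u v ∧ ∑ₛ (arc u v) (λ a b → localOver a b p q)

    ∑∑-∧-xor : ∀ (S f g : Vertex → Vertex → Bool) →
      (∑ V λ u → ∑ V λ v → S u v ∧ (f u v xor g u v))
        ≡ (∑ V λ u → ∑ V λ v → S u v ∧ f u v) xor (∑ V λ u → ∑ V λ v → S u v ∧ g u v)
    ∑∑-∧-xor S f g = trans
      (∑-cong V (λ {u} _ → trans (∑-cong V (λ {v} _ → ∧-distribˡ-xor (S u v) (f u v) (g u v)))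
                                 (∑-∙ V (λ v → S u v ∧ f u v) (λ v → S u v ∧ g u v))))
      (∑-∙ V _ _)

    passing : (Vertex → Vertex → Bool) → Point → Bool
    passing S p = ∑ V λ u → ∑ V λ v → S u v ∧ ∑ₛ (arc u v) (λ a b → passesAbove p a b)

    -- The summand `passing` is the same for all segments that start at `p`. When sides around `p`
    -- are compared it cancels, and only the arcs through `p` remain.
    overAll-split : ∀ S p q → overAll S p q ≡ passing S p xor localAll S p q
    overAll-split S p q = trans
      (∑-cong V λ {u} _ → ∑-cong V λ {v} _ → cong (S u v ∧_) (∑-∙ (segments (arc u v)) _ _))
      (∑∑-∧-xor S _ _)

    overAll-additive : ∀ S S′ p q → overAll (λ u v → S u v xor S′ u v) p q ≡ overAll S p q xor overAll S′ p q
    overAll-additive S S′ p q = trans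
      (∑-cong V (λ {u} _ → trans (∑-cong V (λ {v} _ → ∧-distribʳ-xor _ (S u v) (S′ u v))) (∑-∙ V _ _)))
      (∑-∙ V _ _)

    record Even (S : Vertex → Vertex → Bool) : Set where
      field
        S-sym  : ∀ u v → S u v ≡ S v u
        S-adj  : ∀ u v → S u v ≡ true → Adj u v
        S-even : ∀ u → ∑ V (S u) ≡ false

      S-irrefl : ∀ u → S u u ≡ false
      S-irrefl u with S u u in e
      ... | false = refl
      ... | true = ⊥-elim (subst T (adj-irrefl u) (S-adj u u e))

    _<ᶠ_ : Vertex → Vertex → Bool
    u <ᶠ v = does (u Finₚ.<? v)

    <ᶠ-split : ∀ (f : Vertex → Bool) u → f u ≡ false → ∀ v → ((u <ᶠ v) ∧ f v) xor ((v <ᶠ u) ∧ f v) ≡ f v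
    <ᶠ-split f u fu v with Finₚ.<-cmp u v
    ... | tri< a _ c rewrite dec-true (u Finₚ.<? v) a | dec-false (v Finₚ.<? u) c = xor-identityʳ _
    ... | tri> a _ c rewrite dec-false (u Finₚ.<? v) a | dec-true (v Finₚ.<? u) c = refl
    ... | tri≈ a refl c rewrite dec-false (u Finₚ.<? v) a = sym fu

    module _ {S : Vertex → Vertex → Bool} (even : Even S) where
      open Even even

      -- Collected by vertices, the sum contains `h u` once for each edge of `S` at `u`, hence an
      -- even number of times.
      handshake : ∀ (h : Vertex → Bool) → (∑ V λ u → ∑ V λ v → ((u <ᶠ v) ∧ S u v) ∧ (h u xor h v)) ≡ false
      handshake h = begin
        (∑ V λ u → ∑ V λ v → S′ u v ∧ (h u xor h v))
          ≡⟨ ∑∑-∧-xor S′ (λ u _ → h u) (λ _ v → h v) ⟩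
        (∑ V λ u → ∑ V λ v → S′ u v ∧ h u) xor (∑ V λ u → ∑ V λ v → S′ u v ∧ h v)
          ≡⟨ cong ((∑ V λ u → ∑ V λ v → S′ u v ∧ h u) xor_) (∑-comm V V _) ⟩
        (∑ V λ u → ∑ V λ v → S′ u v ∧ h u) xor (∑ V λ v → ∑ V λ u → S′ u v ∧ h v)
          ≡⟨ ∑-∙ V _ _ ⟨
        (∑ V λ u → (∑ V λ v → S′ u v ∧ h u) xor (∑ V λ v → S′ v u ∧ h u))
          ≡⟨ ∑-zero V (λ {u} _ → vanish u) ⟩
        false ∎
        where
        open ≡-Reasoning
        S′ : Vertex → Vertex → Bool
        S′ u v = (u <ᶠ v) ∧ S u v
        vanish : ∀ u → (∑ V λ v → S′ u v ∧ h u) xor (∑ V λ v → S′ v u ∧ h u) ≡ false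
        vanish u = begin
          (∑ V λ v → S′ u v ∧ h u) xor (∑ V λ v → S′ v u ∧ h u)
            ≡⟨ ∑-∙ V _ _ ⟨
          (∑ V λ v → (S′ u v ∧ h u) xor (S′ v u ∧ h u))
            ≡⟨ ∑-cong V (λ {v} _ → trans
                 (solve 3 (λ a b h → (a :* h) :+ (b :* h) := h :* (a :+ b)) refl (S′ u v) (S′ v u) (h u))
                 (cong (h u ∧_) (trans (cong (λ z → S′ u v xor ((v <ᶠ u) ∧ z)) (S-sym v u))
                                       (<ᶠ-split (S u) u (S-irrefl u) v)))) ⟩
          (∑ V λ v → h u ∧ S u v)
            ≡⟨ ∑-scale V (h u) (S u) ⟩
          h u ∧ ∑ V (S u)
            ≡⟨ trans (cong (h u ∧_) (S-even u)) (∧-zeroʳ (h u)) ⟩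
          false ∎

      -- Along each arc of `S` the change between the two ends of `pq` is a telescoping sum of
      -- `liesAbove`, so it depends only on the end vertices of the arc, and by `handshake` these
      -- contributions cancel. This is the step where evenness replaces the Jordan curve theorem.
      arc-parity : ∀ {u v p q} → (p , q) ∈ segments (arc u v) → overAll S p q ≡ overAll S q p
      arc-parity {u₀} {v₀} {p} {q} pq = xor-cancel (begin
        overAll S p q xor overAll S q p
          ≡⟨ ∑∑-∧-xor S _ _ ⟨
        (∑ V λ u → ∑ V λ v → S u v ∧ (∑ₛ (arc u v) (λ a b → over a b p q) xor ∑ₛ (arc u v) (λ a b → over a b q p)))
          ≡⟨ ∑-cong V (λ {u} _ → ∑-cong V (λ {v} _ → per-arc u v)) ⟩
        (∑ V λ u → ∑ V λ v → ((u <ᶠ v) ∧ S u v) ∧ (h (place u) xor h (place v)))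
          ≡⟨ handshake (h ∘ place) ⟩
        false ∎)
        where
        open ≡-Reasoning
        h : Point → Bool
        h z = liesAbove z p q
        per-segment : ∀ u v {a b} → (a , b) ∈ segments (arc u v) →
          over a b p q xor over a b q p ≡ h a xor h b
        per-segment u v {a} {b} ab with arc-meet {u} {v} {u₀} {v₀} ab pq
        ... | inj₁ (_ , _ , refl) = self-parity Corner x-injective (segment-proper (arc-unique u v) ab)
        ... | inj₂ m =
          let (a∈ , b∈) = segment-ends (arc u v) ab
              (p∈ , q∈) = segment-ends (arc u₀ v₀) pq
          in segment-parity Corner x-injective (u , v , a∈) (u , v , b∈) (u₀ , v₀ , p∈) (u₀ , v₀ , q∈)
               (segment-proper (arc-unique u v) ab) (segment-proper (arc-unique u₀ v₀) pq) m
        per-arc : ∀ u v → S u v ∧ (∑ₛ (arc u v) (λ a b → over a b p q) xor ∑ₛ (arc u v) (λ a b → over a b q p))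
          ≡ ((u <ᶠ v) ∧ S u v) ∧ (h (place u) xor h (place v))
        per-arc u v with S u v in e
        ... | false = sym (cong (_∧ (h (place u) xor h (place v))) (∧-zeroʳ (u <ᶠ v)))
        ... | true = trans (sym (∑-∙ (segments (arc u v)) _ _))
                       (trans (∑-cong (segments (arc u v)) (λ { {a , b} → per-segment u v })) ends)
          where
          ends : ∑ₛ (arc u v) (λ a b → h a xor h b) ≡ ((u <ᶠ v) ∧ true) ∧ (h (place u) xor h (place v))
          ends with u Finₚ.<? v
          ... | yes u<v rewrite dec-true (u Finₚ.<? v) u<v = let (ps , eq) = arc-ends u<v (S-adj u v e) in
            trans (cong (λ l → ∑ₛ l (λ a b → h a xor h b)) eq) (telescope h (place u) ps (place v))
          ... | no ¬u<v rewrite dec-false (u Finₚ.<? v) ¬u<v =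
            cong (λ l → ∑ₛ l (λ a b → h a xor h b)) (arc-empty (¬u<v ∘ proj₁))

-- Sides of darts and the cyclic order of edges around a vertex.

module Rotation where

  open Above
  open Segments
  open Drawing using (PlaneArcs; segments)
  open Parity
  open Induced
  open import Data.Bool.Base using (Bool; true; false; not; _∧_; _∨_; _xor_; T; if_then_else_)
  open import Data.Bool.Properties
  open import Data.Bool.Solver using (module xor-∧-Solver)
  open import Data.Empty using (⊥-elim)
  open import Data.Fin.Base as Fin using (Fin)
  import Data.Fin.Properties as Finₚ
  open import Data.List.Base using (List; []; _∷_; [_]; _++_; _∷ʳ_; allFin)
  open import Data.List.Membership.Propositional using (_∈_)
  open import Data.List.Membership.Propositional.Properties using (∈-allFin; ∈-++⁺ʳ)
  open import Data.List.Properties using (++-assoc)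
  import Data.List.Relation.Unary.All as All
  import Data.List.Relation.Unary.AllPairs as AllPairs
  open import Data.List.Relation.Unary.Any using (here; there)
  open import Data.List.Relation.Unary.Unique.Propositional using (Unique)
  open import Data.List.Relation.Unary.Unique.Propositional.Properties using (allFin⁺)
  open import Data.Nat.Base using (ℕ; zero; suc)
  open import Data.Product.Base using (_×_; _,_; proj₁; proj₂; ∃-syntax; Σ-syntax)
  open import Data.Sum.Base using (_⊎_; inj₁; inj₂; [_,_]′)
  open import Function.Base using (_∘_)
  open import Function.Bundles using (Equivalence)
  open import Relation.Binary.PropositionalEquality
  open import Relation.Nullary using (¬_; yes; no; does; contradiction)
  open import Relation.Nullary.Decidable using (dec-true; dec-false)
  open import Relation.Binary.Definitions using (tri<; tri≈; tri>)
  open xor-∧-Solver using (solve; _:=_; _:+_; _:*_; con)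

  snoc-split : ∀ (a : Point) (ps : List Point) b → Σ[ l ∈ List Point ] (a ∷ ps ∷ʳ b ≡ l ++ penultimate (a ∷ ps ∷ʳ b) ∷ b ∷ [])
  snoc-split a [] b = [] , refl
  snoc-split a (c ∷ []) b = a ∷ [] , refl
  snoc-split a (c ∷ d ∷ ps) b = let (l , e) = snoc-split c (d ∷ ps) b in a ∷ l , cong (a ∷_) e

  second-split : ∀ (a : Point) (ps : List Point) b → Σ[ l ∈ List Point ] (a ∷ ps ∷ʳ b ≡ a ∷ second (a ∷ ps ∷ʳ b) ∷ l)
  second-split a [] b = [] , refl
  second-split a (c ∷ ps) b = ps ∷ʳ b , refl

  penultimate-step : ∀ a b ps c → penultimate (a ∷ b ∷ ps ∷ʳ c) ≡ penultimate (b ∷ ps ∷ʳ c)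
  penultimate-step a b [] c = refl
  penultimate-step a b (_ ∷ _) c = refl

  segment-mid : ∀ l {a b r} → (a , b) ∈ segments (l ++ a ∷ b ∷ r)
  segment-mid [] = here refl
  segment-mid (_ ∷ []) = there (here refl)
  segment-mid (_ ∷ d ∷ l) = there (segment-mid (d ∷ l))

  head-fresh : ∀ (l : List Point) {a r h t z} → Unique (l ++ a ∷ r) → l ++ a ∷ r ≡ h ∷ t → z ∈ r → z ≢ h
  head-fresh [] (fresh AllPairs.∷ _) refl z∈ e = All.lookup fresh z∈ (sym e)
  head-fresh (_ ∷ l) (fresh AllPairs.∷ _) refl z∈ e = All.lookup fresh (∈-++⁺ʳ l (there z∈)) (sym e)

  inner-distinct : ∀ (l : List Point) {z r w} → Unique (l ++ z ∷ r) → w ∈ r → z ≢ w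
  inner-distinct [] (fresh AllPairs.∷ _) w∈ = All.lookup fresh w∈
  inner-distinct (_ ∷ l) (_ AllPairs.∷ u) w∈ = inner-distinct l u w∈

  BoolFun : ℕ → Set
  BoolFun zero = Bool
  BoolFun (suc n) = Bool → BoolFun n

  everywhere : ∀ n → BoolFun n → Bool
  everywhere zero b = b
  everywhere (suc n) f = everywhere n (f true) ∧ everywhere n (f false)

  Tautology : ∀ n → BoolFun n → Set
  Tautology zero b = b ≡ true
  Tautology (suc n) f = ∀ b → Tautology n (f b)

  ∧-true : ∀ {a b} → a ∧ b ≡ true → a ≡ true × b ≡ true
  ∧-true {true} {true} _ = refl , refl

  -- Proof by reflection: after evaluation at all assignments, `refl` is a proof of the general
  -- statement.
  tautology : ∀ n f → everywhere n f ≡ true → Tautology n f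
  tautology zero f e = e
  tautology (suc n) f e true = tautology n (f true) (proj₁ (∧-true e))
  tautology (suc n) f e false = tautology n (f false) (proj₂ (∧-true {everywhere n (f true)} e))

  _≐_ : Bool → Bool → Bool
  a ≐ b = not (a xor b)

  -- Three edges leave a vertex, rᵢ tells whether edge i leaves to the right, and
  -- aᵢⱼ whether it leaves above edge j; s, t and s + t are their values mod 2.
  -- The sides of the edges agree along the cyclic order 1, 2, 3 or along 3, 2, 1.
  module _ (r₁ r₂ r₃ a₁₂ a₂₁ a₁₃ a₃₁ a₂₃ a₃₂ : Bool) where
    inTo outOf : Bool → Bool → Bool × Bool × Bool
    inTo s t = let w = s xor t in
      ((t ∧ a₂₁) xor (w ∧ a₃₁)) xor (r₁ ∧ s) ,
      ((s ∧ a₁₂) xor (w ∧ a₃₂)) xor (r₂ ∧ t) ,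
      ((s ∧ a₁₃) xor (t ∧ a₂₃)) xor (r₃ ∧ w)
    outOf s t = let w = s xor t in
      ((t ∧ a₂₁) xor (w ∧ a₃₁)) xor (not r₁ ∧ s) ,
      ((s ∧ a₁₂) xor (w ∧ a₃₂)) xor (not r₂ ∧ t) ,
      ((s ∧ a₁₃) xor (t ∧ a₂₃)) xor (not r₃ ∧ w)

    forwards backwards : Bool → Bool → Bool
    forwards s t = let (i₁ , i₂ , i₃) = inTo s t ; (o₁ , o₂ , o₃) = outOf s t
      in (i₁ ≐ o₂) ∧ (i₂ ≐ o₃) ∧ (i₃ ≐ o₁)
    backwards s t = let (i₁ , i₂ , i₃) = inTo s t ; (o₁ , o₂ , o₃) = outOf s t
      in (i₁ ≐ o₃) ∧ (i₃ ≐ o₂) ∧ (i₂ ≐ o₁)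

    private
      pair : (r r′ a b : Bool) → Bool
      pair r r′ a b = ((a xor b) ≐ (r ≐ r′)) ∧ (not (r xor r′) ∨ (not a ∧ not b))

    geometric : Bool
    geometric = pair r₁ r₂ a₁₂ a₂₁ ∧ pair r₁ r₃ a₁₃ a₃₁ ∧ pair r₂ r₃ a₂₃ a₃₂
              ∧ not (a₂₁ ∧ a₃₂ ∧ a₁₃) ∧ not (a₃₁ ∧ a₂₃ ∧ a₁₂)

  -- All 512 assignments are evaluated. The premise `geometric` records what holds for three
  -- segments at a point: two on the same side are comparable, two on opposite sides are not, and
  -- "above" has no cycle. The quantifier over `s` and `t` stands inside each alternative because
  -- the cyclic order must not depend on the set `S`.
  cyclic-order : Tautology 9 λ r₁ r₂ r₃ a₁₂ a₂₁ a₁₃ a₃₁ a₂₃ a₃₂ →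
    not (geometric r₁ r₂ r₃ a₁₂ a₂₁ a₁₃ a₃₁ a₂₃ a₃₂)
      ∨ everywhere 2 (forwards r₁ r₂ r₃ a₁₂ a₂₁ a₁₃ a₃₁ a₂₃ a₃₂)
      ∨ everywhere 2 (backwards r₁ r₂ r₃ a₁₂ a₂₁ a₁₃ a₃₁ a₂₃ a₃₂)
  cyclic-order = tautology 9 _ refl

  module _ {G : Graph} (PA : PlaneArcs G) where
    open Graph G using (Vertex; Adj; adj; adj-sym; adj-irrefl; order)
    open PlaneArcs PA

    private
      V = allFin order
      V-unique = allFin⁺ order
      Cor = Corner PA
      x-inj = x-injective PA

    -- The side to the left of pq; s tells whether the segment pq belongs to S.
    leftOf : (Vertex → Vertex → Bool) → Bool → Point → Point → Bool
    leftOf S s p q = overAll PA S p q xor ((q ◁ p) ∧ s)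

    -- The corner next to u on the edge from u to v.
    toward : Vertex → Vertex → Point
    toward u v = if does (u Finₚ.<? v) then second (arc u v) else penultimate (arc v u)

    leftFace : (Vertex → Vertex → Bool) → Vertex → Vertex → Bool
    leftFace S u v = leftOf S (S u v) (place u) (toward u v)

    toward-< : ∀ {u v} → u Fin.< v → toward u v ≡ second (arc u v)
    toward-< {u} {v} u<v rewrite dec-true (u Finₚ.<? v) u<v = refl

    toward-> : ∀ {u v} → v Fin.< u → toward u v ≡ penultimate (arc v u)
    toward-> {u} {v} v<u rewrite dec-false (u Finₚ.<? v) (λ u<v → Finₚ.<-asym u<v v<u) = refl

    ◁-flip : ∀ {p q} → Cor p → Cor q → p ≢ q → q ◁ p ≡ not (p ◁ q)
    ◁-flip {p} {q} cp cq p≢q with ≺-cmp {p} {q} (p≢q ∘ x-inj cp cq)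
    ... | inj₁ pq rewrite ◁-true pq | ◁-false pq = refl
    ... | inj₂ qp rewrite ◁-true qp | ◁-false qp = refl

    first-segment : ∀ {u v} → u Fin.< v → Adj u v → (place u , second (arc u v)) ∈ segments (arc u v)
    first-segment {u} {v} u<v a with arc-ends u<v a
    ... | ps , eq with second-split (place u) ps (place v)
    ... | l , eq′ = subst (λ c → (place u , second c) ∈ segments c) (sym eq)
                      (subst (λ c → (place u , second (place u ∷ ps ∷ʳ place v)) ∈ segments c) (sym eq′) (here refl))

    last-segment : ∀ {u v} → u Fin.< v → Adj u v → (penultimate (arc u v) , place v) ∈ segments (arc u v)
    last-segment {u} {v} u<v a with arc-ends u<v a
    ... | ps , eq with snoc-split (place u) ps (place v)
    ... | l , eq′ = subst (λ c → (penultimate c , place v) ∈ segments c) (sym eq)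
                      (subst (λ c → (_ , place v) ∈ segments c) (sym eq′) (segment-mid l))

    dart-segment : ∀ {u v} → Adj u v →
      (place u , toward u v) ∈ segments (arc u v) ⊎ (toward u v , place u) ∈ segments (arc v u)
    dart-segment {u} {v} a with Finₚ.<-cmp u v
    ... | tri< u<v _ _ = inj₁ (subst (λ q → (place u , q) ∈ segments (arc u v)) (sym (toward-< u<v)) (first-segment u<v a))
    ... | tri≈ _ refl _ = ⊥-elim (subst T (adj-irrefl u) a)
    ... | tri> _ _ v<u = inj₂ (subst (λ q → (q , place u) ∈ segments (arc v u)) (sym (toward-> v<u))
                            (last-segment v<u (Adj-sym G a)))

    dart-corners : ∀ {u v} → Adj u v → Cor (place u) × Cor (toward u v) × place u ≢ toward u v
    dart-corners {u} {v} a with dart-segment a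
    ... | inj₁ h = let (p , q) = segment-ends _ h in (_ , _ , p) , (_ , _ , q) , segment-proper (arc-unique u v) h
    ... | inj₂ h = let (p , q) = segment-ends _ h in (_ , _ , q) , (_ , _ , p) , segment-proper (arc-unique v u) h ∘ sym

    darts-meet : ∀ {v a c} → Adj v a → Adj v c → a ≢ c → MeetAtEnds (place v) (toward v a) (place v) (toward v c)
    darts-meet {v} {a} {c} va vc a≢c with dart-segment va | dart-segment vc
    ... | inj₁ h | inj₁ k with arc-meet {v} {a} {v} {c} h k
    ... | inj₁ (_ , e , _) = contradiction e a≢c
    ... | inj₂ m = m
    darts-meet {v} {a} {c} va vc a≢c | inj₁ h | inj₂ k with arc-meet {v} {a} {c} {v} h k
    ... | inj₁ (e , e′ , _) = contradiction (trans e′ e) a≢c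
    ... | inj₂ m = MeetAtEnds-sym (MeetAtEnds-reverse (MeetAtEnds-sym m))
    darts-meet {v} {a} {c} va vc a≢c | inj₂ h | inj₁ k with arc-meet {a} {v} {v} {c} h k
    ... | inj₁ (e , e′ , _) = contradiction (trans e e′) a≢c
    ... | inj₂ m = MeetAtEnds-reverse m
    darts-meet {v} {a} {c} va vc a≢c | inj₂ h | inj₂ k with arc-meet {a} {v} {c} {v} h k
    ... | inj₁ (e , _ , _) = contradiction e a≢c
    ... | inj₂ m = MeetAtEnds-reverse (MeetAtEnds-sym (MeetAtEnds-reverse (MeetAtEnds-sym m)))

    leftFace-additive : ∀ S S′ u v → leftFace (λ a b → S a b xor S′ a b) u v ≡ leftFace S u v xor leftFace S′ u v
    leftFace-additive S S′ u v rewrite overAll-additive PA S S′ (place u) (toward u v) =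
      solve 5 (λ o o′ t s s′ → (o :+ o′) :+ (t :* (s :+ s′)) := (o :+ (t :* s)) :+ (o′ :+ (t :* s′))) refl
        (overAll PA S (place u) (toward u v)) (overAll PA S′ (place u) (toward u v))
        (toward u v ◁ place u) (S u v) (S′ u v)

    -- At a bend no second arc is present, so all other summands vanish by `local-absent`.
    localAll-one : ∀ S {u v} z q → (∀ {u′ v′} → z ∈ arc u′ v′ → u ≡ u′ × v ≡ v′) →
      localAll PA S z q ≡ S u v ∧ ∑ₛ (arc u v) (λ a b → localOver a b z q)
    localAll-one S {u} {v} z q only = trans
      (∑-single V-unique (∈-allFin u) (λ {u′} u′≢u → ∑-zero V (λ {v′} _ → absent u′ v′ (u′≢u ∘ sym ∘ proj₁))))
      (∑-single V-unique (∈-allFin v) (λ {v′} v′≢v → absent u v′ (v′≢v ∘ sym ∘ proj₂)))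
      where
      absent : ∀ u′ v′ → ¬ (u ≡ u′ × v ≡ v′) → S u′ v′ ∧ ∑ₛ (arc u′ v′) (λ a b → localOver a b z q) ≡ false
      absent u′ v′ h = trans (cong (S u′ v′ ∧_) (local-absent z q (arc u′ v′) (h ∘ only))) (∧-zeroʳ _)

    private
      above : Vertex → Vertex → Vertex → Bool
      above v i j = startsAbove (place v) (toward v i) (toward v j)

      rightward : Vertex → Vertex → Bool
      rightward v i = place v ◁ toward v i

    turnsForward : Vertex → Vertex → Vertex → Vertex → Bool
    turnsForward v a c d = everywhere 2 (forwards (rightward v a) (rightward v c) (rightward v d)
      (above v a c) (above v c a) (above v a d) (above v d a) (above v c d) (above v d c))

    -- A dart that arrives from `u` continues to this neighbour. No angles are compared: of the two
    -- cyclic orders of three neighbours, the test selects one along which sides are constant. Lists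
    -- of other lengths get the identity as filler.
    successorIn : Vertex → List Vertex → Vertex → Vertex
    successorIn v (a ∷ c ∷ []) u = if does (u Finₚ.≟ a) then c else a
    successorIn v (a ∷ c ∷ d ∷ []) u = if turnsForward v a c d
      then (if does (u Finₚ.≟ a) then c else if does (u Finₚ.≟ c) then d else a)
      else (if does (u Finₚ.≟ a) then d else if does (u Finₚ.≟ d) then c else a)
    successorIn v _ u = u

    -- Comparability, incomparability and acyclicity of the three segments at `v` establish the
    -- premise `geometric`; the failed test then leaves only the opposite order.
    turns : ∀ {v a c d} → Adj v a → Adj v c → Adj v d → a ≢ c → a ≢ d → c ≢ d →
      turnsForward v a c d ≡ false → everywhere 2 (backwards (rightward v a) (rightward v c) (rightward v d)
        (above v a c) (above v c a) (above v a d) (above v d a) (above v c d) (above v d c)) ≡ true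
    turns {v} {a} {c} {d} va vc vd a≢c a≢d c≢d ¬forward = resolve
      (cyclic-order (rightward v a) (rightward v c) (rightward v d)
        (above v a c) (above v c a) (above v a d) (above v d a) (above v c d) (above v d c))
      (∧-intro (pair va vc a≢c) (∧-intro (pair va vd a≢d) (∧-intro (pair vc vd c≢d) (∧-intro
        (cong not (startsAbove-acyclic Cor x-inj (cp va) (cq va) (cq vc) (cq vd) (p≢q va) (p≢q vc) (p≢q vd)))
        (cong not (startsAbove-acyclic Cor x-inj (cp va) (cq va) (cq vd) (cq vc) (p≢q va) (p≢q vd) (p≢q vc)))))))
      ¬forward
      where
      ∧-intro : ∀ {a b} → a ≡ true → b ≡ true → a ∧ b ≡ true
      ∧-intro refl refl = refl
      resolve : ∀ {g f b} → (not g ∨ f ∨ b) ≡ true → g ≡ true → f ≡ false → b ≡ true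
      resolve e refl refl = e
      cp : ∀ {w} → Adj v w → Cor (place v)
      cp h = proj₁ (dart-corners h)
      cq : ∀ {w} → Adj v w → Cor (toward v w)
      cq h = proj₁ (proj₂ (dart-corners h))
      p≢q : ∀ {w} → Adj v w → place v ≢ toward v w
      p≢q h = proj₂ (proj₂ (dart-corners h))
      pair : ∀ {i j} → Adj v i → Adj v j → i ≢ j →
        ((above v i j xor above v j i) ≐ (rightward v i ≐ rightward v j))
          ∧ (not (rightward v i xor rightward v j) ∨ (not (above v i j) ∧ not (above v j i))) ≡ true
      pair {i} {j} vi vj i≢j = ∧-intro
        (cong not (trans (cong (_xor (rightward v i ≐ rightward v j)) (trans (xor-comm (above v i j) _)
          (startsAbove-total Cor x-inj (cp vi) (cq vi) (cq vj) (p≢q vi) (p≢q vj) (darts-meet vi vj i≢j))))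
          (xor-same (rightward v i ≐ rightward v j))))
        (opposite (rightward v i xor rightward v j)
          (λ e → startsAbove-opposite-sides Cor x-inj (cp vj) (cq vj) (cq vi) (p≢q vj) (p≢q vi)
                   (trans (xor-comm (rightward v j) (rightward v i)) e))
          (startsAbove-opposite-sides Cor x-inj (cp vi) (cq vi) (cq vj) (p≢q vi) (p≢q vj)))
        where
        opposite : ∀ r {a b} → (r ≡ true → a ≡ false) → (r ≡ true → b ≡ false) → (not r ∨ (not a ∧ not b)) ≡ true
        opposite false _ _ = refl
        opposite true f g = cong₂ (λ a b → not a ∧ not b) (f refl) (g refl)

    module _ {S : Vertex → Vertex → Bool} (even : Even PA S) where
      open Even even

      -- Other arcs contribute through `passing`, which is the same before and after `z`. The two
      -- segments of the arc itself are compared by `startsAbove-total`, and what this leaves over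
      -- is exactly the change of the term of `leftOf` that depends on the direction.
      bend-constant : ∀ {u v} l {a z b r} → arc u v ≡ l ++ a ∷ z ∷ b ∷ r → z ≢ place u → z ≢ place v →
        leftOf S (S u v) a z ≡ leftOf S (S u v) z b
      bend-constant {u} {v} l {a} {z} {b} {r} eq z≢u z≢v = begin
        overAll PA S a z xor ((z ◁ a) ∧ s)
          ≡⟨ cong (_xor ((z ◁ a) ∧ s)) (trans (arc-parity PA even az) (overAll-split PA S z a)) ⟩
        (passing PA S z xor localAll PA S z a) xor ((z ◁ a) ∧ s)
          ≡⟨ cong (λ t → (passing PA S z xor t) xor ((z ◁ a) ∧ s)) (local a (cong (_xor startsAbove z b a) (startsAbove-refl z a))) ⟩
        (passing PA S z xor (s ∧ startsAbove z b a)) xor ((z ◁ a) ∧ s)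
          -- Adding `startsAbove z a b` twice produces the sum that `startsAbove-total` evaluates.
          ≡⟨ solve 5 (λ n s t k o → (n :+ (s :* k)) :+ (t :* s) := (n :+ (s :* (o :+ (k :+ o)))) :+ (t :* s))
               refl (passing PA S z) s (z ◁ a) (startsAbove z b a) (startsAbove z a b) ⟩
        (passing PA S z xor (s ∧ (startsAbove z a b xor (startsAbove z b a xor startsAbove z a b)))) xor ((z ◁ a) ∧ s)
          ≡⟨ cong (λ t → (passing PA S z xor (s ∧ (startsAbove z a b xor t))) xor ((z ◁ a) ∧ s))
               (startsAbove-total Cor x-inj cz ca cb (a≢z ∘ sym) z≢b fork′) ⟩
        (passing PA S z xor (s ∧ (startsAbove z a b xor not ((z ◁ a) xor (z ◁ b))))) xor ((z ◁ a) ∧ s)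
          ≡⟨ shape (passing PA S z) s (startsAbove z a b) (z ◁ a) (z ◁ b) ⟩
        (passing PA S z xor (s ∧ startsAbove z a b)) xor (not (z ◁ b) ∧ s)
          ≡⟨ cong₂ (λ t t′ → (passing PA S z xor t) xor (t′ ∧ s))
               (local b (trans (cong (startsAbove z a b xor_) (startsAbove-refl z b)) (xor-identityʳ _))) (◁-flip cz cb z≢b) ⟨
        (passing PA S z xor localAll PA S z b) xor ((b ◁ z) ∧ s)
          ≡⟨ cong (_xor ((b ◁ z) ∧ s)) (overAll-split PA S z b) ⟨
        overAll PA S z b xor ((b ◁ z) ∧ s) ∎
        where
        open ≡-Reasoning
        s = S u v
        az : (a , z) ∈ segments (arc u v)
        az = subst (λ c → (a , z) ∈ segments c) (sym eq) (segment-mid l)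
        zb : (z , b) ∈ segments (arc u v)
        zb = subst (λ c → (z , b) ∈ segments c) (trans (++-assoc l _ _) (sym eq)) (segment-mid (l ++ a ∷ []))
        unique : Unique (l ++ a ∷ z ∷ b ∷ r)
        unique = subst Unique eq (arc-unique u v)
        a≢z = segment-proper (arc-unique u v) az
        z≢b = segment-proper (arc-unique u v) zb
        ca : Cor a
        ca = u , v , proj₁ (segment-ends _ az)
        cz : Cor z
        cz = u , v , proj₂ (segment-ends _ az)
        cb : Cor b
        cb = u , v , proj₂ (segment-ends _ zb)
        fork′ : MeetAtEnds z a z b
        fork′ with arc-meet {u} {v} {u} {v} az zb
        ... | inj₁ (_ , _ , e) = contradiction (cong proj₁ e) a≢z
        ... | inj₂ m = MeetAtEnds-reverse m
        only : ∀ {u′ v′} → z ∈ arc u′ v′ → u ≡ u′ × v ≡ v′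
        only {u′} {v′} h with arc-bend {u} {v} {u′} {v′} (proj₁ (segment-ends _ zb)) h
        ... | inj₁ e = e
        ... | inj₂ (inj₁ e) = contradiction e z≢u
        ... | inj₂ (inj₂ e) = contradiction e z≢v
        local : ∀ q {t} → startsAbove z a q xor startsAbove z b q ≡ t → localAll PA S z q ≡ s ∧ t
        local q e = trans (localAll-one S z q only)
          (cong (s ∧_) (trans (cong (λ c → ∑ₛ c (λ a b → localOver a b z q)) eq) (trans (local-inner z q l unique) e)))
        shape : ∀ n s k p q → (n xor (s ∧ (k xor not (p xor q)))) xor (p ∧ s) ≡ (n xor (s ∧ k)) xor (not q ∧ s)
        shape n s k p q = trans
          (cong (λ t → (n xor (s ∧ (k xor t))) xor (p ∧ s)) (sym (true-xor (p xor q))))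
          (trans (solve 5 (λ n s k p q → (n :+ (s :* (k :+ (con true :+ (p :+ q))))) :+ (p :* s)
                             := (n :+ (s :* k)) :+ ((con true :+ q) :* s)) refl n s k p q)
                 (cong (λ t → (n xor (s ∧ k)) xor (t ∧ s)) (true-xor q)))

      leftOf-constant : ∀ {u v} l a ps → arc u v ≡ l ++ a ∷ ps ∷ʳ place v → ∃[ t ] arc u v ≡ place u ∷ t →
        leftOf S (S u v) a (second (a ∷ ps ∷ʳ place v)) ≡ leftOf S (S u v) (penultimate (a ∷ ps ∷ʳ place v)) (place v)
      leftOf-constant l a [] eq start = refl
      leftOf-constant {u} {v} l a (z ∷ ps) eq (t , start) = trans
        (bend-constant l (trans eq (cong (λ c → l ++ a ∷ c) (proj₂ (second-split z ps (place v)))))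
          (head-fresh l (subst Unique eq (arc-unique u v)) (trans (sym eq) start) (here refl))
          (inner-distinct (l ++ a ∷ []) (subst Unique eq′ (arc-unique u v)) (∈-++⁺ʳ ps (here refl))))
        (trans (leftOf-constant (l ++ a ∷ []) z ps eq′ (t , start))
          (cong (λ p → leftOf S (S u v) p (place v)) (sym (penultimate-step a z ps (place v)))))
        where
        eq′ : arc u v ≡ (l ++ a ∷ []) ++ z ∷ ps ∷ʳ place v
        eq′ = trans eq (sym (++-assoc l (a ∷ []) _))

      forward-constant : ∀ {u v} → u Fin.< v → Adj u v →
        leftOf S (S u v) (place u) (second (arc u v)) ≡ leftOf S (S u v) (penultimate (arc u v)) (place v)
      forward-constant {u} {v} u<v a = let (ps , eq) = arc-ends u<v a in
        subst (λ c → leftOf S (S u v) (place u) (second c) ≡ leftOf S (S u v) (penultimate c) (place v)) (sym eq)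
          (leftOf-constant [] (place u) ps eq (_ , eq))

      -- The parity above the segment is the same at both ends, so reversal only toggles the term
      -- that accounts for the segment itself.
      leftOf-reverse : ∀ {u v p q} s → (p , q) ∈ segments (arc u v) → leftOf S s q p ≡ leftOf S s p q xor s
      leftOf-reverse {u} {v} {p} {q} s pq = begin
        overAll PA S q p xor ((p ◁ q) ∧ s)              ≡⟨ cong (_xor ((p ◁ q) ∧ s)) (arc-parity PA even pq) ⟨
        overAll PA S p q xor ((p ◁ q) ∧ s)              ≡⟨ lemma (overAll PA S p q) (p ◁ q) s ⟩
        (overAll PA S p q xor (not (p ◁ q) ∧ s)) xor s  ≡⟨ cong (λ t → (overAll PA S p q xor (t ∧ s)) xor s) (◁-flip cp cq p≢q) ⟨
        (overAll PA S p q xor ((q ◁ p) ∧ s)) xor s      ∎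
        where
        open ≡-Reasoning
        cp = u , v , proj₁ (segment-ends _ pq)
        cq = u , v , proj₂ (segment-ends _ pq)
        p≢q = segment-proper (arc-unique u v) pq
        lemma : ∀ o t s → o xor (t ∧ s) ≡ (o xor (not t ∧ s)) xor s
        lemma false false false = refl
        lemma false true false = refl
        lemma true false false = refl
        lemma true true false = refl
        lemma false false true = refl
        lemma false true true = refl
        lemma true false true = refl
        lemma true true true = refl

      -- The side is carried along the arc from corner to corner. For `v < u` the arc is read
      -- backwards, and the two reversals add `S v u` twice.
      dart-constant : ∀ {u v} → Adj u v → leftFace S u v ≡ leftOf S (S u v) (toward v u) (place v)
      dart-constant {u} {v} a with Finₚ.<-cmp u v
      ... | tri≈ _ refl _ = ⊥-elim (subst T (adj-irrefl u) a)
      ... | tri< u<v _ _ rewrite toward-< u<v | toward-> {v} {u} u<v = forward-constant u<v a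
      ... | tri> _ _ v<u rewrite toward-> v<u | toward-< {v} {u} v<u | S-sym u v = begin
        leftOf S (S v u) (place u) (penultimate (arc v u))
          ≡⟨ leftOf-reverse (S v u) (last-segment v<u a′) ⟩
        leftOf S (S v u) (penultimate (arc v u)) (place u) xor S v u
          ≡⟨ cong (_xor S v u) (forward-constant v<u a′) ⟨
        leftOf S (S v u) (place v) (second (arc v u)) xor S v u
          ≡⟨ leftOf-reverse (S v u) (first-segment v<u a′) ⟨
        leftOf S (S v u) (second (arc v u)) (place v) ∎
        where
        open ≡-Reasoning
        a′ = Adj-sym G a

      dart-overAll : ∀ {u v} → Adj u v → overAll PA S (place u) (toward u v) ≡ overAll PA S (toward u v) (place u)
      dart-overAll a with dart-segment a
      ... | inj₁ h = arc-parity PA even h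
      ... | inj₂ h = sym (arc-parity PA even h)

      -- Both darts of an edge see the same parity above it, and exactly one of them has its left
      -- side below the edge. In particular a set whose parity vanishes on all darts is empty.
      leftFace-jump : ∀ {u v} → Adj u v → leftFace S u v xor leftFace S v u ≡ S u v
      leftFace-jump {u} {v} a = begin
        leftFace S u v xor leftFace S v u
          ≡⟨ cong (leftFace S u v xor_) (dart-constant (Adj-sym G a)) ⟩
        leftOf S (S u v) p q xor leftOf S (S v u) q p
          ≡⟨ cong (λ s → leftOf S (S u v) p q xor leftOf S s q p) (S-sym v u) ⟩
        leftOf S (S u v) p q xor leftOf S (S u v) q p
          ≡⟨ cong₂ (λ o f → (overAll PA S p q xor (f ∧ S u v)) xor (o xor ((p ◁ q) ∧ S u v)))
               (sym (dart-overAll a)) (◁-flip (proj₁ cs) (proj₁ (proj₂ cs)) (proj₂ (proj₂ cs))) ⟩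
        (overAll PA S p q xor (not (p ◁ q) ∧ S u v)) xor (overAll PA S p q xor ((p ◁ q) ∧ S u v))
          ≡⟨ lemma (overAll PA S p q) (p ◁ q) (S u v) ⟩
        S u v ∎
        where
        open ≡-Reasoning
        p = place u
        q = toward u v
        cs = dart-corners a
        lemma : ∀ o t s → (o xor (not t ∧ s)) xor (o xor (t ∧ s)) ≡ s
        lemma false false s = xor-identityʳ s
        lemma false true s = refl
        lemma true false s = trans (xor-comm (not s) true) (not-involutive s)
        lemma true true s = not-involutive s

      -- An edge at `v` is stored under its smaller end, so it enters the double sum through either
      -- the first or the last corner of its arc. The two halves are merged by `<ᶠ-split`.
      localAll-vertex : ∀ v q → localAll PA S (place v) q ≡ ∑ V (λ w → S v w ∧ startsAbove (place v) (toward v w) q)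
      localAll-vertex v q = begin
        localAll PA S (place v) q
          ≡⟨ ∑-cong V (λ {a} _ → ∑-cong V (λ {b} _ → per-arc a b)) ⟩
        (∑ V λ a → ∑ V λ b → (is v a ∧ (_<ᶠ_ PA a b) ∧ t b) xor (is v b ∧ (_<ᶠ_ PA a b) ∧ t a))
          ≡⟨ ∑-cong V (λ {a} _ → ∑-∙ V _ _) ⟩
        (∑ V λ a → (∑ V λ b → is v a ∧ (_<ᶠ_ PA a b) ∧ t b) xor (∑ V λ b → is v b ∧ (_<ᶠ_ PA a b) ∧ t a))
          ≡⟨ ∑-∙ V _ _ ⟩
        (∑ V λ a → ∑ V λ b → is v a ∧ (_<ᶠ_ PA a b) ∧ t b) xor (∑ V λ a → ∑ V λ b → is v b ∧ (_<ᶠ_ PA a b) ∧ t a)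
          ≡⟨ cong₂ _xor_
               (trans (∑-cong V (λ {a} _ → ∑-scale V (is v a) (λ b → (_<ᶠ_ PA a b) ∧ t b))) (select (λ a → ∑ V λ b → (_<ᶠ_ PA a b) ∧ t b)))
               (∑-cong V (λ {a} _ → select (λ b → (_<ᶠ_ PA a b) ∧ t a))) ⟩
        (∑ V λ b → (_<ᶠ_ PA v b) ∧ t b) xor (∑ V λ a → (_<ᶠ_ PA a v) ∧ t a)
          ≡⟨ ∑-∙ V _ _ ⟨
        (∑ V λ b → ((_<ᶠ_ PA v b) ∧ t b) xor ((_<ᶠ_ PA b v) ∧ t b))
          ≡⟨ ∑-cong V (λ {b} _ → <ᶠ-split PA t v (cong (_∧ startsAbove (place v) (toward v v) q) (S-irrefl v)) b) ⟩
        ∑ V t ∎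
        where
        open ≡-Reasoning
        t : Vertex → Bool
        t w = S v w ∧ startsAbove (place v) (toward v w) q
        is : Vertex → Vertex → Bool
        is a b = does (b Finₚ.≟ a)
        is-refl : ∀ a → is a a ≡ true
        is-refl a = dec-true (a Finₚ.≟ a) refl
        is-false : ∀ {a b} → b ≢ a → is a b ≡ false
        is-false {a} {b} = dec-false (b Finₚ.≟ a)
        select : ∀ (f : Vertex → Bool) → ∑ V (λ a → is v a ∧ f a) ≡ f v
        select f = trans (∑-single V-unique (∈-allFin v) (λ {j} j≢v → cong (_∧ f j) (is-false j≢v))) (cong (_∧ f v) (is-refl v))
        rest : ∀ b c d → (b ∧ false) xor (c ∧ false) ≡ d → false ≡ d
        rest b c d e = trans (sym (cong₂ _xor_ (∧-zeroʳ b) (∧-zeroʳ c))) e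
        per-arc : ∀ a b → S a b ∧ ∑ₛ (arc a b) (λ c d → localOver c d (place v) q)
          ≡ (is v a ∧ (_<ᶠ_ PA a b) ∧ t b) xor (is v b ∧ (_<ᶠ_ PA a b) ∧ t a)
        per-arc a b with a Finₚ.<? b
        ... | no ¬a<b rewrite dec-false (a Finₚ.<? b) ¬a<b | arc-empty {a} {b} (¬a<b ∘ proj₁)
                            | ∧-zeroʳ (S a b) | ∧-zeroʳ (is v a) | ∧-zeroʳ (is v b) = refl
        ... | yes a<b rewrite dec-true (a Finₚ.<? b) a<b with a Finₚ.≟ v | b Finₚ.≟ v
        ... | yes refl | yes refl = contradiction a<b (Finₚ.<-irrefl refl)
        ... | yes refl | no b≢v rewrite xor-identityʳ (t b) | toward-< a<b with S a b in e
        ...   | false = refl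
        ...   | true = begin
          ∑ₛ (arc a b) (λ c d → localOver c d (place a) q)
            ≡⟨ cong (λ c → ∑ₛ c (λ c d → localOver c d (place a) q)) eq ⟩
          ∑ₛ (place a ∷ second (arc a b) ∷ l) (λ c d → localOver c d (place a) q)
            ≡⟨ local-first (place a) q (subst Unique eq (arc-unique a b)) ⟩
          startsAbove (place a) (second (arc a b)) q ∎
          where
          l = proj₁ (second-split (place a) (proj₁ (arc-ends a<b (S-adj a b e))) (place b))
          eq : arc a b ≡ place a ∷ second (arc a b) ∷ l
          eq = let (ps , eq₁) = arc-ends a<b (S-adj a b e) in
            trans eq₁ (trans (proj₂ (second-split (place a) ps (place b))) (cong (λ c → place a ∷ second c ∷ l) (sym eq₁)))
        per-arc a b | yes a<b | no a≢v | yes refl rewrite S-sym b a | toward-> {b} {a} a<b with S a b in e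
        ...   | false = refl
        ...   | true = begin
          ∑ₛ (arc a b) (λ c d → localOver c d (place b) q)
            ≡⟨ cong (λ c → ∑ₛ c (λ c d → localOver c d (place b) q)) eq ⟩
          ∑ₛ (l ++ penultimate (arc a b) ∷ place b ∷ []) (λ c d → localOver c d (place b) q)
            ≡⟨ local-last (place b) q l (subst Unique eq (arc-unique a b)) ⟩
          startsAbove (place b) (penultimate (arc a b)) q ∎
          where
          l = proj₁ (snoc-split (place a) (proj₁ (arc-ends a<b (S-adj a b e))) (place b))
          eq : arc a b ≡ l ++ penultimate (arc a b) ∷ place b ∷ []
          eq = let (ps , eq₁) = arc-ends a<b (S-adj a b e) in
            trans eq₁ (trans (proj₂ (snoc-split (place a) ps (place b))) (cong (λ c → l ++ penultimate c ∷ place b ∷ []) (sym eq₁)))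
        per-arc a b | yes a<b | no a≢v | no b≢v = trans (cong (S a b ∧_)
          (local-absent (place v) q (arc a b) (λ h → [ a≢v ∘ sym , b≢v ∘ sym ]′ (arc-vertex h)))) (∧-zeroʳ _)

      -- Up to `passing`, which is common to all darts at `v`, what remains is the Boolean
      -- expression that `inTo` tabulates; `outOfV` does the same for `outOf`.
      into : ∀ {u v} → Adj u v → leftFace S u v
        ≡ passing PA S (place v) xor ((∑ V λ w → S v w ∧ above v w u) xor (rightward v u ∧ S v u))
      into {u} {v} a = begin
        leftFace S u v
          ≡⟨ dart-constant a ⟩
        overAll PA S (toward v u) (place v) xor (rightward v u ∧ S u v)
          ≡⟨ cong₂ (λ o s → o xor (rightward v u ∧ s)) (sym (dart-overAll (Adj-sym G a))) (S-sym u v) ⟩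
        overAll PA S (place v) (toward v u) xor (rightward v u ∧ S v u)
          ≡⟨ cong (_xor (rightward v u ∧ S v u)) (trans (overAll-split PA S (place v) (toward v u))
               (cong (passing PA S (place v) xor_) (localAll-vertex v (toward v u)))) ⟩
        (passing PA S (place v) xor (∑ V λ w → S v w ∧ above v w u)) xor (rightward v u ∧ S v u)
          ≡⟨ xor-assoc (passing PA S (place v)) _ _ ⟩
        passing PA S (place v) xor ((∑ V λ w → S v w ∧ above v w u) xor (rightward v u ∧ S v u)) ∎
        where open ≡-Reasoning

      outOfV : ∀ {u v} → Adj v u → leftFace S v u
        ≡ passing PA S (place v) xor ((∑ V λ w → S v w ∧ above v w u) xor (not (rightward v u) ∧ S v u))
      outOfV {u} {v} a = begin
        overAll PA S (place v) (toward v u) xor ((toward v u ◁ place v) ∧ S v u)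
          ≡⟨ cong (λ t → overAll PA S (place v) (toward v u) xor (t ∧ S v u))
               (◁-flip (proj₁ cs) (proj₁ (proj₂ cs)) (proj₂ (proj₂ cs))) ⟩
        overAll PA S (place v) (toward v u) xor (not (rightward v u) ∧ S v u)
          ≡⟨ cong (_xor (not (rightward v u) ∧ S v u)) (trans (overAll-split PA S (place v) (toward v u))
               (cong (passing PA S (place v) xor_) (localAll-vertex v (toward v u)))) ⟩
        (passing PA S (place v) xor (∑ V λ w → S v w ∧ above v w u)) xor (not (rightward v u) ∧ S v u)
          ≡⟨ xor-assoc (passing PA S (place v)) _ _ ⟩
        passing PA S (place v) xor ((∑ V λ w → S v w ∧ above v w u) xor (not (rightward v u) ∧ S v u)) ∎
        where
        open ≡-Reasoning
        cs = dart-corners a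

      module _ {C : Vertex → Bool} (inside : ∀ u v → S u v ≡ true → T (C v)) where

        ∑-nbrs : ∀ v (f : Vertex → Bool) → (∑ V λ w → S v w ∧ f w) ≡ (∑ (nbrs G C v) λ w → S v w ∧ f w)
        ∑-nbrs v f = sym (trans (∑-filter (λ u → T? (C u ∧ adj v u)) V (λ w → S v w ∧ f w)) (∑-cong V λ {w} _ → pointwise w))
          where
          pointwise : ∀ w → (if does (T? (C w ∧ adj v w)) then S v w ∧ f w else false) ≡ S v w ∧ f w
          pointwise w with S v w in e
          ... | true rewrite dec-true (T? (C w ∧ adj v w)) (Equivalence.from T-∧ (inside v w e , S-adj v w e)) = refl
          ... | false with does (T? (C w ∧ adj v w))
          ...   | true = refl
          ...   | false = refl

        ∑-nbrs-even : ∀ v → (∑ (nbrs G C v) λ w → S v w ∧ true) ≡ false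
        ∑-nbrs-even v = trans (sym (∑-nbrs v (λ _ → true)))
          (trans (∑-cong V (λ {w} _ → ∧-identityʳ (S v w))) (S-even v))

        module _ {v : Vertex} where
          private
            s : Vertex → Bool
            s = S v
            n = passing PA S (place v)

            adjacent : ∀ {N} → nbrs G C v ≡ N → ∀ {u} → u ∈ N → Adj v u
            adjacent refl h = proj₂ (∈-nbrs⁻ G C h)

            unique : ∀ {N} → nbrs G C v ≡ N → Unique N
            unique e = subst Unique e (nbrs-unique G C v)

            below : ∀ {N} → nbrs G C v ≡ N → ∀ u → (∑ V λ w → s w ∧ above v w u) ≡ (∑ N λ w → s w ∧ above v w u)
            below e u = trans (∑-nbrs v (λ w → above v w u)) (cong (λ N → ∑ N λ w → s w ∧ above v w u) e)

            own : ∀ u → s u ∧ above v u u ≡ false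
            own u = trans (cong (s u ∧_) (startsAbove-refl (place v) (toward v u))) (∧-zeroʳ (s u))

          -- By evenness both edges at `v` belong to `S` or neither does, so `v` behaves like a bend
          -- and `startsAbove-total` balances the two sides.
          face-constant₂ : ∀ {a c} → nbrs G C v ≡ a ∷ c ∷ [] → ∀ {u} → u ∈ a ∷ c ∷ [] →
            leftFace S u v ≡ leftFace S v (successorIn v (a ∷ c ∷ []) u)
          face-constant₂ {a} {c} e = cases
            where
            open ≡-Reasoning
            va = adjacent e (here refl)
            vc = adjacent e (there (here refl))
            a≢c : a ≢ c
            a≢c = All.head (AllPairs.head (unique e))
            sum-a : (∑ V λ w → s w ∧ above v w a) ≡ s c ∧ above v c a
            sum-a = trans (below e a) (trans (cong (_xor ((s c ∧ above v c a) xor false)) (own a)) (xor-identityʳ _))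
            sum-c : (∑ V λ w → s w ∧ above v w c) ≡ s a ∧ above v a c
            sum-c = trans (below e c) (trans (cong (λ t → (s a ∧ above v a c) xor (t xor false)) (own c)) (xor-identityʳ _))
            even₂ : s a ≡ s c
            even₂ = xor-cancel (trans (cong₂ _xor_ (sym (∧-identityʳ (s a)))
              (trans (sym (∧-identityʳ (s c))) (sym (xor-identityʳ (s c ∧ true)))))
              (trans (cong (λ N → ∑ N λ w → s w ∧ true) (sym e)) (∑-nbrs-even v)))
            total : above v c a xor above v a c ≡ not (rightward v a xor rightward v c)
            total = let (cp , cq , p≢q) = dart-corners va ; (_ , cr , p≢r) = dart-corners vc in
              startsAbove-total Cor x-inj cp cq cr p≢q p≢r (darts-meet va vc a≢c)
            balance : ∀ s p q r t → p xor q ≡ not (r xor t) → (s ∧ p) xor (r ∧ s) ≡ (s ∧ q) xor (not t ∧ s)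
            balance false p q r t _ rewrite ∧-zeroʳ r | ∧-zeroʳ (not t) = refl
            balance true false false false true _ = refl
            balance true false false true false _ = refl
            balance true false true false false _ = refl
            balance true false true true true _ = refl
            balance true true false false false _ = refl
            balance true true false true true _ = refl
            balance true true true false true _ = refl
            balance true true true true false _ = refl
            step : ∀ {i o i′ o′} {p q : Vertex} → Adj v p → Adj v q → (∑ V λ w → s w ∧ above v w p) ≡ i → (∑ V λ w → s w ∧ above v w q) ≡ o →
              rightward v p ∧ s p ≡ i′ → not (rightward v q) ∧ s q ≡ o′ → i xor i′ ≡ o xor o′ → leftFace S p v ≡ leftFace S v q
            step vp vq refl refl refl refl eq = trans (into (Adj-sym G vp)) (trans (cong (n xor_) eq) (sym (outOfV vq)))
            cases : ∀ {u} → u ∈ a ∷ c ∷ [] → leftFace S u v ≡ leftFace S v (successorIn v (a ∷ c ∷ []) u)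
            cases (here refl) rewrite dec-true (a Finₚ.≟ a) refl =
              step va vc sum-a sum-c refl refl (subst (λ t → (s c ∧ above v c a) xor (rightward v a ∧ t) ≡ (t ∧ above v a c) xor (not (rightward v c) ∧ s c)) (sym even₂)
                (balance (s c) (above v c a) (above v a c) (rightward v a) (rightward v c) total))
            cases (there (here refl)) rewrite dec-false (c Finₚ.≟ a) (a≢c ∘ sym) =
              step vc va sum-c sum-a refl refl (subst (λ t → (t ∧ above v a c) xor (rightward v c ∧ s c) ≡ (s c ∧ above v c a) xor (not (rightward v a) ∧ t)) (sym even₂)
                (balance (s c) (above v a c) (above v c a) (rightward v c) (rightward v a)
                  (trans (xor-comm (above v a c) _) (trans total (cong not (xor-comm (rightward v a) _))))))

          -- By evenness the third membership is the sum of the other two, which are the `s` and `t`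
          -- of the truth table. Hence all six sides at `v` are functions of the nine geometric
          -- Booleans and these two.
          face-constant₃ : ∀ {a c d} → nbrs G C v ≡ a ∷ c ∷ d ∷ [] → ∀ {u} → u ∈ a ∷ c ∷ d ∷ [] →
            leftFace S u v ≡ leftFace S v (successorIn v (a ∷ c ∷ d ∷ []) u)
          face-constant₃ {a} {c} {d} e = cases
            where
            open ≡-Reasoning
            N = a ∷ c ∷ d ∷ []
            va = adjacent e (here refl)
            vc = adjacent e (there (here refl))
            vd = adjacent e (there (there (here refl)))
            a≢c : a ≢ c
            a≢c = All.head (AllPairs.head (unique e))
            a≢d : a ≢ d
            a≢d = All.head (All.tail (AllPairs.head (unique e)))
            c≢d : c ≢ d
            c≢d = All.head (AllPairs.head (AllPairs.tail (unique e)))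
            ins = inTo (rightward v a) (rightward v c) (rightward v d)
              (above v a c) (above v c a) (above v a d) (above v d a) (above v c d) (above v d c) (s a) (s c)
            outs = outOf (rightward v a) (rightward v c) (rightward v d)
              (above v a c) (above v c a) (above v a d) (above v d a) (above v c d) (above v d c) (s a) (s c)
            along-forwards = forwards (rightward v a) (rightward v c) (rightward v d)
              (above v a c) (above v c a) (above v a d) (above v d a) (above v c d) (above v d c)
            along-backwards = backwards (rightward v a) (rightward v c) (rightward v d)
              (above v a c) (above v c a) (above v a d) (above v d a) (above v c d) (above v d c)
            i₁ = proj₁ ins
            i₂ = proj₁ (proj₂ ins)
            i₃ = proj₂ (proj₂ ins)
            o₁ = proj₁ outs
            o₂ = proj₁ (proj₂ outs)
            o₃ = proj₂ (proj₂ outs)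
            even₃ : s d ≡ s a xor s c
            even₃ = xor-cancel (trans (trans (xor-comm (s d) _) (trans (xor-assoc (s a) (s c) (s d))
                (cong₂ _xor_ (sym (∧-identityʳ (s a))) (cong₂ _xor_ (sym (∧-identityʳ (s c)))
                  (trans (sym (∧-identityʳ (s d))) (sym (xor-identityʳ (s d ∧ true))))))))
              (trans (cong (λ N → ∑ N λ w → s w ∧ true) (sym e)) (∑-nbrs-even v)))
            sum-a : (∑ V λ w → s w ∧ above v w a) ≡ (s c ∧ above v c a) xor ((s a xor s c) ∧ above v d a)
            sum-a = trans (below e a) (trans (cong₂ (λ t t′ → t xor ((s c ∧ above v c a) xor ((t′ ∧ above v d a) xor false))) (own a) even₃)
              (cong ((s c ∧ above v c a) xor_) (xor-identityʳ _)))
            sum-c : (∑ V λ w → s w ∧ above v w c) ≡ (s a ∧ above v a c) xor ((s a xor s c) ∧ above v d c)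
            sum-c = trans (below e c) (trans (cong₂ (λ t t′ → (s a ∧ above v a c) xor (t xor ((t′ ∧ above v d c) xor false))) (own c) even₃)
              (cong ((s a ∧ above v a c) xor_) (xor-identityʳ _)))
            sum-d : (∑ V λ w → s w ∧ above v w d) ≡ (s a ∧ above v a d) xor (s c ∧ above v c d)
            sum-d = trans (below e d) (trans (cong (λ t → (s a ∧ above v a d) xor ((s c ∧ above v c d) xor (t xor false))) (own d))
              (cong ((s a ∧ above v a d) xor_) (xor-identityʳ _)))
            into-a : leftFace S a v ≡ n xor i₁
            into-a = trans (into (Adj-sym G va)) (cong (λ t → n xor (t xor (rightward v a ∧ s a))) sum-a)
            into-c : leftFace S c v ≡ n xor i₂
            into-c = trans (into (Adj-sym G vc)) (cong (λ t → n xor (t xor (rightward v c ∧ s c))) sum-c)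
            into-d : leftFace S d v ≡ n xor i₃
            into-d = trans (into (Adj-sym G vd)) (cong₂ (λ t t′ → n xor (t xor (rightward v d ∧ t′))) sum-d even₃)
            out-a : leftFace S v a ≡ n xor o₁
            out-a = trans (outOfV va) (cong (λ t → n xor (t xor (not (rightward v a) ∧ s a))) sum-a)
            out-c : leftFace S v c ≡ n xor o₂
            out-c = trans (outOfV vc) (cong (λ t → n xor (t xor (not (rightward v c) ∧ s c))) sum-c)
            out-d : leftFace S v d ≡ n xor o₃
            out-d = trans (outOfV vd) (cong₂ (λ t t′ → n xor (t xor (not (rightward v d) ∧ t′))) sum-d even₃)
            ≐-sound : ∀ {p q} → (p ≐ q) ≡ true → p ≡ q
            ≐-sound {false} {false} _ = refl
            ≐-sound {true} {true} _ = refl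
            forward : turnsForward v a c d ≡ true → i₁ ≡ o₂ × i₂ ≡ o₃ × i₃ ≡ o₁
            forward h = let t = ∧-true {i₁ ≐ o₂} (tautology 2 along-forwards h (s a) (s c)) ; t′ = ∧-true {i₂ ≐ o₃} (proj₂ t) in
              ≐-sound (proj₁ t) , ≐-sound (proj₁ t′) , ≐-sound (proj₂ t′)
            backward : turnsForward v a c d ≡ false → i₁ ≡ o₃ × i₃ ≡ o₂ × i₂ ≡ o₁
            backward h = let t = ∧-true {i₁ ≐ o₃} (tautology 2 along-backwards (turns va vc vd a≢c a≢d c≢d h) (s a) (s c)) ; t′ = ∧-true {i₃ ≐ o₂} (proj₂ t) in
              ≐-sound (proj₁ t) , ≐-sound (proj₁ t′) , ≐-sound (proj₂ t′)
            link : ∀ {p q i o} → leftFace S p v ≡ n xor i → leftFace S v q ≡ n xor o → i ≡ o → leftFace S p v ≡ leftFace S v q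
            link p q refl = trans p (sym q)
            cases : ∀ {u} → u ∈ N → leftFace S u v ≡ leftFace S v (successorIn v N u)
            cases h with turnsForward v a c d in t
            cases (here refl) | true rewrite dec-true (a Finₚ.≟ a) refl = link into-a out-c (proj₁ (forward t))
            cases (there (here refl)) | true rewrite dec-false (c Finₚ.≟ a) (a≢c ∘ sym) | dec-true (c Finₚ.≟ c) refl =
              link into-c out-d (proj₁ (proj₂ (forward t)))
            cases (there (there (here refl))) | true rewrite dec-false (d Finₚ.≟ a) (a≢d ∘ sym) | dec-false (d Finₚ.≟ c) (c≢d ∘ sym) =
              link into-d out-a (proj₂ (proj₂ (forward t)))
            cases (here refl) | false rewrite dec-true (a Finₚ.≟ a) refl = link into-a out-d (proj₁ (backward t))
            cases (there (here refl)) | false rewrite dec-false (c Finₚ.≟ a) (a≢c ∘ sym) | dec-false (c Finₚ.≟ d) c≢d =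
              link into-c out-a (proj₂ (proj₂ (backward t)))
            cases (there (there (here refl))) | false rewrite dec-false (d Finₚ.≟ a) (a≢d ∘ sym) | dec-true (d Finₚ.≟ d) refl =
              link into-d out-c (proj₁ (proj₂ (backward t)))

-- Orbits of an injective map on a finite list; linear algebra over two elements.

module Orbits where

  open import Data.Bool.Base using (Bool; true; false; _xor_)
  open import Data.Bool.Properties using (xor-same)
  open import Data.Empty using (⊥-elim)
  open import Data.Fin.Base as Fin using (Fin; zero; suc; toℕ; funToFin; finToFun)
  import Data.Fin.Properties as Finₚ
  open import Data.List.Base using (List; []; _∷_; length; filter; lookup; applyUpTo)
  open import Data.List.Membership.Propositional using (_∈_; _∉_)
  open import Data.List.Membership.Propositional.Properties
    using (∈-filter⁺; ∈-filter⁻; ∈-applyUpTo⁺; ∈-applyUpTo⁻; ∈-lookup; ∈-++⁻)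
  open import Data.List.Properties using (length-++; length-applyUpTo)
  open import Data.List.Relation.Unary.All as All using (All)
  open import Data.List.Relation.Unary.Any as Any using (here; there; index)
  open import Data.List.Relation.Unary.Any.Properties using (lookup-index)
  open import Data.List.Relation.Unary.AllPairs using ([]; _∷_)
  open import Data.List.Relation.Unary.Unique.Propositional using (Unique)
  import Data.List.Relation.Unary.Unique.Propositional.Properties as Uniqueₚ
  open import Data.Nat.Base
  open import Data.Nat.Properties
  open import Data.Product.Base using (_×_; _,_; proj₁; proj₂; ∃-syntax)
  open import Data.Sum.Base using (_⊎_; inj₁; inj₂; [_,_]′)
  open import Function.Base using (_∘_)
  open import Relation.Binary.Definitions using (DecidableEquality)
  open import Relation.Binary.PropositionalEquality
  open import Relation.Nullary using (Dec; yes; no; contradiction; ¬?)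

  module _ {A : Set} where

    lookup-injective : ∀ {xs : List A} → Unique xs → ∀ i j → lookup xs i ≡ lookup xs j → i ≡ j
    lookup-injective (_ ∷ _) zero zero e = refl
    lookup-injective (fresh ∷ _) zero (suc j) e = ⊥-elim (All.lookup fresh (∈-lookup j) e)
    lookup-injective (fresh ∷ _) (suc i) zero e = ⊥-elim (All.lookup fresh (∈-lookup i) (sym e))
    lookup-injective (_ ∷ u) (suc i) (suc j) e = cong suc (lookup-injective u i j e)

    unique-⊆-length : ∀ {xs ys : List A} → Unique xs → (∀ {z} → z ∈ xs → z ∈ ys) → length xs ≤ length ys
    unique-⊆-length {xs} {ys} u sub with length xs ≤? length ys
    ... | yes le = le
    ... | no ¬le with Finₚ.pigeonhole (≰⇒> ¬le) (λ i → index (sub (∈-lookup {xs = xs} i)))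
    ... | i , j , i<j , e = contradiction (lookup-injective u i j same) (Finₚ.<⇒≢ i<j)
      where
      same : lookup xs i ≡ lookup xs j
      same = trans (lookup-index (sub (∈-lookup {xs = xs} i)))
        (trans (cong (lookup ys) e) (sym (lookup-index (sub (∈-lookup {xs = xs} j)))))

    module _ (N : A → A) where

      iterate : ℕ → A → A
      iterate zero z = z
      iterate (suc i) z = N (iterate i z)

      module _ (_≟_ : DecidableEquality A) (g : ℕ) where

        -- The field `long` bounds all orbits from below without speaking of orbits; for darts `g`
        -- is the girth bound.
        record Orbital (L : List A) : Set where
          field
            unique    : Unique L
            closed    : ∀ {z} → z ∈ L → N z ∈ L
            injective : ∀ {z w} → z ∈ L → w ∈ L → N z ≡ N w → z ≡ w
            long      : ∀ {z} → z ∈ L → ∀ i → 0 < i → i < g → iterate i z ≢ z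

          iterate-∈ : ∀ {z} → z ∈ L → ∀ i → iterate i z ∈ L
          iterate-∈ z∈ zero = z∈
          iterate-∈ z∈ (suc i) = closed (iterate-∈ z∈ i)

          cancel : ∀ {z} → z ∈ L → ∀ i j → iterate i z ≡ iterate (i + j) z → z ≡ iterate j z
          cancel z∈ zero j e = e
          cancel z∈ (suc i) j e = cancel z∈ i j (injective (iterate-∈ z∈ i) (iterate-∈ z∈ (i + j)) e)

          collision : ∀ {z} → z ∈ L → ∀ {i j} → i < j → iterate i z ≡ iterate j z → iterate (j ∸ i) z ≡ z
          collision z∈ {i} {j} i<j e =
            sym (cancel z∈ i (j ∸ i) (trans e (cong (λ k → iterate k _) (sym (m+[n∸m]≡n (<⇒≤ i<j))))))

          -- Two of the first `suc (length L)` iterates coincide, and injectivity pulls the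
          -- coincidence back to `z` itself.
          period : ∀ {z} → z ∈ L → ∃[ p ] (0 < p × iterate p z ≡ z)
          period {z} z∈ with Finₚ.pigeonhole (n<1+n (length L)) (λ i → index (iterate-∈ z∈ (toℕ i)))
          ... | i , j , i<j , e = toℕ j ∸ toℕ i , m<n⇒0<n∸m i<j , collision z∈ i<j
            (trans (lookup-index (iterate-∈ z∈ (toℕ i)))
              (trans (cong (lookup L) e) (sym (lookup-index (iterate-∈ z∈ (toℕ j))))))

          apart : ∀ {z} → z ∈ L → ∀ {i j} → i < j → j < g → iterate i z ≢ iterate j z
          apart z∈ {i} {j} i<j j<g e =
            long z∈ (j ∸ i) (m<n⇒0<n∸m i<j) (≤-<-trans (m∸n≤m j i) j<g) (collision z∈ i<j e)

        open Orbital

        module _ {L : List A} (o : Orbital L) {x : A} (x∈ : x ∈ L) where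
          private
            p = proj₁ (period o x∈)
            0<p = proj₁ (proj₂ (period o x∈))
            wrap : iterate p x ≡ x
            wrap = proj₂ (proj₂ (period o x∈))

            orbit : List A
            orbit = applyUpTo (λ i → iterate i x) p

          in-orbit? : ∀ z → Dec (z ∈ orbit)
          in-orbit? z = Any.any? (z ≟_) orbit

          remaining : List A
          remaining = filter (¬? ∘ in-orbit?) L

          private
            remaining⁻ : ∀ {z} → z ∈ remaining → z ∈ L × z ∉ orbit
            remaining⁻ = ∈-filter⁻ (¬? ∘ in-orbit?)

            orbit⁻ : ∀ {z} → z ∈ orbit → ∃[ i ] (i < p × z ≡ iterate i x)
            orbit⁻ = ∈-applyUpTo⁻ (λ i → iterate i x)

            orbit⁺ : ∀ {i} → i < p → iterate i x ∈ orbit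
            orbit⁺ = ∈-applyUpTo⁺ (λ i → iterate i x)

            -- This keeps the complement of the orbit closed under `N`. What is mapped to the start
            -- `x` must be the last iterate before the orbit wraps around.
            predecessor : ∀ {z} → z ∈ L → ∀ i → i < p → N z ≡ iterate i x → z ∈ orbit
            predecessor z∈ (suc i) i<p e =
              subst (_∈ orbit) (sym (injective o z∈ (iterate-∈ o x∈ i) e)) (orbit⁺ (<-trans (n<1+n i) i<p))
            predecessor {z} z∈ zero _ e = before-wrap p 0<p wrap orbit⁺
              where
              before-wrap : ∀ q → 0 < q → iterate q x ≡ x → (∀ {i} → i < q → iterate i x ∈ orbit) → z ∈ orbit
              before-wrap (suc q) _ w f =
                subst (_∈ orbit) (sym (injective o z∈ (iterate-∈ o x∈ q) (trans e (sym w)))) (f (n<1+n q))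

          remaining-orbital : Orbital remaining
          remaining-orbital = record
            { unique = Uniqueₚ.filter⁺ (¬? ∘ in-orbit?) (unique o)
            ; closed = λ z∈ → let (z∈L , z∉) = remaining⁻ z∈ in
                ∈-filter⁺ (¬? ∘ in-orbit?) (closed o z∈L) λ h →
                  let (i , i<p , e) = orbit⁻ h in z∉ (predecessor z∈L i i<p e)
            ; injective = λ z∈ w∈ → injective o (proj₁ (remaining⁻ z∈)) (proj₁ (remaining⁻ w∈))
            ; long = λ z∈ → long o (proj₁ (remaining⁻ z∈))
            }

          g≤p : g ≤ p
          g≤p = ≮⇒≥ λ p<g → long o x∈ p 0<p p<g wrap

          -- The first `g` iterates are distinct by `apart` and belong to the removed orbit, so
          -- together with the remaining elements they form a duplicate-free list inside `L`.
          remaining-length : g + length remaining ≤ length L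
          remaining-length = ≤-trans (≤-reflexive (sym (trans (length-++ start) (cong (_+ length remaining) (length-applyUpTo (λ i → iterate i x) g)))))
            (unique-⊆-length
              (Uniqueₚ.++⁺ (Uniqueₚ.applyUpTo⁺₁ (λ i → iterate i x) g (λ i<j j<g → apart o x∈ i<j j<g))
                (unique remaining-orbital) λ (h , k) → proj₂ (remaining⁻ k) (start⊆ h))
              (λ h → [ (λ k → let (i , _ , e) = ∈-applyUpTo⁻ (λ i → iterate i x) k in subst (_∈ L) (sym e) (iterate-∈ o x∈ i))
                     , proj₁ ∘ remaining⁻ ]′ (∈-++⁻ start h)))
            where
            start = applyUpTo (λ i → iterate i x) g
            start⊆ : ∀ {z} → z ∈ start → z ∈ orbit
            start⊆ h = let (i , i<g , e) = ∈-applyUpTo⁻ (λ i → iterate i x) h in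
              subst (_∈ orbit) (sym e) (orbit⁺ (<-≤-trans i<g g≤p))

          covered : ∀ {z} → z ∈ L → z ∈ remaining ⊎ ∃[ i ] (z ≡ iterate i x)
          covered {z} z∈ with in-orbit? z
          ... | yes h = let (i , _ , e) = orbit⁻ h in inj₂ (i , e)
          ... | no ¬h = inj₁ (∈-filter⁺ (¬? ∘ in-orbit?) z∈ ¬h)

        opaque
          peel-orbit : ∀ {L x} → Orbital L → x ∈ L → ∃[ R ] (Orbital R × g + length R ≤ length L ×
            (∀ {z} → z ∈ R → z ∈ L) × (∀ {z} → z ∈ L → z ∈ R ⊎ ∃[ i ] (z ≡ iterate i x)))
          peel-orbit o x∈ = remaining o x∈ , remaining-orbital o x∈ , remaining-length o x∈
            , proj₁ ∘ ∈-filter⁻ (¬? ∘ in-orbit? o x∈) , covered o x∈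

        -- Every orbit that is peeled off takes at least `g` elements away. This gives the count of
        -- representatives and, with `n` as fuel, termination.
        representatives : ∀ n L → length L ≤ n → Orbital L → 0 < g →
          ∃[ rs ] (length rs * g ≤ length L × (∀ {r} → r ∈ rs → r ∈ L) ×
                   (∀ {z} → z ∈ L → ∃[ r ] (r ∈ rs × ∃[ i ] (z ≡ iterate i r))))
        representatives n [] le o 0<g = [] , z≤n , (λ ()) , λ ()
        representatives zero (x ∷ L) () o 0<g
        representatives (suc n) (x ∷ L) le o 0<g with peel-orbit o (here refl)
        ... | R , oR , shorter , R⊆L , cover
          with representatives n R (s≤s⁻¹ (≤-trans (+-monoˡ-≤ _ 0<g) (≤-trans shorter le))) oR 0<g
        ... | rs , size , sub , cover′ =
          x ∷ rs
          , ≤-trans (+-monoʳ-≤ g size) shorter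
          , (λ { (here refl) → here refl ; (there h) → R⊆L (sub h) })
          , λ h → [ (λ k → let (r , r∈ , e) = cover′ k in r , there r∈ , e)
                  , (λ (i , e) → x , here refl , i , e) ]′ (cover h)

  bit : Bool → Fin 2
  bit true = zero
  bit false = suc zero

  unbit : Fin 2 → Bool
  unbit zero = true
  unbit (suc zero) = false

  unbit-bit : ∀ b → unbit (bit b) ≡ b
  unbit-bit true = refl
  unbit-bit false = refl

  unbit-injective : ∀ {i j} → unbit i ≡ unbit j → i ≡ j
  unbit-injective {zero} {zero} _ = refl
  unbit-injective {zero} {suc zero} ()
  unbit-injective {suc zero} {zero} ()
  unbit-injective {suc zero} {suc zero} _ = refl

  funToFin-cong : ∀ {m n} {f h : Fin m → Fin n} → f ≗ h → funToFin f ≡ funToFin h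
  funToFin-cong {zero} e = refl
  funToFin-cong {suc m} e = cong₂ Fin.combine (e zero) (funToFin-cong (e ∘ suc))

  -- Pigeonhole on the 2 ^ m vectors: the difference of two with equal values.
  nontrivial-solution : ∀ {m M} → M < m → (Φ : (Fin m → Bool) → Fin M → Bool) →
    (∀ s t j → Φ (λ i → s i xor t i) j ≡ Φ s j xor Φ t j) →
    ∃[ s ] ((∃[ i ] s i ≡ true) × (∀ j → Φ s j ≡ false))
  nontrivial-solution {m} {M} M<m Φ additive
    with Finₚ.pigeonhole (^-monoʳ-< 2 (s≤s (s≤s z≤n)) M<m) (λ k → funToFin (bit ∘ Φ (unbit ∘ finToFun k)))
  ... | k , l , k<l , e = s , nonzero (Finₚ.any? (λ i → s i Data.Bool.Properties.≟ true)) , vanish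
    where
    import Data.Bool.Properties
    a b s : Fin m → Bool
    a = unbit ∘ finToFun k
    b = unbit ∘ finToFun l
    s i = a i xor b i
    nonzero : Dec (∃[ i ] s i ≡ true) → ∃[ i ] s i ≡ true
    nonzero (yes h) = h
    nonzero (no ¬h) = ⊥-elim (Finₚ.<⇒≢ k<l (begin
      k                    ≡⟨ Finₚ.funToFin-finToFin {m} {2} k ⟨
      funToFin (finToFun {2} {m} k) ≡⟨ funToFin-cong (λ i → unbit-injective (same (a i) (b i) (λ h → ¬h (i , h)))) ⟩
      funToFin (finToFun {2} {m} l) ≡⟨ Finₚ.funToFin-finToFin {m} {2} l ⟩
      l                    ∎))
      where
      open ≡-Reasoning
      same : ∀ p q → p xor q ≢ true → p ≡ q
      same true true _ = refl
      same true false h = ⊥-elim (h refl)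
      same false true h = ⊥-elim (h refl)
      same false false _ = refl
    vanish : ∀ j → Φ s j ≡ false
    vanish j = trans (additive a b j) (trans (cong (_xor Φ b j) agree) (xor-same (Φ b j)))
      where
      agree : Φ a j ≡ Φ b j
      agree = begin
        Φ a j                                        ≡⟨ unbit-bit _ ⟨
        unbit (bit (Φ a j))                          ≡⟨ cong unbit (Finₚ.finToFun-funToFin (bit ∘ Φ a) j) ⟨
        unbit (finToFun (funToFin (bit ∘ Φ a)) j)    ≡⟨ cong (λ f → unbit (finToFun f j)) e ⟩
        unbit (finToFun (funToFin (bit ∘ Φ b)) j)    ≡⟨ cong unbit (Finₚ.finToFun-funToFin (bit ∘ Φ b) j) ⟩
        unbit (bit (Φ b j))                          ≡⟨ unbit-bit _ ⟩
        Φ b j                                        ∎ where open ≡-Reasoning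

-- Euler's inequality for a plane subgraph with degrees two and three.

module Euler where

  open Drawing using (PlaneArcs)
  open Parity
  open Induced
  open Rotation
  open Orbits
  open Walks
  open Sums
  open import Data.Bool.Base using (Bool; true; false; _∧_; _∨_; _xor_; T; if_then_else_)
  open import Data.Bool.Properties
    using (T?; T-∧; xor-same; ∧-zeroʳ; ∧-identityʳ; ∧-distribʳ-xor; ∨-comm)
  open import Data.Empty using (⊥-elim)
  open import Data.Fin.Base as Fin using (Fin)
  import Data.Fin.Properties as Finₚ
  open import Data.List.Base
    using (List; []; _∷_; _++_; length; filter; lookup; map; allFin; cartesianProduct)
  open import Data.List.Membership.Propositional using (_∈_)
  open import Data.List.Membership.Propositional.Properties
  open import Data.List.Properties using (length-++; length-map; filter-++)
  import Data.List.Relation.Unary.All as All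
  import Data.List.Relation.Unary.AllPairs as AllPairs
  open import Data.List.Relation.Unary.Any using (here; there; index)
  open import Data.List.Relation.Unary.Any.Properties using (lookup-index)
  open import Data.List.Relation.Unary.Unique.Propositional using (Unique)
  import Data.List.Relation.Unary.Unique.Propositional.Properties as Uniqueₚ
  open import Data.Nat.Base
  open import Data.Nat.Properties hiding (_≟_)
  open import Data.Nat.Solver using (module +-*-Solver)
  open import Data.Product.Base using (_×_; _,_; proj₁; proj₂; ∃-syntax; swap)
  open import Data.Product.Properties using (≡-dec; ,-injectiveˡ; ,-injectiveʳ)
  open import Data.Sum.Base using (_⊎_; inj₁; inj₂)
  open import Function.Base using (_∘_)
  open import Function.Bundles using (Equivalence)
  open import Relation.Binary.Definitions using (tri<; tri≈; tri>)
  open import Relation.Binary.PropositionalEquality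
  open import Relation.Nullary using (Dec; yes; no; does; contradiction; ¬?)
  open import Relation.Nullary.Decidable using (dec-true; dec-false)
  open import Relation.Unary using (Pred; Decidable)
  open import Level using (0ℓ)

  module ℕ∑ = Sum _+_ 0 +-0-isCommutativeMonoid

  length-filter-split : ∀ {A : Set} {P : Pred A 0ℓ} (P? : Decidable P) xs →
    length xs ≡ length (filter P? xs) + length (filter (¬? ∘ P?) xs)
  length-filter-split P? [] = refl
  length-filter-split P? (x ∷ xs) with P? x
  ... | yes _ = cong suc (length-filter-split P? xs)
  ... | no _ = trans (cong suc (length-filter-split P? xs)) (sym (+-suc (length (filter P? xs)) _))

  length-filter-map : ∀ {A B : Set} {P : Pred B 0ℓ} (P? : Decidable P) (f : A → B) xs →
    length (filter P? (map f xs)) ≡ length (filter (P? ∘ f) xs)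
  length-filter-map P? f [] = refl
  length-filter-map P? f (x ∷ xs) with does (P? (f x))
  ... | true = cong suc (length-filter-map P? f xs)
  ... | false = length-filter-map P? f xs

  length-filter-product : ∀ {A B : Set} {P : Pred (A × B) 0ℓ} (P? : Decidable P) xs ys →
    length (filter P? (cartesianProduct xs ys)) ≡ ℕ∑.∑ xs (λ x → length (filter (λ y → P? (x , y)) ys))
  length-filter-product P? [] ys = refl
  length-filter-product P? (x ∷ xs) ys = trans
    (cong length (filter-++ P? (map (x ,_) ys) (cartesianProduct xs ys)))
    (trans (length-++ (filter P? (map (x ,_) ys)))
      (cong₂ _+_ (length-filter-map P? (x ,_) ys) (length-filter-product P? xs ys)))

  ∑-true : ∀ {I : Set} (is : List I) {f : I → Bool} → ∑ is f ≡ true → ∃[ i ] f i ≡ true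
  ∑-true (i ∷ is) {f} e with f i in eq
  ... | true = i , eq
  ... | false = ∑-true is e

  TwoOrThree : {A : Set} → List A → Set
  TwoOrThree N = (∃[ a ] ∃[ c ] N ≡ a ∷ c ∷ []) ⊎ (∃[ a ] ∃[ c ] ∃[ d ] N ≡ a ∷ c ∷ d ∷ [])

  module _ {G : Graph} (PA : PlaneArcs G) where
    open Graph G using (Vertex; Adj; adj; adj-sym; order; IsCycle)

    private
      V = allFin order

    module _ (v : Vertex) where
      private
        next = successorIn PA v

      next-two : ∀ {a c} → a ≢ c → next (a ∷ c ∷ []) a ≡ c × next (a ∷ c ∷ []) c ≡ a
      next-two {a} {c} a≢c rewrite dec-true (a Finₚ.≟ a) refl | dec-false (c Finₚ.≟ a) (a≢c ∘ sym) = refl , refl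

      next-three : ∀ {a c d} → a ≢ c → a ≢ d → c ≢ d → let N = a ∷ c ∷ d ∷ [] in
        (next N a ≡ c × next N c ≡ d × next N d ≡ a) ⊎ (next N a ≡ d × next N c ≡ a × next N d ≡ c)
      next-three {a} {c} {d} a≢c a≢d c≢d with turnsForward PA v a c d
      ... | true rewrite dec-true (a Finₚ.≟ a) refl | dec-false (c Finₚ.≟ a) (a≢c ∘ sym) | dec-true (c Finₚ.≟ c) refl
                       | dec-false (d Finₚ.≟ a) (a≢d ∘ sym) | dec-false (d Finₚ.≟ c) (c≢d ∘ sym) = inj₁ (refl , refl , refl)
      ... | false rewrite dec-true (a Finₚ.≟ a) refl | dec-false (c Finₚ.≟ a) (a≢c ∘ sym) | dec-false (c Finₚ.≟ d) c≢d
                        | dec-false (d Finₚ.≟ a) (a≢d ∘ sym) | dec-true (d Finₚ.≟ d) refl = inj₂ (refl , refl , refl)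

    -- The condition `f u ≢ u` says that a dart does not turn back, and injectivity makes the
    -- turning map on darts injective.
    Permutes : (Vertex → Vertex) → List Vertex → Set
    Permutes f N = (∀ {u} → u ∈ N → f u ∈ N × f u ≢ u) × (∀ {u w} → u ∈ N → w ∈ N → f u ≡ f w → u ≡ w)

    module _ (f : Vertex → Vertex) where
      permutes-two : ∀ {a c} → a ≢ c → f a ≡ c × f c ≡ a → Permutes f (a ∷ c ∷ [])
      permutes-two a≢c (na , nc) = (λ { (here refl) → there (here na) , λ e → a≢c (trans (sym e) na)
                         ; (there (here refl)) → here nc , λ e → a≢c (trans (sym nc) e) })
                    , λ { (here refl) (here refl) _ → refl
                        ; (here refl) (there (here refl)) e → trans (sym nc) (trans (sym e) na)
                        ; (there (here refl)) (here refl) e → trans (sym na) (trans (sym e) nc)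
                        ; (there (here refl)) (there (here refl)) _ → refl }

      permutes-three : ∀ {a c d} → a ≢ c → a ≢ d → c ≢ d →
        (f a ≡ c × f c ≡ d × f d ≡ a) ⊎ (f a ≡ d × f c ≡ a × f d ≡ c) → Permutes f (a ∷ c ∷ d ∷ [])
      permutes-three {a} {c} {d} a≢c a≢d c≢d (inj₁ (na , nc , nd)) =
        (λ { (here refl) → there (here na) , λ e → a≢c (trans (sym e) na)
           ; (there (here refl)) → there (there (here nc)) , λ e → c≢d (trans (sym e) nc)
           ; (there (there (here refl))) → here nd , λ e → a≢d (trans (sym nd) e) })
        , inj
        where
        inj : ∀ {u w} → u ∈ a ∷ c ∷ d ∷ [] → w ∈ a ∷ c ∷ d ∷ [] → f u ≡ f w → u ≡ w
        inj (here refl) (here refl) _ = refl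
        inj (here refl) (there (here refl)) e = contradiction (trans (sym na) (trans e nc)) c≢d
        inj (here refl) (there (there (here refl))) e = contradiction (trans (sym nd) (trans (sym e) na)) a≢c
        inj (there (here refl)) (here refl) e = contradiction (trans (sym na) (trans (sym e) nc)) c≢d
        inj (there (here refl)) (there (here refl)) _ = refl
        inj (there (here refl)) (there (there (here refl))) e = contradiction (trans (sym nd) (trans (sym e) nc)) a≢d
        inj (there (there (here refl))) (here refl) e = contradiction (trans (sym nd) (trans e na)) a≢c
        inj (there (there (here refl))) (there (here refl)) e = contradiction (trans (sym nd) (trans e nc)) a≢d
        inj (there (there (here refl))) (there (there (here refl))) _ = refl
      permutes-three {a} {c} {d} a≢c a≢d c≢d (inj₂ (na , nc , nd)) =
        (λ { (here refl) → there (there (here na)) , λ e → a≢d (trans (sym e) na)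
           ; (there (here refl)) → here nc , λ e → a≢c (trans (sym nc) e)
           ; (there (there (here refl))) → there (here nd) , λ e → c≢d (trans (sym nd) e) })
        , inj
        where
        inj : ∀ {u w} → u ∈ a ∷ c ∷ d ∷ [] → w ∈ a ∷ c ∷ d ∷ [] → f u ≡ f w → u ≡ w
        inj (here refl) (here refl) _ = refl
        inj (here refl) (there (here refl)) e = contradiction (trans (sym nc) (trans (sym e) na)) a≢d
        inj (here refl) (there (there (here refl))) e = contradiction (trans (sym nd) (trans (sym e) na)) c≢d
        inj (there (here refl)) (here refl) e = contradiction (trans (sym nc) (trans e na)) a≢d
        inj (there (here refl)) (there (here refl)) _ = refl
        inj (there (here refl)) (there (there (here refl))) e = contradiction (trans (sym nc) (trans e nd)) a≢c
        inj (there (there (here refl))) (here refl) e = contradiction (trans (sym nd) (trans e na)) c≢d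
        inj (there (there (here refl))) (there (here refl)) e = contradiction (trans (sym nc) (trans (sym e) nd)) a≢c
        inj (there (there (here refl))) (there (there (here refl))) _ = refl

    next-permutes : ∀ v {N} → TwoOrThree N → Unique N → Permutes (successorIn PA v N) N
    next-permutes v (inj₁ (a , c , refl)) ((a≢c All.∷ _) AllPairs.∷ _) = permutes-two _ a≢c (next-two v a≢c)
    next-permutes v (inj₂ (a , c , d , refl)) ((a≢c All.∷ a≢d All.∷ _) AllPairs.∷ (c≢d All.∷ _) AllPairs.∷ _) =
      permutes-three _ a≢c a≢d c≢d (next-three v a≢c a≢d c≢d)

    module _ (C : Vertex → Bool) (degrees : ∀ v → T (C v) → TwoOrThree (nbrs G C v)) where

      Dart : Set
      Dart = Vertex × Vertex

      dart? : ∀ (d : Dart) → Dec (T ((C (proj₁ d) ∧ C (proj₂ d)) ∧ adj (proj₁ d) (proj₂ d)))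
      dart? d = T? _

      darts edges vertices : _
      darts = filter dart? (cartesianProduct V V)
      edges = filter (λ (d : Dart) → proj₁ d Finₚ.<? proj₂ d) darts
      vertices = filter (λ v → T? (C v)) V

      darts⁻ : ∀ {u v} → (u , v) ∈ darts → T (C u) × T (C v) × Adj u v
      darts⁻ h = let (cc , a) = Equivalence.to T-∧ (proj₂ (∈-filter⁻ dart? {xs = cartesianProduct V V} h))
                     (cu , cv) = Equivalence.to T-∧ cc in cu , cv , a

      darts⁺ : ∀ {u v} → T (C u) → T (C v) → Adj u v → (u , v) ∈ darts
      darts⁺ cu cv a = ∈-filter⁺ dart? (∈-cartesianProduct⁺ (∈-allFin _) (∈-allFin _))
        (Equivalence.from T-∧ (Equivalence.from T-∧ (cu , cv) , a))

      darts-unique : Unique darts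
      darts-unique = Uniqueₚ.filter⁺ dart? (Uniqueₚ.cartesianProduct⁺ (Uniqueₚ.allFin⁺ order) (Uniqueₚ.allFin⁺ order))

      edges⁻ : ∀ {u v} → (u , v) ∈ edges → (u , v) ∈ darts × u Fin.< v
      edges⁻ = ∈-filter⁻ (λ (d : Dart) → proj₁ d Finₚ.<? proj₂ d) {xs = darts}

      edges-unique : Unique edges
      edges-unique = Uniqueₚ.filter⁺ (λ (d : Dart) → proj₁ d Finₚ.<? proj₂ d) darts-unique

      darts-halve : length darts ≤ length edges + length edges
      darts-halve = ≤-trans (≤-reflexive (length-filter-split (λ (d : Dart) → proj₁ d Finₚ.<? proj₂ d) darts))
        (+-monoʳ-≤ (length edges) (≤-trans (≤-reflexive (sym (length-map swap (filter (¬? ∘ (λ (d : Dart) → proj₁ d Finₚ.<? proj₂ d)) darts))))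
          (unique-⊆-length (Uniqueₚ.map⁺ swap-injective (Uniqueₚ.filter⁺ (¬? ∘ (λ (d : Dart) → proj₁ d Finₚ.<? proj₂ d)) darts-unique)) reversed)))
        where
        swap-injective : ∀ {d e : Dart} → swap d ≡ swap e → d ≡ e
        swap-injective refl = refl
        reversed : ∀ {d} → d ∈ map swap (filter (¬? ∘ (λ (d : Dart) → proj₁ d Finₚ.<? proj₂ d)) darts) → d ∈ edges
        reversed h with ∈-map⁻ swap h
        ... | (u , v) , k , refl with ∈-filter⁻ (¬? ∘ (λ (d : Dart) → proj₁ d Finₚ.<? proj₂ d)) {xs = darts} k
        ... | uv , u≮v with darts⁻ uv
        ... | cu , cv , a with Finₚ.<-cmp u v
        ... | tri< u<v _ _ = contradiction u<v u≮v
        ... | tri≈ _ refl _ = ⊥-elim (loopless G a)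
        ... | tri> _ _ v<u = ∈-filter⁺ (λ (d : Dart) → proj₁ d Finₚ.<? proj₂ d) (darts⁺ cv cu (Adj-sym G a)) v<u

      darts-length : length darts ≡ ℕ∑.∑ vertices (λ v → length (nbrs G C v))
      darts-length = trans (length-filter-product dart? V V)
        (trans (ℕ∑.∑-cong V (λ {v} _ → row v)) (sym (ℕ∑.∑-filter (λ v → T? (C v)) V (λ v → length (nbrs G C v)))))
        where
        none : ∀ (xs : List Vertex) → length (filter (λ (_ : Vertex) → T? false) xs) ≡ 0
        none [] = refl
        none (x ∷ xs) = none xs
        row : ∀ v → length (filter (λ u → dart? (v , u)) V) ≡ (if does (T? (C v)) then length (nbrs G C v) else 0)
        row v with C v
        ... | true = refl
        ... | false = none V

      N : Dart → Dart
      N (u , v) = v , successorIn PA v (nbrs G C v) u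

      module _ {u v : Vertex} (uv : (u , v) ∈ darts) where
        private
          h = darts⁻ uv
          u∈ : u ∈ nbrs G C v
          u∈ = ∈-nbrs⁺ G C (proj₁ h) (Adj-sym G (proj₂ (proj₂ h)))
          permutes = next-permutes v (degrees v (proj₁ (proj₂ h))) (nbrs-unique G C v)

        N-closed : N (u , v) ∈ darts
        N-closed = let (cw , a) = ∈-nbrs⁻ G C (proj₁ (proj₁ permutes u∈)) in darts⁺ (proj₁ (proj₂ h)) cw a

        N-turns : proj₂ (N (u , v)) ≢ u
        N-turns = proj₂ (proj₁ permutes u∈)

        N-injective : ∀ {w x} → (w , x) ∈ darts → N (u , v) ≡ N (w , x) → (u , v) ≡ (w , x)
        N-injective wx e with ,-injectiveˡ e
        ... | refl = cong (_, v) (proj₂ permutes u∈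
          (∈-nbrs⁺ G C (proj₁ (darts⁻ wx)) (Adj-sym G (proj₂ (proj₂ (darts⁻ wx))))) (,-injectiveʳ e))

      module _ {g : ℕ} (girth : ∀ c → IsCycle c → g ≤ length c) where

        orbital : Orbital N (≡-dec Finₚ._≟_ Finₚ._≟_) g darts
        orbital = record
          { unique = darts-unique
          ; closed = N-closed
          ; injective = λ z∈ w∈ → N-injective z∈ w∈
          ; long = long
          }
          where
          iterates : ∀ {d} → d ∈ darts → ∀ i → iterate N i d ∈ darts
          iterates d∈ zero = d∈
          iterates d∈ (suc i) = N-closed (iterates d∈ i)
          long : ∀ {d} → d ∈ darts → ∀ i → 0 < i → i < g → iterate N i d ≢ d
          long {d} d∈ i 0<i i<g e =
            -- Read off by first vertices, an orbit is a closed walk without backtracking, so it is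
            -- at least as long as some cycle.
            let (c , cyc , le) = closed-walk-cycle G (λ j → proj₁ (iterate N j d)) i 0<i
                  (λ j → proj₂ (proj₂ (darts⁻ (iterates d∈ j))))
                  (λ j h → N-turns (iterates d∈ j) (sym h)) (cong proj₁ e)
            in <-irrefl refl (<-≤-trans i<g (≤-trans (girth c cyc) le))

      hit : Dart → Vertex → Vertex → Bool
      hit (a , b) u v = does (≡-dec Finₚ._≟_ Finₚ._≟_ (a , b) (u , v)) ∨ does (≡-dec Finₚ._≟_ Finₚ._≟_ (a , b) (v , u))

      -- A vector of bits over the edges is turned into the symmetric relation that `Even` and
      -- `leftFace` work with; edges are stored in one orientation, hence the two alternatives in
      -- `hit`.
      chain : (Fin (length edges) → Bool) → Vertex → Vertex → Bool
      chain s u v = ∑ (allFin (length edges)) (λ i → s i ∧ hit (lookup edges i) u v)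

      chain-additive : ∀ s t u v → chain (λ i → s i xor t i) u v ≡ chain s u v xor chain t u v
      chain-additive s t u v = trans (∑-cong (allFin _) (λ {i} _ → ∧-distribʳ-xor (hit (lookup edges i) u v) (s i) (t i)))
        (∑-∙ (allFin _) (λ i → s i ∧ hit (lookup edges i) u v) (λ i → t i ∧ hit (lookup edges i) u v))

      chain-sym : ∀ s u v → chain s u v ≡ chain s v u
      chain-sym s u v = ∑-cong (allFin _) (λ {i} _ → cong (s i ∧_) (∨-comm (does (≡-dec Finₚ._≟_ Finₚ._≟_ (lookup edges i) (u , v))) _))

      chain-support : ∀ s u v → chain s u v ≡ true → T (C u) × T (C v) × Adj u v
      chain-support s u v e with ∑-true (allFin _) e
      ... | i , h with ≡-dec Finₚ._≟_ Finₚ._≟_ (lookup edges i) (u , v) | ≡-dec Finₚ._≟_ Finₚ._≟_ (lookup edges i) (v , u)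
      ... | yes eq | _ = darts⁻ (proj₁ (edges⁻ (subst (_∈ edges) eq (∈-lookup i))))
      ... | no _ | yes eq = let (cv , cu , a) = darts⁻ (proj₁ (edges⁻ (subst (_∈ edges) eq (∈-lookup i)))) in cu , cv , Adj-sym G a
      ... | no _ | no _ = contradiction (trans (sym h) (∧-zeroʳ (s i))) λ ()

      chain-edge : ∀ s i → chain s (proj₁ (lookup edges i)) (proj₂ (lookup edges i)) ≡ s i
      chain-edge s i = trans
        (∑-single (Uniqueₚ.allFin⁺ _) (∈-allFin i) (λ {j} j≢i → trans (cong (s j ∧_) (miss j j≢i)) (∧-zeroʳ (s j))))
        (trans (cong (s i ∧_) (cong (_∨ does (≡-dec Finₚ._≟_ Finₚ._≟_ (lookup edges i) (v , u)))
          (dec-true (≡-dec Finₚ._≟_ Finₚ._≟_ (lookup edges i) (lookup edges i)) refl))) (∧-identityʳ (s i)))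
        where
        u = proj₁ (lookup edges i)
        v = proj₂ (lookup edges i)
        ordered : ∀ j → proj₁ (lookup edges j) Fin.< proj₂ (lookup edges j)
        ordered j = proj₂ (edges⁻ (∈-lookup {xs = edges} j))
        miss : ∀ j → j ≢ i → hit (lookup edges j) u v ≡ false
        miss j j≢i = cong₂ _∨_
          (dec-false (≡-dec Finₚ._≟_ Finₚ._≟_ (lookup edges j) (u , v)) (λ e → j≢i (lookup-injective edges-unique j i e)))
          (dec-false (≡-dec Finₚ._≟_ Finₚ._≟_ (lookup edges j) (v , u))
            (λ e → Finₚ.<-asym (ordered i) (subst₂ Fin._<_ (cong proj₁ e) (cong proj₂ e) (ordered j))))

      module _ {r : Vertex} {rest : List Vertex} (vertices≡ : vertices ≡ r ∷ rest) where

        -- Handshake: the boundaries of a chain at all vertices sum to zero, so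
        -- vanishing at all vertices but one suffices.
        chain-even : ∀ s → (∀ {v} → v ∈ rest → ∑ V (chain s v) ≡ false) → Even PA (chain s)
        chain-even s closed = record
          { S-sym = chain-sym s
          ; S-adj = λ u v e → proj₂ (proj₂ (chain-support s u v e))
          ; S-even = boundary
          }
          where
          other : ∀ {u} → u ≢ r → ∑ V (chain s u) ≡ false
          other {u} u≢r with T? (C u)
          ... | no ¬cu = ∑-zero V (λ {v} _ → absent v)
            where
            absent : ∀ v → chain s u v ≡ false
            absent v with chain s u v in e
            ... | false = refl
            ... | true = contradiction (proj₁ (chain-support s u v e)) ¬cu
          ... | yes cu with subst (u ∈_) vertices≡ (∈-filter⁺ (λ v → T? (C v)) (∈-allFin u) cu)
          ... | here e = contradiction e u≢r
          ... | there h = closed h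
          irrefl : ∀ u → chain s u u ≡ false
          irrefl u with chain s u u in e
          ... | false = refl
          ... | true = ⊥-elim (loopless G (proj₂ (proj₂ (chain-support s u u e))))
          total : ∑ V (λ u → ∑ V (chain s u)) ≡ false
          total = begin
            (∑ V λ u → ∑ V λ v → chain s u v)
              ≡⟨ ∑-cong V (λ {u} _ → ∑-cong V (λ {v} _ → sym (<ᶠ-split PA (chain s u) u (irrefl u) v))) ⟩
            (∑ V λ u → ∑ V λ v → (_<ᶠ_ PA u v ∧ chain s u v) xor (_<ᶠ_ PA v u ∧ chain s u v))
              ≡⟨ trans (∑-cong V (λ {u} _ → ∑-∙ V (λ v → _<ᶠ_ PA u v ∧ chain s u v) (λ v → _<ᶠ_ PA v u ∧ chain s u v))) (∑-∙ V _ _) ⟩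
            (∑ V λ u → ∑ V λ v → _<ᶠ_ PA u v ∧ chain s u v) xor (∑ V λ u → ∑ V λ v → _<ᶠ_ PA v u ∧ chain s u v)
              ≡⟨ cong ((∑ V λ u → ∑ V λ v → _<ᶠ_ PA u v ∧ chain s u v) xor_)
                   (trans (∑-comm V V (λ u v → _<ᶠ_ PA v u ∧ chain s u v))
                     (∑-cong V (λ {v} _ → ∑-cong V (λ {u} _ → cong (_<ᶠ_ PA v u ∧_) (chain-sym s u v))))) ⟩
            (∑ V λ u → ∑ V λ v → _<ᶠ_ PA u v ∧ chain s u v) xor (∑ V λ v → ∑ V λ u → _<ᶠ_ PA v u ∧ chain s v u)
              ≡⟨ xor-same (∑ V λ u → ∑ V λ v → _<ᶠ_ PA u v ∧ chain s u v) ⟩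
            false ∎ where open ≡-Reasoning
          boundary : ∀ u → ∑ V (chain s u) ≡ false
          boundary u with u Finₚ.≟ r
          ... | no u≢r = other u≢r
          ... | yes refl = trans (sym (∑-single (Uniqueₚ.allFin⁺ order) (∈-allFin r) other)) total

        module _ {g : ℕ} (0<g : 0 < g) (girth : ∀ c → IsCycle c → g ≤ length c) where
          private
            reps = representatives N (≡-dec Finₚ._≟_ Finₚ._≟_) g (length darts) darts ≤-refl (orbital girth) 0<g
            rs = proj₁ reps
            cover = proj₂ (proj₂ (proj₂ reps))

            equations : List (Vertex ⊎ Dart)
            equations = map inj₁ rest ++ map inj₂ rs

            form : (Vertex → Vertex → Bool) → Vertex ⊎ Dart → Bool
            form S (inj₁ v) = ∑ V (S v)
            form S (inj₂ (u , v)) = leftFace PA S u v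

            form-cong : ∀ {S S′} → (∀ u v → S u v ≡ S′ u v) → ∀ e → form S e ≡ form S′ e
            form-cong h (inj₁ v) = ∑-cong V (λ {w} _ → h v w)
            form-cong {S} {S′} h (inj₂ (u , v)) = cong₂ (λ o s → o xor (_ ∧ s))
              (∑-cong V (λ {a} _ → ∑-cong V (λ {b} _ → cong (_∧ _) (h a b)))) (h u v)

            form-additive : ∀ S S′ e → form (λ u v → S u v xor S′ u v) e ≡ form S e xor form S′ e
            form-additive S S′ (inj₁ v) = ∑-∙ V _ _
            form-additive S S′ (inj₂ (u , v)) = leftFace-additive PA S S′ u v

            -- Vanishing boundaries make the chain even, so its parities are constant along orbits.
            -- Being zero at the representatives they are zero on all darts, and `leftFace-jump`
            -- recovers the bit of an edge as the sum over its two darts.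
            solution-trivial : ∀ s → (∀ {e} → e ∈ equations → form (chain s) e ≡ false) → ∀ i → s i ≡ false
            solution-trivial s vanish i = trans (sym (chain-edge s i)) (trans (sym (leftFace-jump PA even adj-i))
              (cong₂ _xor_ (everywhere-zero uv) (everywhere-zero vu)))
              where
              even : Even PA (chain s)
              even = chain-even s (λ h → vanish (∈-++⁺ˡ (∈-map⁺ inj₁ h)))
              inside : ∀ u v → chain s u v ≡ true → T (C v)
              inside u v e = proj₁ (proj₂ (chain-support s u v e))
              constant : ∀ {u v} → (u , v) ∈ darts → leftFace PA (chain s) u v ≡ leftFace PA (chain s) v (proj₂ (N (u , v)))
              constant {u} {v} d with darts⁻ d
              ... | cu , cv , a with degrees v cv
              ... | inj₁ (_ , _ , e) = subst (λ N → leftFace PA (chain s) u v ≡ leftFace PA (chain s) v (successorIn PA v N u)) (sym e)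
                (face-constant₂ PA even inside e (subst (u ∈_) e (∈-nbrs⁺ G C cu (Adj-sym G a))))
              ... | inj₂ (_ , _ , _ , e) = subst (λ N → leftFace PA (chain s) u v ≡ leftFace PA (chain s) v (successorIn PA v N u)) (sym e)
                (face-constant₃ PA even inside e (subst (u ∈_) e (∈-nbrs⁺ G C cu (Adj-sym G a))))
              along-orbit : ∀ {d} → d ∈ darts → ∀ i → (iterate N i d ∈ darts) ×
                leftFace PA (chain s) (proj₁ (iterate N i d)) (proj₂ (iterate N i d)) ≡ leftFace PA (chain s) (proj₁ d) (proj₂ d)
              along-orbit d∈ zero = d∈ , refl
              along-orbit d∈ (suc i) = let (h , e) = along-orbit d∈ i in N-closed h , trans (sym (constant h)) e
              everywhere-zero : ∀ {u v} → (u , v) ∈ darts → leftFace PA (chain s) u v ≡ false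
              everywhere-zero d∈ with cover d∈
              ... | r , r∈ , k , refl = trans (proj₂ (along-orbit (proj₁ (proj₂ (proj₂ reps)) r∈) k))
                (vanish (∈-++⁺ʳ (map inj₁ rest) (∈-map⁺ inj₂ r∈)))
              uv = proj₁ (edges⁻ (∈-lookup {xs = edges} i))
              adj-i = proj₂ (proj₂ (darts⁻ uv))
              vu = darts⁺ (proj₁ (proj₂ (darts⁻ uv))) (proj₁ (darts⁻ uv)) (Adj-sym G adj-i)

          -- The equations: the boundaries at all vertices but one, and the faces.
          edges-bounded : length edges ≤ length equations
          edges-bounded with length edges ≤? length equations
          ... | yes le = le
          ... | no ¬le with nontrivial-solution (≰⇒> ¬le) (λ s j → form (chain s) (lookup equations j))
                  (λ s t j → trans (form-cong (chain-additive s t) (lookup equations j)) (form-additive (chain s) (chain t) (lookup equations j)))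
          ... | s , (i , si) , vanish = contradiction (trans (sym si) (solution-trivial s on-list i)) λ ()
            where
            on-list : ∀ {e} → e ∈ equations → form (chain s) e ≡ false
            on-list h = trans (cong (form (chain s)) (lookup-index h)) (vanish (index h))

          -- The number `F` of representatives is eliminated: `m + 1 ≤ n + F` is multiplied by
          -- `2 * g`, and then `F * g ≤ length darts` is inserted. Darts are counted because their
          -- number is the sum of the degrees.
          euler : g * length darts + 2 * g ≤ 2 * (g * length vertices) + 2 * length darts
          euler = begin
            g * length darts + 2 * g
              ≤⟨ +-monoˡ-≤ (2 * g) (*-monoʳ-≤ g darts-halve) ⟩
            g * (m + m) + 2 * g
              ≡⟨ solve 2 (λ g m → g :* (m :+ m) :+ con 2 :* g := con 2 :* (g :* (con 1 :+ m))) refl g m ⟩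
            2 * (g * suc m)
              ≤⟨ *-monoʳ-≤ 2 (*-monoʳ-≤ g (s≤s (≤-trans edges-bounded (≤-reflexive
                   (trans (length-++ (map inj₁ rest)) (cong₂ _+_ (length-map inj₁ rest) (length-map inj₂ rs))))))) ⟩
            2 * (g * suc (length rest + F))
              ≡⟨ cong (λ l → 2 * (g * (l + F))) (cong length vertices≡) ⟨
            2 * (g * (length vertices + F))
              ≡⟨ solve 3 (λ g n f → con 2 :* (g :* (n :+ f)) := con 2 :* (g :* n) :+ con 2 :* (f :* g)) refl g (length vertices) F ⟩
            2 * (g * length vertices) + 2 * (F * g)
              ≤⟨ +-monoʳ-≤ (2 * (g * length vertices)) (*-monoʳ-≤ 2 (proj₁ (proj₂ reps))) ⟩
            2 * (g * length vertices) + 2 * length darts ∎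
            where
            open ≤-Reasoning
            open +-*-Solver using (solve; _:=_; _:+_; _:*_; con)
            m = length edges
            F = length rs

-- Discharging between 3-vertices and 2-vertices.

module Discharge where

  open Drawing using (PlaneArcs)
  open Induced
  open Euler
  open Above using (true-does)
  open import Data.Bool.Base using (Bool; true; false; T; _∧_; not; if_then_else_)
  open import Data.Bool.Properties using (T?)
  open import Data.Empty using (⊥-elim)
  open import Data.Fin.Properties using (any?)
  open import Data.List.Base using (List; []; _∷_; length; filter; allFin)
  open import Data.List.Membership.Propositional using (_∈_)
  open import Data.List.Membership.Propositional.Properties using (∈-allFin; ∈-filter⁺; ∈-filter⁻)
  open import Data.List.Relation.Unary.Any using (here; there)
  open import Data.Nat.Base
  open import Data.Nat.Properties
  open import Data.Nat.Solver using (module +-*-Solver)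
  open import Data.Product.Base using (_×_; _,_; proj₂; ∃-syntax)
  open import Data.Sum.Base using (_⊎_; inj₁; inj₂)
  open import Function.Base using (_∘_)
  open import Relation.Binary.PropositionalEquality
  open import Relation.Nullary using (¬_; yes; no; does; contradiction; _×-dec_)
  open ℕ∑

  ∑-mono : ∀ {I : Set} (is : List I) {f h : I → ℕ} → (∀ {i} → i ∈ is → f i ≤ h i) → ∑ is f ≤ ∑ is h
  ∑-mono [] le = z≤n
  ∑-mono (i ∷ is) le = +-mono-≤ (le (here refl)) (∑-mono is (le ∘ there))

  ∑-const : ∀ {I : Set} (is : List I) k → ∑ is (λ _ → k) ≡ k * length is
  ∑-const [] k = sym (*-zeroʳ k)
  ∑-const (i ∷ is) k = trans (cong (k +_) (∑-const is k)) (sym (*-suc k (length is)))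

  ∑-scale : ∀ {I : Set} (is : List I) k (f : I → ℕ) → ∑ is (λ i → k * f i) ≡ k * ∑ is f
  ∑-scale [] k f = sym (*-zeroʳ k)
  ∑-scale (i ∷ is) k f = trans (cong (k * f i +_) (∑-scale is k f)) (sym (*-distribˡ-+ k (f i) (∑ is f)))

  module _ (G : Graph) (C : Graph.Vertex G → Bool) where
    open Graph G using (Vertex; Adj; adj; adj-sym; order; IsCycle)

    private
      V = allFin order
      members = filter (λ v → T? (C v)) V

    deg : Vertex → ℕ
    deg v = length (nbrs G C v)

    two : Vertex → Bool
    two v = does (deg v ≟ 2)

    twoNbrs : Vertex → ℕ
    twoNbrs v = ∑ (nbrs G C v) λ u → if two u then 1 else 0

    -- What a 3-vertex has to contribute to an adjacent 2-vertex, when each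
    -- 2-vertex demands two units.
    demand : Vertex → ℕ
    demand v = if two v then 1 + twoNbrs v else 0

    load : Vertex → ℕ
    load u = ∑ (nbrs G C u) demand

    -- Double counting over ordered pairs of adjacent members: what the 2-vertices receive is what
    -- the 3-vertices give.
    ∑-edges-swap : ∀ (F : Vertex → Vertex → ℕ) →
      ∑ members (λ v → ∑ (nbrs G C v) (F v)) ≡ ∑ members (λ u → ∑ (nbrs G C u) (λ v → F v u))
    ∑-edges-swap F = begin
      ∑ members (λ v → ∑ (nbrs G C v) (F v))
        ≡⟨ expand F ⟩
      ∑ V (λ v → ∑ V (λ u → if C v then (if C u ∧ adj v u then F v u else 0) else 0))
        ≡⟨ ∑-comm V V _ ⟩
      ∑ V (λ u → ∑ V (λ v → if C v then (if C u ∧ adj v u then F v u else 0) else 0))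
        ≡⟨ ∑-cong V (λ {u} _ → ∑-cong V (λ {v} _ → exchange (C u) (C v) (adj-sym v u))) ⟩
      ∑ V (λ u → ∑ V (λ v → if C u then (if C v ∧ adj u v then F v u else 0) else 0))
        ≡⟨ expand (λ u v → F v u) ⟨
      ∑ members (λ u → ∑ (nbrs G C u) (λ v → F v u)) ∎
      where
      open ≡-Reasoning
      exchange : ∀ c d {a b} {n : ℕ} → a ≡ b → (if d then (if c ∧ a then n else 0) else 0) ≡ (if c then (if d ∧ b then n else 0) else 0)
      exchange false false _ = refl
      exchange false true _ = refl
      exchange true false _ = refl
      exchange true true refl = refl
      inner : ∀ (F : Vertex → Vertex → ℕ) v c → (if c then ∑ (nbrs G C v) (F v) else 0)
        ≡ ∑ V (λ u → if c then (if C u ∧ adj v u then F v u else 0) else 0)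
      inner F v false = sym (∑-zero V (λ _ → refl))
      inner F v true = ∑-filter (λ u → T? (C u ∧ adj v u)) V (F v)
      expand : ∀ (F : Vertex → Vertex → ℕ) → ∑ members (λ v → ∑ (nbrs G C v) (F v))
        ≡ ∑ V (λ v → ∑ V (λ u → if C v then (if C u ∧ adj v u then F v u else 0) else 0))
      expand F = trans (∑-filter (λ v → T? (C v)) V (λ v → ∑ (nbrs G C v) (F v))) (∑-cong V (λ {v} _ → inner F v (C v)))

    module _ (degrees : ∀ v → T (C v) → TwoOrThree (nbrs G C v)) (s : ℕ)
             (no-path : ∀ v → T (C v) → deg v ≡ 2 → twoNbrs v < 2)
             (light : ∀ u → T (C u) → deg u ≡ 3 → load u ≤ s) where
      private
        three : Vertex → Bool
        three v = not (two v)

        vertex⁻ : ∀ {v} → v ∈ members → T (C v)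
        vertex⁻ h = proj₂ (∈-filter⁻ (λ v → T? (C v)) {xs = V} h)

        n₂ n₃ : ℕ
        n₂ = ∑ members (λ v → if two v then 1 else 0)
        n₃ = ∑ members (λ v → if two v then 0 else 1)

        count : length members ≡ n₂ + n₃
        count = trans (trans (sym (*-identityˡ _)) (sym (∑-const members 1)))
          (trans (∑-cong members (λ {v} _ → either (two v))) (∑-∙ members _ _))
          where
          either : ∀ b → 1 ≡ (if b then 1 else 0) + (if b then 0 else 1)
          either false = refl
          either true = refl

        degree-three : ∀ {v} → T (C v) → two v ≡ false → deg v ≡ 3
        degree-three {v} cv e with degrees v cv
        ... | inj₁ (_ , _ , eq) rewrite eq = contradiction e λ ()
        ... | inj₂ (_ , _ , _ , eq) = cong length eq

        degree-two : ∀ {v} → two v ≡ true → deg v ≡ 2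
        degree-two {v} = true-does (deg v ≟ 2)

        degree-sum : ∑ members deg ≡ 2 * n₂ + 3 * n₃
        degree-sum = trans (∑-cong members (λ {v} h → value v (vertex⁻ h)))
          (trans (∑-∙ members _ _) (cong₂ _+_ (∑-scale members 2 _) (∑-scale members 3 _)))
          where
          value : ∀ v → T (C v) → deg v ≡ 2 * (if two v then 1 else 0) + 3 * (if two v then 0 else 1)
          value v cv with two v in e
          ... | true = degree-two {v} e
          ... | false = degree-three cv e

        give : Vertex → Vertex → ℕ
        give v u = if two u then 0 else demand v

        -- A 2-vertex between two 3-vertices gets one unit from each side. With one 2-neighbour it
        -- gets both units from the other side, and two 2-neighbours are excluded by `no-path`.
        received : ∀ {v} → T (C v) → (if two v then 2 else 0) ≤ ∑ (nbrs G C v) (give v)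
        received {v} cv with two v in e
        ... | false = z≤n
        ... | true with degrees v cv
        ...   | inj₂ (_ , _ , _ , eq) = contradiction (trans (sym (degree-two {v} e)) (cong length eq)) λ ()
        ...   | inj₁ (a , c , eq) = subst₂ (λ N k → 2 ≤ ∑ N (λ u → if two u then 0 else 1 + k)) (sym eq) refl
                  (subst (λ k → 2 ≤ ∑ (a ∷ c ∷ []) (λ u → if two u then 0 else 1 + k))
                    (sym (cong (λ N → ∑ N (λ u → if two u then 1 else 0)) eq))
                    (split (two a) (two c) (subst (λ N → ∑ N (λ u → if two u then 1 else 0) < 2) eq (no-path v cv (degree-two {v} e)))))
          where
          split : ∀ p q → (if p then 1 else 0) + ((if q then 1 else 0) + 0) < 2 →
            let k = (if p then 1 else 0) + ((if q then 1 else 0) + 0) in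
            2 ≤ (if p then 0 else 1 + k) + ((if q then 0 else 1 + k) + 0)
          split true true (s≤s (s≤s ()))
          split true false _ = s≤s (s≤s z≤n)
          split false true _ = s≤s (s≤s z≤n)
          split false false _ = s≤s (s≤s z≤n)

        given : ∀ {u} → T (C u) → ∑ (nbrs G C u) (λ v → give v u) ≤ s * (if two u then 0 else 1)
        given {u} cu with two u in e
        ... | true = ≤-trans (≤-reflexive (∑-zero (nbrs G C u) (λ _ → refl))) z≤n
        ... | false = ≤-trans (light u cu (degree-three cu e)) (≤-reflexive (sym (*-identityʳ s)))

        balance : 2 * n₂ ≤ s * n₃
        balance = begin
          2 * n₂                                             ≡⟨ ∑-scale members 2 _ ⟨
          ∑ members (λ v → 2 * (if two v then 1 else 0))    ≤⟨ ∑-mono members (λ {v} h → ≤-trans (≤-reflexive (twice (two v))) (received (vertex⁻ h))) ⟩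
          ∑ members (λ v → ∑ (nbrs G C v) (give v))         ≡⟨ ∑-edges-swap give ⟩
          ∑ members (λ u → ∑ (nbrs G C u) (λ v → give v u)) ≤⟨ ∑-mono members (λ h → given (vertex⁻ h)) ⟩
          ∑ members (λ u → s * (if two u then 0 else 1))    ≡⟨ ∑-scale members s _ ⟩
          s * n₃                                             ∎
          where
          open ≤-Reasoning
          twice : ∀ b → 2 * (if b then 1 else 0) ≡ (if b then 2 else 0)
          twice false = refl
          twice true = refl

      -- Since `g - 6` is `2 * s`, Euler's inequality becomes `s n₃ + g ≤ 2 n₂`, while `balance`
      -- bounds `2 n₂` by `s n₃`. The summand `g` on the left makes this a contradiction.
      overloaded : let g = 2 * s + 6 in
        ¬ g * ∑ members deg + 2 * g ≤ 2 * (g * length members) + 2 * ∑ members deg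
      overloaded euler rewrite count | degree-sum = <-irrefl refl (begin-strict
        common + 4 * n₂                                ≤⟨ +-monoʳ-≤ common (≤-trans (≤-reflexive (*-assoc 2 2 n₂)) (*-monoʳ-≤ 2 balance)) ⟩
        common + 2 * (s * n₃)                          <⟨ m<m+n _ 0<2g ⟩
        common + 2 * (s * n₃) + 2 * g                  ≡⟨ solve 3 (λ s n₂ n₃ → let g = con 2 :* s :+ con 6 in
                                                            (con 2 :* g :* n₂ :+ (con 4 :* s :+ con 18) :* n₃) :+ con 2 :* (s :* n₃) :+ con 2 :* g
                                                              := g :* (con 2 :* n₂ :+ con 3 :* n₃) :+ con 2 :* g) refl s n₂ n₃ ⟩
        g * (2 * n₂ + 3 * n₃) + 2 * g                  ≤⟨ euler ⟩
        2 * (g * (n₂ + n₃)) + 2 * (2 * n₂ + 3 * n₃)    ≡⟨ solve 3 (λ s n₂ n₃ → let g = con 2 :* s :+ con 6 in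
                                                            con 2 :* (g :* (n₂ :+ n₃)) :+ con 2 :* (con 2 :* n₂ :+ con 3 :* n₃)
                                                              := (con 2 :* g :* n₂ :+ (con 4 :* s :+ con 18) :* n₃) :+ con 4 :* n₂) refl s n₂ n₃ ⟩
        common + 4 * n₂                                ∎)
        where
        open ≤-Reasoning
        open +-*-Solver using (solve; _:=_; _:+_; _:*_; con)
        g = 2 * s + 6
        -- These are the terms that both sides of Euler's inequality share after the substitution of
        -- `2 * s + 6` for `g`.
        common = 2 * g * n₂ + (4 * s + 18) * n₃
        0<2g : 0 < 2 * g
        0<2g = ≤-trans (s≤s z≤n) (*-monoʳ-≤ 2 {1} {g} (≤-trans (s≤s z≤n) (m≤n+m 6 (2 * s))))

  module _ {G : Graph} (PA : PlaneArcs G) (C : Graph.Vertex G → Bool) where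
    open Graph G using (Vertex; order; IsCycle)

    -- Both searches are finite; if both fail, `overloaded` contradicts `euler`. The member `r`
    -- guarantees that there is a vertex whose boundary can be left out.
    configuration : (∀ v → T (C v) → TwoOrThree (nbrs G C v)) → ∀ {r} → T (C r) → ∀ s →
      (∀ c → IsCycle c → 2 * s + 6 ≤ length c) →
      (∃[ v ] (T (C v) × deg G C v ≡ 2 × 2 ≤ twoNbrs G C v)) ⊎ (∃[ u ] (T (C u) × deg G C u ≡ 3 × s < load G C u))
    configuration degrees {r} cr s girth
      with any? (λ v → T? (C v) ×-dec ((deg G C v ≟ 2) ×-dec (2 ≤? twoNbrs G C v)))
         | any? (λ u → T? (C u) ×-dec ((deg G C u ≟ 3) ×-dec (s <? load G C u)))
    ... | yes p | _ = inj₁ p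
    ... | no _ | yes q = inj₂ q
    ... | no ¬p | no ¬q = ⊥-elim (overloaded G C degrees s
        (λ v cv e → ≰⇒> λ h → ¬p (v , cv , e , h))
        (λ u cu e → ≮⇒≥ λ h → ¬q (u , cu , e , h))
        (subst (λ D → (2 * s + 6) * D + 2 * (2 * s + 6) ≤ 2 * ((2 * s + 6) * length (vertices PA C degrees)) + 2 * D)
          (darts-length PA C degrees) (at-root (vertices PA C degrees) refl (∈-filter⁺ (λ v → T? (C v)) (∈-allFin r) cr))))
      where
      at-root : ∀ vs → vertices PA C degrees ≡ vs → r ∈ vs →
        (2 * s + 6) * length (darts PA C degrees) + 2 * (2 * s + 6)
          ≤ 2 * ((2 * s + 6) * length (vertices PA C degrees)) + 2 * length (darts PA C degrees)
      at-root (_ ∷ _) e _ = euler PA C degrees e (≤-trans (s≤s z≤n) (m≤n+m 6 (2 * s))) girth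

-- Partial injective colourings and their greedy extension.

module Colour where

  open Induced
  open Walks using (loopless)
  open import Data.Bool.Base using (Bool; T; _∧_; not)
  open import Data.Bool.Properties using (T-∧)
  open import Data.Empty using (⊥; ⊥-elim)
  open import Data.Fin.Base as Fin using (Fin)
  import Data.Fin.Properties as Finₚ
  open import Data.List.Base using (List; []; _∷_; _++_; length; map; lookup)
  open import Data.List.Membership.Propositional using (_∈_; _∉_)
  open import Data.List.Membership.Propositional.Properties using (∈-map⁺; ∈-++⁺ˡ; ∈-++⁺ʳ)
  open import Data.List.Properties using (length-map; length-++)
  open import Data.List.Relation.Unary.Any as Any using (Any; here; there; index)
  open import Data.List.Relation.Unary.Any.Properties using (lookup-index)
  open import Data.Nat.Base
  open import Data.Nat.Properties hiding (_≟_)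
  open import Data.Product.Base using (_×_; _,_; proj₁; proj₂; ∃-syntax; Σ-syntax)
  open import Data.Sum.Base using (_⊎_; inj₁; inj₂; [_,_]′)
  open import Function.Base using (_∘_; id)
  open import Function.Bundles using (Equivalence)
  open import Relation.Binary.PropositionalEquality
  open import Relation.Nullary using (¬_; Dec; yes; no; does; contradiction; _⊎-dec_; ¬?)
  open import Relation.Nullary.Decidable using (decidable-stable)

  opaque
    fresh-colour : ∀ {k} (xs : List (Fin k)) → length xs < k → ∃[ x ] x ∉ xs
    fresh-colour {k} xs short with Finₚ.any? (λ x → ¬? (Any.any? (x Finₚ.≟_) xs))
    ... | yes h = h
    ... | no none = ⊥-elim (clash (Finₚ.pigeonhole short (λ x → index (used x))))
      where
      used : ∀ x → x ∈ xs
      used x = decidable-stable (Any.any? (x Finₚ.≟_) xs) (λ h → none (x , h))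
      clash : ¬ (∃[ i ] ∃[ j ] (i Fin.< j × index (used i) ≡ index (used j)))
      clash (i , j , i<j , e) = Finₚ.<⇒≢ i<j
        (trans (lookup-index (used i)) (trans (cong (lookup xs) e) (sym (lookup-index (used j)))))

  ∈-remove : ∀ {A : Set} {x : A} {xs} → x ∈ xs →
    ∃[ ys ] (suc (length ys) ≡ length xs × (∀ {z} → z ∈ xs → z ∈ x ∷ ys) × (∀ {z} → z ∈ ys → z ∈ xs))
  ∈-remove {xs = x ∷ xs} (here refl) = xs , refl , id , there
  ∈-remove {xs = y ∷ xs} (there h) with ∈-remove h
  ... | ys , len , to , from = y ∷ ys , cong suc len
    , (λ { (here refl) → there (here refl) ; (there k) → skip (to k) })
    , λ { (here refl) → here refl ; (there k) → there (from k) }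
    where
    skip : ∀ {z x} → z ∈ x ∷ ys → z ∈ x ∷ y ∷ ys
    skip (here e) = here e
    skip (there k) = there (there k)

  module _ (G : Graph) (k : ℕ) where
    open Graph G using (Vertex; Adj; adj; adj-sym; order)

    Listed : Vertex → Vertex → List (Vertex × Vertex) → Set
    Listed c d U = (c , d) ∈ U ⊎ (d , c) ∈ U

    listed-sym : ∀ {c d U} → Listed c d U → Listed d c U
    listed-sym (inj₁ h) = inj₂ h
    listed-sym (inj₂ h) = inj₁ h

    module _ (A : Vertex → Bool) where

      Edgeᴬ : Vertex → Vertex → Set
      Edgeᴬ u v = T (A u) × T (A v) × Adj u v

      edgeᴬ-sym : ∀ {u v} → Edgeᴬ u v → Edgeᴬ v u
      edgeᴬ-sym (a , b , e) = b , a , Adj-sym G e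

      -- An injective colouring of the edges within A except those listed in U.
      record Colouring (U : List (Vertex × Vertex)) : Set where
        field
          col     : Vertex → Vertex → Fin k
          col-sym : ∀ u v → col u v ≡ col v u
          valid   : ∀ {a b c d} → Adj b c → a ≢ c → b ≢ d → Edgeᴬ a b → ¬ Listed a b U →
                    Edgeᴬ c d → ¬ Listed c d U → col a b ≢ col c d

      open Colouring public

      -- Reading the edge uv as u — v, the coloured edges c — d with v adjacent to c.
      Near : List (Vertex × Vertex) → Vertex → Vertex → Vertex → Vertex → Set
      Near U v u c d = c ∈ nbrs G A v × c ≢ u × d ∈ nbrs G A c × d ≢ v × ¬ Listed c d U

      Same : Vertex → Vertex → Vertex → Vertex → Set
      Same u v c d = (c ≡ u × d ≡ v) ⊎ (c ≡ v × d ≡ u)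

      same? : ∀ u v c d → Dec (Same u v c d)
      same? u v c d = both (c Finₚ.≟ u) (d Finₚ.≟ v) ⊎-dec both (c Finₚ.≟ v) (d Finₚ.≟ u)
        where
        both : ∀ {P Q : Set} → Dec P → Dec Q → Dec (P × Q)
        both (yes p) (yes q) = yes (p , q)
        both (no ¬p) _ = no (¬p ∘ proj₁)
        both _ (no ¬q) = no (¬q ∘ proj₂)

      same-sym : ∀ {u v c d} → Same u v c d → Same u v d c
      same-sym (inj₁ (p , q)) = inj₂ (q , p)
      same-sym (inj₂ (p , q)) = inj₁ (q , p)

      module _ {U u v} (K : Colouring ((u , v) ∷ U)) (x : Fin k)
               (free-v : ∀ {c d} → Near ((u , v) ∷ U) v u c d → col K c d ≢ x)
               (free-u : ∀ {c d} → Near ((u , v) ∷ U) u v c d → col K c d ≢ x) where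
        private
          pick : ∀ {c d} → Dec (Same u v c d) → Fin k → Fin k
          pick (yes _) y = x
          pick (no _) y = y

          col′ : Vertex → Vertex → Fin k
          col′ c d = pick (same? u v c d) (col K c d)

          same-col : ∀ {c d} → Same u v c d → col′ c d ≡ x
          same-col {c} {d} s with same? u v c d
          ... | yes _ = refl
          ... | no ¬s = contradiction s ¬s

          other-col : ∀ {c d} → ¬ Same u v c d → col′ c d ≡ col K c d
          other-col {c} {d} ¬s with same? u v c d
          ... | yes s = contradiction s ¬s
          ... | no _ = refl

          unlisted : ∀ {c d} → ¬ Same u v c d → ¬ Listed c d U → ¬ Listed c d ((u , v) ∷ U)
          unlisted ¬s ¬l (inj₁ (here refl)) = ¬s (inj₁ (refl , refl))
          unlisted ¬s ¬l (inj₁ (there h)) = ¬l (inj₁ h)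
          unlisted ¬s ¬l (inj₂ (here refl)) = ¬s (inj₂ (refl , refl))
          unlisted ¬s ¬l (inj₂ (there h)) = ¬l (inj₂ h)

          avoids : ∀ {a b c d} → Same u v a b → Adj b c → a ≢ c → b ≢ d → Edgeᴬ c d →
            ¬ Listed c d ((u , v) ∷ U) → col K c d ≢ x
          avoids (inj₁ (refl , refl)) bc a≢c b≢d (ac , ad , cd) l =
            free-v (∈-nbrs⁺ G A ac bc , a≢c ∘ sym , ∈-nbrs⁺ G A ad cd , b≢d ∘ sym , l)
          avoids (inj₂ (refl , refl)) bc a≢c b≢d (ac , ad , cd) l =
            free-u (∈-nbrs⁺ G A ac bc , a≢c ∘ sym , ∈-nbrs⁺ G A ad cd , b≢d ∘ sym , l)

          not-self : ∀ {a b c d} → Same u v a b → Same u v c d → Adj b c → ¬ a ≢ c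
          not-self (inj₁ (refl , refl)) (inj₁ (refl , refl)) _ h = h refl
          not-self (inj₁ (refl , refl)) (inj₂ (refl , refl)) e _ = loopless G e
          not-self (inj₂ (refl , refl)) (inj₁ (refl , refl)) e _ = loopless G e
          not-self (inj₂ (refl , refl)) (inj₂ (refl , refl)) _ h = h refl

        opaque
          -- An edge does not conflict with itself, for lack of loops. Every other new conflict
          -- passes through one of the two ends of `uv`, where `free-v` and `free-u` exclude it.
          recolour : Σ[ K′ ∈ Colouring U ] (col K′ u v ≡ x × (∀ {c d} → ¬ Same u v c d → col K′ c d ≡ col K c d))
          recolour = record { col = col′ ; col-sym = sym′ ; valid = valid′ } , same-col (inj₁ (refl , refl)) , other-col
            where
            sym′ : ∀ c d → col′ c d ≡ col′ d c
            sym′ c d = by (same? u v c d)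
              where
              by : Dec (Same u v c d) → col′ c d ≡ col′ d c
              by (yes s) = trans (same-col s) (sym (same-col (same-sym s)))
              by (no ¬s) = trans (other-col ¬s) (trans (col-sym K c d) (sym (other-col (¬s ∘ same-sym))))
            valid′ : ∀ {a b c d} → Adj b c → a ≢ c → b ≢ d → Edgeᴬ a b → ¬ Listed a b U →
              Edgeᴬ c d → ¬ Listed c d U → col′ a b ≢ col′ c d
            valid′ {a} {b} {c} {d} bc a≢c b≢d ab lab cd lcd e = by (same? u v a b) (same? u v c d)
              where
              by : Dec (Same u v a b) → Dec (Same u v c d) → ⊥
              by (yes s) (yes t) = not-self s t bc a≢c
              by (yes s) (no ¬t) = avoids s bc a≢c b≢d cd (unlisted ¬t lcd) (trans (sym (other-col ¬t)) (trans (sym e) (same-col s)))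
              by (no ¬s) (yes t) = avoids (same-sym t) (Adj-sym G bc) (b≢d ∘ sym) (a≢c ∘ sym) (edgeᴬ-sym ab)
                (unlisted (¬s ∘ same-sym) (lab ∘ listed-sym))
                (trans (col-sym K b a) (trans (sym (other-col ¬s)) (trans e (same-col t))))
              by (no ¬s) (no ¬t) = valid K bc a≢c b≢d ab (unlisted ¬s lab) cd (unlisted ¬t lcd)
                (trans (sym (other-col ¬s)) (trans e (other-col ¬t)))

      -- Colours are counted, not edges: edges with a common colour, as in the star at a 3-vertex
      -- below, take up one place.
      Bound : (Vertex → Vertex → Fin k) → (Vertex → Vertex → Set) → ℕ → Set
      Bound f P n = ∃[ xs ] (length xs ≤ n × (∀ {c d} → P c d → f c d ∈ xs))

      bound-∪ : ∀ {f P Q R m n} → (∀ {c d} → R c d → P c d ⊎ Q c d) → Bound f P m → Bound f Q n → Bound f R (m + n)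
      bound-∪ split (xs , l , p) (ys , l′ , q) = xs ++ ys
        , ≤-trans (≤-reflexive (length-++ xs)) (+-mono-≤ l l′)
        , λ r → [ ∈-++⁺ˡ ∘ p , ∈-++⁺ʳ xs ∘ q ]′ (split r)

      bound-⊆ : ∀ {f P R m} → (∀ {c d} → R c d → P c d) → Bound f P m → Bound f R m
      bound-⊆ sub (xs , l , p) = xs , l , p ∘ sub

      opaque
        greedy : ∀ {U u v m n} (K : Colouring ((u , v) ∷ U)) →
          Bound (col K) (Near ((u , v) ∷ U) v u) m → Bound (col K) (Near ((u , v) ∷ U) u v) n → m + n < k →
          Σ[ K′ ∈ Colouring U ] (∀ {c d} → ¬ Same u v c d → col K′ c d ≡ col K c d)
        greedy K (xs , l , p) (ys , l′ , q) short =
          let (x , x∉) = fresh-colour (xs ++ ys) (≤-<-trans (≤-trans (≤-reflexive (length-++ xs)) (+-mono-≤ l l′)) short)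
              (K′ , _ , same) = recolour K x
                (λ h e → x∉ (∈-++⁺ˡ (subst (_∈ xs) e (p h)))) (λ h e → x∉ (∈-++⁺ʳ xs (subst (_∈ ys) e (q h))))
          in K′ , same

      Covers : Vertex → List Vertex → Set
      Covers v vs = ∀ {c} → c ∈ nbrs G A v → c ∈ vs

      Beyond : List (Vertex × Vertex) → Vertex → Vertex → Vertex → Vertex → Set
      Beyond U c v c′ d = c′ ≡ c × d ∈ nbrs G A c × d ≢ v × ¬ Listed c d U

      module _ {U : List (Vertex × Vertex)} (f : Vertex → Vertex → Fin k) where
        at-cover : ∀ {c v ds} → Covers c (v ∷ ds) → ∀ es → (∀ {d} → d ∈ ds → Listed c d U ⊎ d ∈ es) →
          Bound f (Beyond U c v) (length es)
        at-cover {c} {v} {ds} cov es split = map (f c) es , ≤-reflexive (length-map (f c) es) ,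
          λ { (refl , d∈ , d≢v , l) → ∈-map⁺ (f c) (counted (cov d∈) d≢v l) }
          where
          counted : ∀ {d} → d ∈ v ∷ ds → d ≢ v → ¬ Listed c d U → d ∈ es
          counted (here e) d≢v _ = contradiction e d≢v
          counted (there h) _ l = [ (λ k → contradiction k l) , id ]′ (split h)

        at-degree : ∀ {c v n} → v ∈ nbrs G A c → length (nbrs G A c) ≤ suc n → Bound f (Beyond U c v) n
        at-degree v∈ le = let (ds , len , to , _) = ∈-remove v∈ ; (xs , l , p) = at-cover to ds inj₂ in
          xs , ≤-trans l (s≤s⁻¹ (≤-trans (≤-reflexive len) le)) , p

        near₀ : ∀ {v u} → Covers v (u ∷ []) → Bound f (Near U v u) 0
        near₀ cov = [] , z≤n , λ { (c∈ , c≢u , _) → ⊥-elim (none (cov c∈) c≢u) }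
          where
          none : ∀ {c u} → c ∈ u ∷ [] → ¬ c ≢ u
          none (here e) h = h e

        near₁ : ∀ {v u c m} → Covers v (u ∷ c ∷ []) → Bound f (Beyond U c v) m → Bound f (Near U v u) m
        near₁ {v} {u} {c} cov = bound-⊆ λ { (c∈ , c≢u , d∈ , d≢v , l) → move (cov c∈) c≢u d∈ d≢v l }
          where
          move : ∀ {c′ d} → c′ ∈ u ∷ c ∷ [] → c′ ≢ u → d ∈ nbrs G A c′ → d ≢ v → ¬ Listed c′ d U → Beyond U c v c′ d
          move (here e) h = contradiction e h
          move (there (here refl)) _ d∈ d≢v l = refl , d∈ , d≢v , l

        near₂ : ∀ {v u c c′ m n} → Covers v (u ∷ c ∷ c′ ∷ []) → Bound f (Beyond U c v) m → Bound f (Beyond U c′ v) n →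
          Bound f (Near U v u) (m + n)
        near₂ {v} {u} {c} {c′} cov = bound-∪ λ { (c∈ , c≢u , d∈ , d≢v , l) → move (cov c∈) c≢u d∈ d≢v l }
          where
          move : ∀ {w d} → w ∈ u ∷ c ∷ c′ ∷ [] → w ≢ u → d ∈ nbrs G A w → d ≢ v → ¬ Listed w d U →
            Beyond U c v w d ⊎ Beyond U c′ v w d
          move (here e) h = contradiction e h
          move (there (here refl)) _ d∈ d≢v l = inj₁ (refl , d∈ , d≢v , l)
          move (there (there (here refl))) _ d∈ d≢v l = inj₂ (refl , d∈ , d≢v , l)

      nbr-sym : ∀ {u v} → T (A v) → u ∈ nbrs G A v → v ∈ nbrs G A u
      nbr-sym av h = ∈-nbrs⁺ G A av (Adj-sym G (proj₂ (∈-nbrs⁻ G A h)))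

      module _ (subcubic : ∀ v → length (nbrs G A v) ≤ 3) where

        -- There are at most two further neighbours of `v`, with at most two further edges each.
        near-four : ∀ {U v u} (f : Vertex → Vertex → Fin k) → T (A v) → u ∈ nbrs G A v → Bound f (Near U v u) 4
        near-four {U} {v} {u} f av u∈ with ∈-remove u∈
        ... | ds , len , to , from = by ds (s≤s⁻¹ (≤-trans (≤-reflexive len) (subcubic v))) to from
          where
          widen : ∀ {P m n} → m ≤ n → Bound f P m → Bound f P n
          widen le (xs , l , p) = xs , ≤-trans l le , p
          by : ∀ ds → length ds ≤ 2 → Covers v (u ∷ ds) → (∀ {z} → z ∈ ds → z ∈ nbrs G A v) → Bound f (Near U v u) 4
          by [] _ cov _ = widen z≤n (near₀ f cov)
          by (c ∷ []) _ cov from = widen (s≤s (s≤s z≤n)) (near₁ f cov (at-degree f (nbr-sym av (from (here refl))) (subcubic c)))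
          by (c ∷ d ∷ []) _ cov from = near₂ f cov (at-degree f (nbr-sym av (from (here refl))) (subcubic c))
            (at-degree f (nbr-sym av (from (there (here refl)))) (subcubic d))
          by (_ ∷ _ ∷ _ ∷ _) (s≤s (s≤s ())) _ _

    Colourable : (Vertex → Bool) → Set
    Colourable A = Colouring A []

    -- Vertices are deleted rather than edges. The middle edge of a conflict between two remaining
    -- edges joins remaining vertices, so no conflict among the remaining edges is lost in the
    -- smaller graph.
    _∖_ : (Vertex → Bool) → List Vertex → Vertex → Bool
    (A ∖ R) v = A v ∧ not (does (Any.any? (v Finₚ.≟_) R))

    opaque
      -- Colourings are total functions, so nothing has to be redefined: the values at edges of
      -- deleted vertices are declared void by listing these edges in `U`.
      restore : ∀ {A R U} → (∀ {r w} → r ∈ R → w ∈ nbrs G A r → Listed r w U) → Colourable (A ∖ R) → Colouring A U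
      restore {A} {R} {U} listed K = record
        { col = col K
        ; col-sym = col-sym K
        ; valid = λ bc a≢c b≢d ab lab cd lcd → valid K bc a≢c b≢d (kept ab lab) (λ { (inj₁ ()) ; (inj₂ ()) })
            (kept cd lcd) (λ { (inj₁ ()) ; (inj₂ ()) })
        }
        where
        survive : ∀ {v} → T (A v) → v ∉ R → T ((A ∖ R) v)
        survive {v} av v∉ with Any.any? (v Finₚ.≟_) R
        ... | yes h = contradiction h v∉
        ... | no _ = Equivalence.from T-∧ (av , _)
        kept : ∀ {u v} → Edgeᴬ A u v → ¬ Listed u v U → Edgeᴬ (A ∖ R) u v
        kept (au , av , e) l =
          survive au (λ h → l (listed h (∈-nbrs⁺ G A av e))) ,
          survive av (λ h → l (listed-sym (listed h (∈-nbrs⁺ G A au (Adj-sym G e))))) , e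

-- Configurations that are reducible by greedy colouring.

module Reduce where

  open Induced
  open Colour
  open import Data.Bool.Base using (Bool; T)
  open import Data.Empty using (⊥-elim)
  open import Data.List.Base using (List; []; _∷_; length)
  open import Data.List.Membership.Propositional using (_∈_)
  open import Data.List.Relation.Unary.Any using (here; there)
  open import Data.Nat.Base
  open import Data.Nat.Properties
  open import Data.Product.Base using (_,_; proj₁)
  open import Data.Sum.Base using (inj₁; inj₂)
  open import Function.Base using (_∘_)
  open import Relation.Binary.PropositionalEquality
  open import Relation.Nullary using (¬_)

  pattern 1st = here refl
  pattern 2nd = there (here refl)
  pattern 3rd = there (there (here refl))

  swap₂ : ∀ {A : Set} {a b z : A} → z ∈ a ∷ b ∷ [] → z ∈ b ∷ a ∷ []
  swap₂ 1st = 2nd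
  swap₂ 2nd = 1st

  rotate : ∀ {A : Set} {a b c z : A} → z ∈ a ∷ b ∷ c ∷ [] → z ∈ b ∷ c ∷ a ∷ []
  rotate 1st = 3rd
  rotate 2nd = 1st
  rotate 3rd = 2nd

  swap₁₂ : ∀ {A : Set} {a b c z : A} → z ∈ a ∷ b ∷ c ∷ [] → z ∈ b ∷ a ∷ c ∷ []
  swap₁₂ 1st = 2nd
  swap₁₂ 2nd = 1st
  swap₁₂ 3rd = 3rd

  module _ (G : Graph) (k : ℕ) (A : Graph.Vertex G → Bool) (subcubic : ∀ v → length (nbrs G A v) ≤ 3) where
    open Graph G using (Vertex; Adj)

    private
      N : Vertex → List Vertex
      N = nbrs G A
      Cov : Vertex → List Vertex → Set
      Cov = Covers G k A
      Removable : List Vertex → Set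
      Removable R = Colourable G k (_∖_ G k A R) → Colourable G k A

      back : ∀ {u v} → T (A v) → u ∈ N v → v ∈ N u
      back = nbr-sym G k A

      alive : ∀ {u v} → u ∈ N v → T (A u)
      alive h = proj₁ (∈-nbrs⁻ G A h)

      step : ∀ {U u v m n} → Colouring G k A ((u , v) ∷ U) →
        (∀ f → Bound G k A f (Near G k A ((u , v) ∷ U) v u) m) → (∀ f → Bound G k A f (Near G k A ((u , v) ∷ U) u v) n) →
        m + n < k → Colouring G k A U
      step K p q short = proj₁ (greedy G k A K (p (col K)) (q (col K)) short)

      four : ∀ {U v u} → T (A v) → u ∈ N v → ∀ f → Bound G k A f (Near G k A U v u) 4
      four av u∈ f = near-four G k A subcubic f av u∈

      some : ∀ {U c v} → T (A c) → c ∈ N v → T (A v) → ∀ f → Bound G k A f (Beyond G k A U c v) 2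
      some {c = c} _ c∈ av f = at-degree G k A f (back av c∈) (subcubic c)

      one : ∀ {U c v d} → Cov c (v ∷ d ∷ []) → ∀ f → Bound G k A f (Beyond G k A U c v) 1
      one cov f = at-cover G k A f cov (_ ∷ []) inj₂

      none : ∀ {U c v d} → Cov c (v ∷ d ∷ []) → Listed G k c d U → ∀ f → Bound G k A f (Beyond G k A U c v) 0
      none cov l f = at-cover G k A f cov [] λ { (here refl) → inj₁ l }

      skip : ∀ {U c v d e} → Cov c (v ∷ d ∷ e ∷ []) → Listed G k c d U → ∀ f → Bound G k A f (Beyond G k A U c v) 1
      skip cov l f = at-cover G k A f cov (_ ∷ []) λ { (here refl) → inj₁ l ; (there h) → inj₂ h }

    remove-isolated : ∀ {v} → Cov v [] → Removable (v ∷ [])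
    remove-isolated {v} cov = restore G k {R = v ∷ []} λ { (here refl) w∈ → ⊥-elim (absurd (cov w∈)) }
      where
      absurd : ∀ {w : Vertex} → ¬ w ∈ []
      absurd ()

    remove-pendant : ∀ {v u m} → Cov v (u ∷ []) → (∀ {U} f → Bound G k A f (Near G k A U u v) m) → m < k → Removable (v ∷ [])
    remove-pendant {v} {u} {m} cov bound short K = step {U = []} {v} {u}
      (restore G k {R = v ∷ []} (λ { (here refl) w∈ → listed (cov w∈) }) K)
      bound (λ f → near₀ G k A f cov) (≤-<-trans (≤-reflexive (+-identityʳ m)) short)
      where
      listed : ∀ {w} → w ∈ u ∷ [] → Listed G k v w ((v , u) ∷ [])
      listed 1st = inj₁ 1st

    remove-leaf : ∀ {v u} → T (A v) → u ∈ N v → Cov v (u ∷ []) → 4 < k → Removable (v ∷ [])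
    remove-leaf av u∈ cov = remove-pendant cov (four (alive u∈) (back av u∈))

    module _ {v a b : Vertex} (av : T (A v)) (a∈ : a ∈ N v) (b∈ : b ∈ N v) (cov : Cov v (a ∷ b ∷ [])) where
      private
        listed : ∀ {r w} → r ∈ v ∷ [] → w ∈ N r → Listed G k r w ((v , a) ∷ (v , b) ∷ [])
        listed (here refl) w∈ = by (cov w∈)
          where
          by : ∀ {w} → w ∈ a ∷ b ∷ [] → Listed G k v w ((v , a) ∷ (v , b) ∷ [])
          by 1st = inj₁ 1st
          by 2nd = inj₁ 2nd

      -- Each of the two edges sees at most four edges through its far end and two through `v`.
      remove-two : 6 < k → Removable (v ∷ [])
      remove-two short K = step (step (restore G k listed K)
          (four (alive a∈) (back av a∈)) (λ f → near₁ G k A f cov (some (alive b∈) b∈ av f)) short)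
        (four (alive b∈) (back av b∈)) (λ f → near₁ G k A f (swap₂ ∘ cov) (some (alive a∈) a∈ av f)) short

      -- As `b` has only one further edge, `va` sees at most 4 + 1 edges, and `vb` at most 2 + 2.
      remove-two-beside-two : ∀ {c} → c ∈ N b → Cov b (v ∷ c ∷ []) → 5 < k → Removable (v ∷ [])
      remove-two-beside-two c∈ covb short K = step (step (restore G k listed K)
          (four (alive a∈) (back av a∈)) (λ f → near₁ G k A f cov (one covb f)) short)
        (λ f → near₁ G k A f covb (some (alive c∈) c∈ (alive b∈) f))
        (λ f → near₁ G k A f (swap₂ ∘ cov) (some (alive a∈) a∈ av f)) (<-trans (n<1+n 4) short)

      -- Each of the two edges sees at most two edges through its far end and one through `v`, so
      -- this works even with four colours.
      remove-middle : ∀ {c d} → c ∈ N a → d ∈ N b → Cov a (v ∷ c ∷ []) → Cov b (v ∷ d ∷ []) → 3 < k → Removable (v ∷ [])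
      remove-middle c∈ d∈ cova covb short K = step (step (restore G k listed K)
          (λ f → near₁ G k A f cova (some (alive c∈) c∈ (alive a∈) f)) (λ f → near₁ G k A f cov (one covb f)) short)
        (λ f → near₁ G k A f covb (some (alive d∈) d∈ (alive b∈) f)) (λ f → near₁ G k A f (swap₂ ∘ cov) (one cova f)) short

    -- The outer edges `vb` and `wc` are coloured while `av` and `aw` are still open, so through `a`
    -- they see only `az`: 4 + 1 in all. Afterwards `av` and `aw` see 2 through their far ends and 1
    -- + 2 through `a`.
    remove-two-twos : ∀ {a v w z b c} → T (A a) → v ∈ N a → w ∈ N a → z ∈ N a → Cov a (v ∷ w ∷ z ∷ []) →
      b ∈ N v → Cov v (a ∷ b ∷ []) → c ∈ N w → Cov w (a ∷ c ∷ []) → 5 < k → Removable (v ∷ w ∷ [])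
    remove-two-twos {a} {v} {w} {z} {b} {c} aa v∈ w∈ z∈ cova b∈ covv c∈ covw short K =
      step (step (step (step (restore G k listed K)
        (four (alive b∈) (back (alive v∈) b∈)) (λ f → near₁ G k A f (swap₂ ∘ covv) (skip cova (inj₁ (there 3rd)) f)) short)
        (four (alive c∈) (back (alive w∈) c∈)) (λ f → near₁ G k A f (swap₂ ∘ covw) (skip (swap₁₂ ∘ cova) (inj₁ 2nd) f)) short)
        (λ f → near₁ G k A f covv (some (alive b∈) b∈ (alive v∈) f))
        (λ f → near₂ G k A f cova (one covw f) (some (alive z∈) z∈ aa f)) short)
        (λ f → near₁ G k A f covw (some (alive c∈) c∈ (alive w∈) f))
        (λ f → near₂ G k A f (swap₁₂ ∘ cova) (one covv f) (some (alive z∈) z∈ aa f)) short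
      where
      U = (v , b) ∷ (w , c) ∷ (a , v) ∷ (a , w) ∷ []
      listed : ∀ {r x} → r ∈ v ∷ w ∷ [] → x ∈ N r → Listed G k r x U
      listed 1st x∈ = by (covv x∈)
        where
        by : ∀ {x} → x ∈ a ∷ b ∷ [] → Listed G k v x U
        by 1st = inj₂ 3rd
        by 2nd = inj₁ 1st
      listed 2nd x∈ = by (covw x∈)
        where
        by : ∀ {x} → x ∈ a ∷ c ∷ [] → Listed G k w x U
        by 1st = inj₂ (there 3rd)
        by 2nd = inj₁ 2nd

    -- The edge `wb` comes first, while `av` is open, and sees at most four edges, all through `b`.
    -- Then `av` sees at most 1 + (1 + 2), and `vw` at most 2 + 2.
    remove-thread-beside-two : ∀ {a v u z w b c} → T (A a) → v ∈ N a → u ∈ N a → z ∈ N a → Cov a (v ∷ u ∷ z ∷ []) →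
      w ∈ N v → Cov v (a ∷ w ∷ []) → b ∈ N w → Cov w (v ∷ b ∷ []) → Cov u (a ∷ c ∷ []) → 4 < k → Removable (v ∷ w ∷ [])
    remove-thread-beside-two {a} {v} {u} {z} {w} {b} {c} aa v∈ u∈ z∈ cova w∈ covv b∈ covw covu short K =
      step (step (step (restore G k listed K)
        (four (alive b∈) (back (alive w∈) b∈)) (λ f → near₁ G k A f (swap₂ ∘ covw) (none (swap₂ ∘ covv) (inj₂ 2nd) f)) short)
        (λ f → near₁ G k A f covv (one covw f)) (λ f → near₂ G k A f cova (one covu f) (some (alive z∈) z∈ aa f)) short)
        (λ f → near₁ G k A f covw (some (alive b∈) b∈ (alive w∈) f))
        (λ f → near₁ G k A f (swap₂ ∘ covv) (some aa (back aa v∈) (alive v∈) f)) short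
      where
      U = (w , b) ∷ (a , v) ∷ (v , w) ∷ []
      listed : ∀ {r x} → r ∈ v ∷ w ∷ [] → x ∈ N r → Listed G k r x U
      listed 1st x∈ = by (covv x∈)
        where
        by : ∀ {x} → x ∈ a ∷ w ∷ [] → Listed G k v x U
        by 1st = inj₂ 2nd
        by 2nd = inj₁ 3rd
      listed 2nd x∈ = by (covw x∈)
        where
        by : ∀ {x} → x ∈ v ∷ b ∷ [] → Listed G k w x U
        by 1st = inj₂ 3rd
        by 2nd = inj₁ 1st

    -- An edge at `a` sees at most two edges through its own 2-vertex and one through each of the
    -- other two.
    remove-centre : ∀ {a u v w p q r} → T (A a) → u ∈ N a → v ∈ N a → w ∈ N a → Cov a (u ∷ v ∷ w ∷ []) →
      p ∈ N u → Cov u (a ∷ p ∷ []) → q ∈ N v → Cov v (a ∷ q ∷ []) → r ∈ N w → Cov w (a ∷ r ∷ []) →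
      4 < k → Removable (a ∷ [])
    remove-centre {a} {u} {v} {w} aa u∈ v∈ w∈ cova p∈ covu q∈ covv r∈ covw short K =
      step (step (step (restore G k listed K)
        (λ f → near₁ G k A f covu (some (alive p∈) p∈ (alive u∈) f)) (λ f → near₂ G k A f cova (one covv f) (one covw f)) short)
        (λ f → near₁ G k A f covv (some (alive q∈) q∈ (alive v∈) f)) (λ f → near₂ G k A f (rotate ∘ cova) (one covw f) (one covu f)) short)
        (λ f → near₁ G k A f covw (some (alive r∈) r∈ (alive w∈) f)) (λ f → near₂ G k A f (rotate ∘ rotate ∘ cova) (one covu f) (one covv f)) short
      where
      U = (a , u) ∷ (a , v) ∷ (a , w) ∷ []
      listed : ∀ {s x} → s ∈ a ∷ [] → x ∈ N s → Listed G k s x U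
      listed (here refl) x∈ = by (cova x∈)
        where
        by : ∀ {x} → x ∈ u ∷ v ∷ w ∷ [] → Listed G k a x U
        by 1st = inj₁ 1st
        by 2nd = inj₁ 2nd
        by 3rd = inj₁ 3rd

-- Four colours on a path with pendant edges, by exhaustion.

module LeafColours where

  open Induced
  open Colour
  open Reduce
  open Rotation using (∧-true)
  open import Data.Bool.Base using (Bool; true; false; _∧_; _∨_)
  open import Data.Fin.Base as Fin using (Fin; zero; suc)
  open import Data.Nat.Base
  open import Data.Nat.Properties hiding (_≟_)
  open import Data.Product.Base using (_×_; _,_; proj₁; proj₂; ∃-syntax)
  open import Function.Base using (_∘_)
  open import Relation.Binary.PropositionalEquality

  every some : ∀ {n} → (Fin n → Bool) → Bool
  every {zero} f = true
  every {suc n} f = f zero ∧ every (f ∘ suc)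
  some {zero} f = false
  some {suc n} f = f zero ∨ some (f ∘ suc)

  every-sound : ∀ {n} (f : Fin n → Bool) → every f ≡ true → ∀ i → f i ≡ true
  every-sound f e zero = proj₁ (∧-true e)
  every-sound f e (suc i) = every-sound (f ∘ suc) (proj₂ (∧-true {f zero} e)) i

  some-sound : ∀ {n} (f : Fin n → Bool) → some f ≡ true → ∃[ i ] f i ≡ true
  some-sound {suc n} f e with f zero in eq
  ... | true = zero , eq
  ... | false = let (i , h) = some-sound (f ∘ suc) e in suc i , h

  _≠_ : ∀ {n} → Fin n → Fin n → Bool
  zero ≠ zero = false
  zero ≠ suc _ = true
  suc _ ≠ zero = true
  suc i ≠ suc j = i ≠ j

  ≠-sound : ∀ {n} {i j : Fin n} → (i ≠ j) ≡ true → i ≢ j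
  ≠-sound {i = suc i} e refl = ≠-sound {i = i} e refl

  ≠₃-sound : ∀ {n} {a b c d : Fin n} → (a ≠ b) ∧ (a ≠ c) ∧ (a ≠ d) ≡ true → a ≢ b × a ≢ c × a ≢ d
  ≠₃-sound {a = a} {b} {c} {d} e = ≠-sound (proj₁ h) , ≠-sound (proj₁ h′) , ≠-sound (proj₂ h′)
    where
    h = ∧-true {a ≠ b} e
    h′ = ∧-true {a ≠ c} {a ≠ d} (proj₂ h)

  -- The five uncoloured edges of three consecutive 2-vertices with pendant
  -- edges: the outer edges have colours p, q, y and z, r, s.
  middleLeaf : (y z m₁ m₃ : Fin 4) → Bool
  middleLeaf y z m₁ m₃ = some λ m₂ → (m₂ ≠ y) ∧ (m₂ ≠ z) ∧ (m₂ ≠ m₁) ∧ (m₂ ≠ m₃)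

  middleLeaf-sound : ∀ {y z m₁ m₃} → middleLeaf y z m₁ m₃ ≡ true →
    ∃[ m₂ ] (m₂ ≢ y × m₂ ≢ z × m₂ ≢ m₁ × m₂ ≢ m₃)
  middleLeaf-sound {y} {z} {m₁} {m₃} h = m₂ , ≠-sound (proj₁ c) , ≠₃-sound (proj₂ c)
    where
    found = some-sound (λ m₂ → (m₂ ≠ y) ∧ (m₂ ≠ z) ∧ (m₂ ≠ m₁) ∧ (m₂ ≠ m₃)) h
    m₂ = proj₁ found
    c = ∧-true {m₂ ≠ y} {(m₂ ≠ z) ∧ (m₂ ≠ m₁) ∧ (m₂ ≠ m₃)} (proj₂ found)

  -- The later choices sit inside the test `P`, so a colour is accepted only if it can be completed.
  guarded : (a b c : Fin 4) → (Fin 4 → Bool) → Bool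
  guarded a b c P = some λ e → ((e ≠ a) ∧ (e ≠ b) ∧ (e ≠ c)) ∧ P e

  guarded-sound : ∀ {a b c P} → guarded a b c P ≡ true → ∃[ e ] ((e ≢ a × e ≢ b × e ≢ c) × P e ≡ true)
  guarded-sound {a} {b} {c} {P} h = e , ≠₃-sound (proj₁ d) , proj₂ d
    where
    found = some-sound (λ e → ((e ≠ a) ∧ (e ≠ b) ∧ (e ≠ c)) ∧ P e) h
    e = proj₁ found
    d = ∧-true {(e ≠ a) ∧ (e ≠ b) ∧ (e ≠ c)} {P e} (proj₂ found)

  leafyPath : (p q y z r s : Fin 4) → Bool
  leafyPath p q y z r s = guarded p q z λ e₁ → guarded r s y λ e₂ → guarded p q e₂ λ m₁ → guarded r s e₁ λ m₃ →
    middleLeaf y z m₁ m₃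

  -- All 4096 outer colourings are evaluated. The conflicts among the five edges form the path `e₁`,
  -- `m₃`, `m₂`, `m₁`, `e₂`, whose members keep at least 1, 2, 2, 2, 1 colours. Lists of these sizes
  -- alone would not suffice; it matters that `e₁` and `m₁` both avoid `p` and `q`, and that `e₂`
  -- and `m₃` both avoid `r` and `s`.
  leafyPath-all : (every {4} λ p → every {4} λ q → every {4} λ y → every {4} λ z → every {4} λ r → every {4} λ s →
    leafyPath p q y z r s) ≡ true
  leafyPath-all = refl

  leafyPath-true : ∀ p q y z r s → leafyPath p q y z r s ≡ true
  leafyPath-true p q y z r = every-sound (leafyPath p q y z r)
    (every-sound (λ r → every (leafyPath p q y z r))
    (every-sound (λ z → every λ r → every (leafyPath p q y z r))
    (every-sound (λ y → every λ z → every λ r → every (leafyPath p q y z r))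
    (every-sound (λ q → every λ y → every λ z → every λ r → every (leafyPath p q y z r))
    (every-sound (λ p → every λ q → every λ y → every λ z → every λ r → every (leafyPath p q y z r)) leafyPath-all p) q) y) z) r)

  record LeafyColours (p q y z r s : Fin 4) : Set where
    constructor leafyColours
    field
      {e₁ e₂ m₁ m₃ m₂} : Fin 4
      E₁ : e₁ ≢ p × e₁ ≢ q × e₁ ≢ z
      E₂ : e₂ ≢ r × e₂ ≢ s × e₂ ≢ y
      M₁ : m₁ ≢ p × m₁ ≢ q × m₁ ≢ e₂
      M₃ : m₃ ≢ r × m₃ ≢ s × m₃ ≢ e₁
      M₂ : m₂ ≢ y × m₂ ≢ z × m₂ ≢ m₁ × m₂ ≢ m₃

  opaque
    leafy-colours : ∀ p q y z r s → LeafyColours p q y z r s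
    leafy-colours p q y z r s = first (guarded-sound {p} {q} {z} (leafyPath-true p q y z r s))
      where
      Chosen : (a b c : Fin 4) → (Fin 4 → Bool) → Set
      Chosen a b c P = ∃[ e ] ((e ≢ a × e ≢ b × e ≢ c) × P e ≡ true)
      fourth : ∀ {e₁ e₂ m₁} → e₁ ≢ p × e₁ ≢ q × e₁ ≢ z → e₂ ≢ r × e₂ ≢ s × e₂ ≢ y → m₁ ≢ p × m₁ ≢ q × m₁ ≢ e₂ →
        Chosen r s e₁ (λ m₃ → middleLeaf y z m₁ m₃) → LeafyColours p q y z r s
      fourth {m₁ = m₁} E₁ E₂ M₁ (m₃ , M₃ , h) = leafyColours E₁ E₂ M₁ M₃ (proj₂ (middleLeaf-sound {y} {z} {m₁} {m₃} h))
      third : ∀ {e₁ e₂} → e₁ ≢ p × e₁ ≢ q × e₁ ≢ z → e₂ ≢ r × e₂ ≢ s × e₂ ≢ y →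
        Chosen p q e₂ (λ m₁ → guarded r s e₁ λ m₃ → middleLeaf y z m₁ m₃) → LeafyColours p q y z r s
      third {e₁} E₁ E₂ (m₁ , M₁ , h) = fourth E₁ E₂ M₁ (guarded-sound {r} {s} {e₁} {λ m₃ → middleLeaf y z m₁ m₃} h)
      second : ∀ {e₁} → e₁ ≢ p × e₁ ≢ q × e₁ ≢ z →
        Chosen r s y (λ e₂ → guarded p q e₂ λ m₁ → guarded r s e₁ λ m₃ → middleLeaf y z m₁ m₃) → LeafyColours p q y z r s
      second {e₁} E₁ (e₂ , E₂ , h) = third E₁ E₂ (guarded-sound {p} {q} {e₂} {λ m₁ → guarded r s e₁ λ m₃ → middleLeaf y z m₁ m₃} h)
      first : Chosen p q z (λ e₁ → guarded r s y λ e₂ → guarded p q e₂ λ m₁ → guarded r s e₁ λ m₃ → middleLeaf y z m₁ m₃) →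
        LeafyColours p q y z r s
      first (e₁ , E₁ , h) = second E₁ (guarded-sound {r} {s} {y} {λ e₂ → guarded p q e₂ λ m₁ → guarded r s e₁ λ m₃ → middleLeaf y z m₁ m₃} h)

-- Prescribed colours beyond the ends of an edge, with four colours available.

module Ends where

  open Induced
  open Walks using (loopless)
  open Colour
  open Reduce
  open import Data.Bool.Base using (Bool; T)
  open import Data.Empty using (⊥-elim)
  open import Data.Fin.Base as Fin using (Fin; zero)
  open import Data.List.Base using (List; []; _∷_; length)
  open import Data.List.Membership.Propositional using (_∈_)
  open import Data.Nat.Base
  open import Data.Nat.Properties hiding (_≟_)
  open import Data.Product.Base using (_×_; _,_; proj₁; proj₂; ∃-syntax)
  open import Relation.Binary.PropositionalEquality
  open import Relation.Nullary using (¬_; contradiction)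

  module Around (G : Graph) (A : Graph.Vertex G → Bool) (subcubic : ∀ v → length (nbrs G A v) ≤ 3)
         (triangle-free : ∀ {a b c} → Graph.Adj G a b → Graph.Adj G b c → ¬ Graph.Adj G c a) where
    open Graph G using (Vertex; Adj)

    N : Vertex → List Vertex
    N = nbrs G A
    Cov : Vertex → List Vertex → Set
    Cov = Covers G 4 A
    Removable : List Vertex → Set
    Removable R = Colourable G 4 (_∖_ G 4 A R) → Colourable G 4 A
    Lst : Vertex → Vertex → List (Vertex × Vertex) → Set
    Lst = Listed G 4
    Nr : List (Vertex × Vertex) → Vertex → Vertex → Vertex → Vertex → Set
    Nr = Near G 4 A

    back : ∀ {u v} → T (A v) → u ∈ N v → v ∈ N u
    back = nbr-sym G 4 A

    alive : ∀ {u v} → u ∈ N v → T (A u)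
    alive h = proj₁ (∈-nbrs⁻ G A h)

    joined : ∀ {u v} → u ∈ N v → Adj v u
    joined h = proj₂ (∈-nbrs⁻ G A h)

    apart : ∀ {u v} → Adj u v → u ≢ v
    apart a refl = loopless G a

    -- A counterpart of `Bound` for a colour `x` that has been chosen in advance: the colours at `c`
    -- are compared with it instead of being counted.
    record End (U : List (Vertex × Vertex)) (c v : Vertex) (f : Vertex → Vertex → Fin 4) (x : Fin 4) : Set where
      constructor end
      field avoids : ∀ {d} → d ∈ N c → d ≢ v → ¬ Lst c d U → f c d ≢ x

    open End public

    end-leaf : ∀ {U c v f x} → Cov c (v ∷ []) → End U c v f x
    end-leaf {c = c} {v} cov = end λ d∈ d≢v _ → ⊥-elim (only (cov d∈) d≢v)
      where
      only : ∀ {d} → d ∈ v ∷ [] → ¬ d ≢ v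
      only 1st h = h refl

    end₁ : ∀ {U c v d f x} → Cov c (v ∷ d ∷ []) → (¬ Lst c d U → f c d ≢ x) → End U c v f x
    end₁ {U} {c} {v} {d} {f} {x} cov h = end λ d∈ → by (cov d∈)
      where
      by : ∀ {e} → e ∈ v ∷ d ∷ [] → e ≢ v → ¬ Lst c e U → f c e ≢ x
      by 1st e≢v _ = ⊥-elim (e≢v refl)
      by 2nd _ l = h l

    end₂ : ∀ {U c v d e f x} → Cov c (v ∷ d ∷ e ∷ []) → (¬ Lst c d U → f c d ≢ x) → (¬ Lst c e U → f c e ≢ x) →
      End U c v f x
    end₂ {U} {c} {v} {d} {e} {f} {x} cov h k = end λ d∈ → by (cov d∈)
      where
      by : ∀ {b} → b ∈ v ∷ d ∷ e ∷ [] → b ≢ v → ¬ Lst c b U → f c b ≢ x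
      by 1st b≢v _ = ⊥-elim (b≢v refl)
      by 2nd _ l = h l
      by 3rd _ l = k l

    near-one : ∀ {U v u c f x} → Cov v (u ∷ c ∷ []) → End U c v f x → ∀ {a b} → Nr U v u a b → f a b ≢ x
    near-one {U} {v} {u} {c} {f} {x} cov h (c∈ , c≢u , d∈ , d≢v , l) = by (cov c∈) c≢u d∈ d≢v l
      where
      by : ∀ {a b} → a ∈ u ∷ c ∷ [] → a ≢ u → b ∈ N a → b ≢ v → ¬ Lst a b U → f a b ≢ x
      by 1st a≢u = ⊥-elim (a≢u refl)
      by 2nd _ = avoids h

    near-two : ∀ {U v u c c′ f x} → Cov v (u ∷ c ∷ c′ ∷ []) → End U c v f x → End U c′ v f x →
      ∀ {a b} → Nr U v u a b → f a b ≢ x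
    near-two {U} {v} {u} {c} {c′} {f} {x} cov h k (c∈ , c≢u , d∈ , d≢v , l) = by (cov c∈) c≢u d∈ d≢v l
      where
      by : ∀ {a b} → a ∈ u ∷ c ∷ c′ ∷ [] → a ≢ u → b ∈ N a → b ≢ v → ¬ Lst a b U → f a b ≢ x
      by 1st a≢u = ⊥-elim (a≢u refl)
      by 2nd _ = avoids h
      by 3rd _ = avoids k

    near-leaf : ∀ {U v u} {f : Vertex → Vertex → Fin 4} {x} → Cov v (u ∷ []) → ∀ {a b} → Nr U v u a b → f a b ≢ x
    near-leaf {u = u} cov (c∈ , c≢u , _) = ⊥-elim (only (cov c∈) c≢u)
      where
      only : ∀ {d} → d ∈ u ∷ [] → ¬ d ≢ u
      only 1st h = h refl

    listed⇒ : ∀ {U c d} {P : Set} → Lst c d U → ¬ Lst c d U → P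
    listed⇒ l ¬l = contradiction l ¬l

    -- Shorter lists are padded by repetition, with `zero` for the empty list, because the
    -- exhaustive search expects exactly two colours beyond each end.
    two-colours : ∀ (xs : List (Fin 4)) → length xs ≤ 2 → ∃[ p ] ∃[ q ] (∀ {x} → x ∈ xs → x ∈ p ∷ q ∷ [])
    two-colours [] _ = zero , zero , λ ()
    two-colours (p ∷ []) _ = p , p , λ { 1st → 1st }
    two-colours (p ∷ q ∷ []) _ = p , q , λ { 1st → 1st ; 2nd → 2nd }
    two-colours (_ ∷ _ ∷ _ ∷ _) (s≤s (s≤s ()))

-- Arms of two 2-vertices attached to a 3-vertex.

module Arms where

  open Ends
  open Induced
  open Colour
  open Reduce
  open import Data.Bool.Base using (Bool; T)
  open import Data.Empty using (⊥-elim)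
  open import Data.Fin.Base as Fin using (Fin)
  open import Data.List.Base using (List; []; _∷_; _++_; length)
  open import Data.List.Membership.Propositional using (_∈_)
  open import Data.List.Relation.Unary.Any using (here)
  open import Data.Nat.Base
  open import Data.Nat.Properties hiding (_≟_)
  open import Data.Product.Base using (_×_; _,_; proj₁; proj₂; Σ-syntax)
  open import Data.Sum.Base using (inj₁; inj₂)
  open import Function.Base using (_∘_)
  open import Relation.Binary.PropositionalEquality
  open import Relation.Nullary using (¬_)

  module Limbs (G : Graph) (A : Graph.Vertex G → Bool) (subcubic : ∀ v → length (nbrs G A v) ≤ 3)
           (triangle-free : ∀ {a b c} → Graph.Adj G a b → Graph.Adj G b c → ¬ Graph.Adj G c a) where
    open Graph G using (Vertex; Adj)
    open Around G A subcubic triangle-free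

    -- One of the three arms at a 3-vertex a: two 2-vertices u and u′, both with
    -- or both without a pendant edge.
    data Arm (a u : Vertex) : Set where
      plain : ∀ {u′ c} → u′ ∈ N u → Cov u (a ∷ u′ ∷ []) → c ∈ N u′ → Cov u′ (u ∷ c ∷ []) → a ≢ u′ → Arm a u
      leafy : ∀ {u′ c l l′} → u′ ∈ N u → l ∈ N u → Cov u (a ∷ u′ ∷ l ∷ []) →
              c ∈ N u′ → l′ ∈ N u′ → Cov u′ (u ∷ c ∷ l′ ∷ []) → Cov l (u ∷ []) → Cov l′ (u′ ∷ []) →
              a ≢ u′ → a ≢ l → a ≢ l′ → Arm a u

    -- The order is the one in which `finish-arm` colours the edges.
    armEdges : ∀ {a u} → Arm a u → List (Vertex × Vertex)
    armEdges {u = u} (plain {u′ = u′} _ _ _ _ _) = (u , u′) ∷ []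
    armEdges {u = u} (leafy {u′ = u′} {l = l} {l′} _ _ _ _ _ _ _ _ _ _ _) = (u , u′) ∷ (u′ , l′) ∷ (u , l) ∷ []

    armLeaves : ∀ {a u} → Arm a u → List Vertex
    armLeaves (plain _ _ _ _ _) = []
    armLeaves (leafy {l = l} {l′} _ _ _ _ _ _ _ _ _ _ _) = l ∷ l′ ∷ []

    innerEnd outerEnd : ∀ {a u} → Arm a u → Vertex
    innerEnd (plain {u′ = u′} _ _ _ _ _) = u′
    innerEnd (leafy {u′ = u′} _ _ _ _ _ _ _ _ _ _ _) = u′
    outerEnd (plain {c = c} _ _ _ _ _) = c
    outerEnd (leafy {c = c} _ _ _ _ _ _ _ _ _ _ _) = c

    inner-joined : ∀ {a u} (arm : Arm a u) → a ≢ innerEnd arm × Adj u (innerEnd arm)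
    inner-joined (plain u′∈ _ _ _ a≢) = a≢ , joined u′∈
    inner-joined (leafy u′∈ _ _ _ _ _ _ _ a≢ _ _) = a≢ , joined u′∈

    module _ {a u : Vertex} where

      arm-near : ∀ (arm : Arm a u) {U} {f : Vertex → Vertex → Fin 4} {x} → (∀ {e} → e ∈ armEdges arm → e ∈ U) →
        f (innerEnd arm) (outerEnd arm) ≢ x → ∀ {c d} → Nr U u a c d → f c d ≢ x
      arm-near (plain _ covu _ covu′ _) sub h = near-one covu (end₁ covu′ (λ _ → h))
      arm-near (leafy _ _ covu _ _ covu′ covl _ _ _ _) sub h =
        near-two covu (end₂ covu′ (λ _ → h) (listed⇒ (inj₁ (sub 2nd)))) (end-leaf covl)

      arm-listed : ∀ (arm : Arm a u) {d} → d ∈ N u → d ≢ a → Lst u d (armEdges arm)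
      arm-listed (plain _ covu _ _ _) d∈ d≢a with covu d∈
      ... | 1st = ⊥-elim (d≢a refl)
      ... | 2nd = inj₁ 1st
      arm-listed (leafy _ _ covu _ _ _ _ _ _ _ _) d∈ d≢a with covu d∈
      ... | 1st = ⊥-elim (d≢a refl)
      ... | 2nd = inj₁ 1st
      ... | 3rd = inj₁ 3rd

      leaves-listed : ∀ (arm : Arm a u) {l d} → l ∈ armLeaves arm → d ∈ N l → Lst l d (armEdges arm)
      leaves-listed (leafy _ _ _ _ _ _ covl _ _ _ _) 1st d∈ with covl d∈
      ... | 1st = inj₂ 3rd
      leaves-listed (leafy _ _ _ _ _ _ _ covl′ _ _ _) 2nd d∈ with covl′ d∈
      ... | 1st = inj₂ 2nd

      -- Edges at `a` of one colour count once in a `Bound`. This is what leaves every edge of an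
      -- arm a free colour out of four.
      Star : ∀ {U} → Colouring G 4 A U → Fin 4 → Set
      Star K x = ∀ {d} → d ∈ N a → col K a d ≡ x

      private
        at-star : ∀ {U V x} (K : Colouring G 4 A V) → Star K x → Bound G 4 A (col K) (Beyond G 4 A U a u) 1
        at-star {x = x} K star = x ∷ [] , s≤s z≤n , λ { (refl , d∈ , _) → here (star d∈) }

        two-at : ∀ {U v c} {K : Vertex → Vertex → Fin 4} → v ∈ N c → Bound G 4 A K (Beyond G 4 A U c v) 2
        two-at {c = c} {K} v∈ = at-degree G 4 A K v∈ (subcubic c)

        missing : ∀ {v d U} {f : Vertex → Vertex → Fin 4} → Cov v (d ∷ []) → Bound G 4 A f (Beyond G 4 A U v d) 0
        missing {f = f} cov = at-cover G 4 A f cov [] λ ()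

        not-at : ∀ {p q d} → a ≢ p → a ≢ q → ¬ Same G 4 A p q a d
        not-at a≢p a≢q (inj₁ (e , _)) = a≢p e
        not-at a≢p a≢q (inj₂ (e , _)) = a≢q e

      -- Every edge sees at most three colours. For `uu′` these are two through `c` and the star
      -- colour. For `u′l′` they are two through `c` and that of `au`, because `ul` is still open.
      -- For `ul` they are the star colour and those of `u′c` and `u′l′`.
      finish-arm : ∀ (arm : Arm a u) → T (A u) → Adj a u → ∀ {U x} (K : Colouring G 4 A (armEdges arm ++ U)) → Star K x →
        Σ[ K′ ∈ Colouring G 4 A U ] Star K′ x
      finish-arm (plain {u′ = u′} {c} u′∈ covu c∈ covu′ a≢u′) au e K star =
        let (K′ , same) = greedy G 4 A K
              (near₁ G 4 A (col K) covu′ (two-at (back (alive u′∈) c∈)))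
              (near₁ G 4 A (col K) (swap₂ ∘ covu) (at-star K star)) ≤-refl
        in K′ , λ d∈ → trans (same (not-at (apart e) a≢u′)) (star d∈)
      finish-arm (leafy {u′ = u′} {c} {l} {l′} u′∈ l∈ covu c∈ l′∈ covu′ covl covl′ a≢u′ a≢l a≢l′) au e {U} {x} K star = result
        where
        first-step = greedy G 4 A K
          (near₂ G 4 A (col K) covu′ (two-at (back (alive u′∈) c∈)) (missing covl′))
          (near₂ G 4 A (col K) (swap₁₂ ∘ covu) (at-star K star) (missing covl)) ≤-refl
        K₁ = proj₁ first-step
        star₁ : Star K₁ x
        star₁ d∈ = trans (proj₂ first-step (not-at (apart e) a≢u′)) (star d∈)
        second-step = greedy G 4 A K₁ (near₀ G 4 A (col K₁) covl′)
          (near₂ G 4 A (col K₁) (rotate ∘ rotate ∘ covu′)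
            (at-cover G 4 A (col K₁) (swap₁₂ ∘ covu) (a ∷ []) λ { 1st → inj₂ 1st ; 2nd → inj₁ (inj₁ 2nd) })
            (two-at (back (alive u′∈) c∈))) ≤-refl
        K₂ = proj₁ second-step
        star₂ : Star K₂ x
        star₂ d∈ = trans (proj₂ second-step (not-at a≢u′ a≢l′)) (star₁ d∈)
        third-step = greedy G 4 A K₂ (near₀ G 4 A (col K₂) covl)
          (near₂ G 4 A (col K₂) (rotate ∘ rotate ∘ covu) (at-star K₂ star₂)
            (at-cover G 4 A (col K₂) covu′ (c ∷ l′ ∷ []) inj₂)) ≤-refl
        result : Σ[ K′ ∈ Colouring G 4 A U ] Star K′ x
        result = proj₁ third-step , λ d∈ → trans (proj₂ third-step (not-at (apart e) a≢l)) (star₂ d∈)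

      opaque
        complete-arm : ∀ (arm : Arm a u) → T (A u) → Adj a u → ∀ {U x} (K : Colouring G 4 A (armEdges arm ++ U)) →
          Star K x → Σ[ K′ ∈ Colouring G 4 A U ] Star K′ x
        complete-arm = finish-arm

-- Reduction of three consecutive vertices with a pendant edge each.

module LeafyPaths where

  open LeafColours
  open Ends
  open Induced
  open Walks using (loopless)
  open Colour
  open Reduce
  open import Data.Bool.Base using (Bool; T)
  open import Data.Fin.Base as Fin using (Fin)
  open import Data.List.Base using (List; []; _∷_; length)
  open import Data.List.Membership.Propositional using (_∈_; _∉_)
  open import Data.List.Relation.Unary.Any using (there)
  open import Data.Nat.Base
  open import Data.Nat.Properties hiding (_≟_)
  open import Data.Product.Base using (_×_; _,_; proj₁; proj₂; ∃-syntax)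
  open import Data.Sum.Base using (_⊎_; inj₁; inj₂)
  open import Function.Base using (_∘_)
  open import Relation.Binary.PropositionalEquality
  open import Relation.Nullary using (¬_)

  module _ (G : Graph) (A : Graph.Vertex G → Bool) (subcubic : ∀ v → length (nbrs G A v) ≤ 3)
           (triangle-free : ∀ {a b c} → Graph.Adj G a b → Graph.Adj G b c → ¬ Graph.Adj G c a) where
    open Graph G using (Vertex; Adj)
    open Around G A subcubic triangle-free

    record LeafyPath : Set where
      field
        {x₁ x₂ x₃ l₁ l₂ l₃ c w} : Vertex
        ax₂   : T (A x₂)
        x₁∈   : x₁ ∈ N x₂
        x₃∈   : x₃ ∈ N x₂
        l₂∈   : l₂ ∈ N x₂
        cov₂  : Cov x₂ (x₁ ∷ x₃ ∷ l₂ ∷ [])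
        covl₂ : Cov l₂ (x₂ ∷ [])
        c∈    : c ∈ N x₁
        l₁∈   : l₁ ∈ N x₁
        cov₁  : Cov x₁ (x₂ ∷ c ∷ l₁ ∷ [])
        covl₁ : Cov l₁ (x₁ ∷ [])
        w∈    : w ∈ N x₃
        l₃∈   : l₃ ∈ N x₃
        cov₃  : Cov x₃ (x₂ ∷ w ∷ l₃ ∷ [])
        covl₃ : Cov l₃ (x₃ ∷ [])
        x₁≢x₃ : x₁ ≢ x₃
        c≢x₂  : c ≢ x₂
        w≢x₂  : w ≢ x₂
        c≢l₁  : c ≢ l₁
        w≢l₃  : w ≢ l₃

      removed : List Vertex
      removed = x₂ ∷ l₁ ∷ l₂ ∷ l₃ ∷ []

    module _ (P : LeafyPath) where
      open LeafyPath P
      private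
        U = (x₁ , x₂) ∷ (x₂ , x₃) ∷ (x₁ , l₁) ∷ (x₃ , l₃) ∷ (x₂ , l₂) ∷ []

        leaf-nbr : ∀ {l v} → Cov l (v ∷ []) → ∀ {u} → T (A l) → l ∈ N u → T (A u) → u ≡ v
        leaf-nbr cov al l∈ au with cov (back au l∈)
        ... | 1st = refl

        ax₁ = alive x₁∈
        ax₃ = alive x₃∈

        -- The five edges to be coloured lie within these six vertices. Edges with an end outside
        -- keep their colours throughout, which is why `c` and `w` have to be located first.
        Core : Vertex → Set
        Core v = v ≡ x₁ ⊎ v ≡ x₂ ⊎ v ≡ x₃ ⊎ v ≡ l₁ ⊎ v ≡ l₂ ⊎ v ≡ l₃

        c-outside : ¬ Core c
        c-outside (inj₁ refl) = loopless G (joined c∈)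
        c-outside (inj₂ (inj₁ e)) = c≢x₂ e
        c-outside (inj₂ (inj₂ (inj₁ refl))) = triangle-free (joined c∈) (Adj-sym G (joined x₃∈)) (joined x₁∈)
        c-outside (inj₂ (inj₂ (inj₂ (inj₁ e)))) = c≢l₁ e
        c-outside (inj₂ (inj₂ (inj₂ (inj₂ (inj₁ refl))))) = apart (joined x₁∈) (sym (leaf-nbr covl₂ (alive l₂∈) c∈ ax₁))
        c-outside (inj₂ (inj₂ (inj₂ (inj₂ (inj₂ refl))))) = x₁≢x₃ (leaf-nbr covl₃ (alive l₃∈) c∈ ax₁)

        w-outside : ¬ Core w
        w-outside (inj₁ refl) = triangle-free (joined w∈) (Adj-sym G (joined x₁∈)) (joined x₃∈)
        w-outside (inj₂ (inj₁ e)) = w≢x₂ e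
        w-outside (inj₂ (inj₂ (inj₁ refl))) = loopless G (joined w∈)
        w-outside (inj₂ (inj₂ (inj₂ (inj₁ refl)))) = x₁≢x₃ (sym (leaf-nbr covl₁ (alive l₁∈) w∈ ax₃))
        w-outside (inj₂ (inj₂ (inj₂ (inj₂ (inj₁ refl))))) = apart (joined x₃∈) (sym (leaf-nbr covl₂ (alive l₂∈) w∈ ax₃))
        w-outside (inj₂ (inj₂ (inj₂ (inj₂ (inj₂ e))))) = w≢l₃ e

        differs : ∀ {u v a b} → Core u → Core v → ¬ Core a → ¬ Same G 4 A u v a b
        differs cu cv ¬ca (inj₁ (refl , _)) = ¬ca cu
        differs cu cv ¬ca (inj₂ (refl , _)) = ¬ca cv

        differs′ : ∀ {u v a b} → Core u → Core v → ¬ Core b → ¬ Same G 4 A u v a b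
        differs′ cu cv ¬cb (inj₁ (_ , refl)) = ¬cb cv
        differs′ cu cv ¬cb (inj₂ (_ , refl)) = ¬cb cu

        κ₁ : Core x₁
        κ₁ = inj₁ refl
        κ₂ : Core x₂
        κ₂ = inj₂ (inj₁ refl)
        κ₃ : Core x₃
        κ₃ = inj₂ (inj₂ (inj₁ refl))
        λ₁ : Core l₁
        λ₁ = inj₂ (inj₂ (inj₂ (inj₁ refl)))
        λ₂ : Core l₂
        λ₂ = inj₂ (inj₂ (inj₂ (inj₂ (inj₁ refl))))
        λ₃ : Core l₃
        λ₃ = inj₂ (inj₂ (inj₂ (inj₂ (inj₂ refl))))

        x₁≢x₂ = apart (Adj-sym G (joined x₁∈))
        x₂≢x₃ = apart (joined x₃∈)
        l₁≢x₂ : l₁ ≢ x₂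
        l₁≢x₂ refl = x₁≢x₃ (sym (leaf-nbr covl₁ ax₂ (back ax₂ x₃∈) ax₃))
        l₃≢x₁ : l₃ ≢ x₁
        l₃≢x₁ refl = triangle-free (joined l₃∈) (Adj-sym G (joined x₁∈)) (joined x₃∈)

        listed : ∀ {r v} → r ∈ removed → v ∈ N r → Lst r v U
        listed 1st v∈ = by (cov₂ v∈)
          where
          by : ∀ {v} → v ∈ x₁ ∷ x₃ ∷ l₂ ∷ [] → Lst x₂ v U
          by 1st = inj₂ 1st
          by 2nd = inj₁ 2nd
          by 3rd = inj₁ (there (there 3rd))
        listed 2nd v∈ = by (covl₁ v∈)
          where
          by : ∀ {v} → v ∈ x₁ ∷ [] → Lst l₁ v U
          by 1st = inj₂ 3rd
        listed 3rd v∈ = by (covl₂ v∈)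
          where
          by : ∀ {v} → v ∈ x₂ ∷ [] → Lst l₂ v U
          by 1st = inj₂ (there (there 3rd))
        listed (there 3rd) v∈ = by (covl₃ v∈)
          where
          by : ∀ {v} → v ∈ x₃ ∷ [] → Lst l₃ v U
          by 1st = inj₂ (there 3rd)

        record Outer (c v : Vertex) (p q : Fin 4) (f : Vertex → Vertex → Fin 4) : Set where
          constructor outerColours
          field colours : ∀ {d} → d ∈ N c → d ≢ v → f c d ∈ p ∷ q ∷ []

        open Outer

        outer-end : ∀ {U c v p q f x} → Outer c v p q f → x ≢ p → x ≢ q → End U c v f x
        outer-end {p = p} {q} {x = x} o x≢p x≢q = end λ d∈ d≢v _ e → no-member (subst (_∈ p ∷ q ∷ []) e (colours o d∈ d≢v))
          where
          no-member : x ∉ p ∷ q ∷ []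
          no-member 1st = x≢p refl
          no-member 2nd = x≢q refl

        listed-core : ∀ {a b} → Lst a b U → Core a
        listed-core (inj₁ 1st) = κ₁
        listed-core (inj₁ 2nd) = κ₂
        listed-core (inj₁ 3rd) = κ₁
        listed-core (inj₁ (there 3rd)) = κ₃
        listed-core (inj₁ (there (there 3rd))) = κ₂
        listed-core (inj₂ 1st) = κ₂
        listed-core (inj₂ 2nd) = κ₃
        listed-core (inj₂ 3rd) = λ₁
        listed-core (inj₂ (there 3rd)) = λ₃
        listed-core (inj₂ (there (there 3rd))) = λ₂

        -- Apart from the edge to `v` there are at most two edges at `c`, and as `c` is outside the
        -- configuration none of them is among the uncoloured ones.
        outer : ∀ {c v} (K : Colouring G 4 A U) → ¬ Core c → v ∈ N c → ∃[ p ] ∃[ q ] Outer c v p q (col K)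
        outer K ¬core v∈ = let (xs , le , bound) = at-degree G 4 A {U} (col K) v∈ (subcubic _)
                               (p , q , sub) = two-colours xs le
                           in p , q , outerColours λ d∈ d≢v → sub (bound (refl , d∈ , d≢v , ¬core ∘ listed-core))

        keep : ∀ {c v p q f h} → (∀ {d} → h c d ≡ f c d) → Outer c v p q f → Outer c v p q h
        keep {p = p} {q} eq o = outerColours λ d∈ d≢v → subst (_∈ p ∷ q ∷ []) (sym eq) (colours o d∈ d≢v)

      remove-leafy-path : Removable removed
      remove-leafy-path K = K₅
        where
        K₀ : Colouring G 4 A U
        K₀ = restore G 4 {R = removed} listed K
        f₀ = col K₀
        outer-c = outer K₀ c-outside (back ax₁ c∈)
        outer-w = outer K₀ w-outside (back ax₃ w∈)
        p = proj₁ outer-c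
        q = proj₁ (proj₂ outer-c)
        r = proj₁ outer-w
        s = proj₁ (proj₂ outer-w)
        y = f₀ x₁ c
        z = f₀ x₃ w
        -- All five colours are fixed before any edge is coloured. The steps below only install them
        -- in the order of `U`, carrying the colours already read off through each recolouring.
        chosen = leafy-colours p q y z r s
        open LeafyColours chosen
        fst : ∀ {P Q S : Set} → P × Q × S → P
        fst (a , _ , _) = a
        snd : ∀ {P Q S : Set} → P × Q × S → Q
        snd (_ , b , _) = b
        thd : ∀ {P Q S : Set} → P × Q × S → S
        thd (_ , _ , c) = c
        is : ∀ {a b c : Fin 4} → a ≡ b → c ≢ b → a ≢ c
        is e h e′ = h (trans (sym e′) e)

        step₁ = recolour G 4 A K₀ e₁
          (near-two cov₂ (end₂ cov₃ (λ _ → is refl (thd E₁)) (listed⇒ (inj₁ (there 3rd)))) (end-leaf covl₂))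
          (near-two cov₁ (outer-end (proj₂ (proj₂ outer-c)) (fst E₁) (snd E₁)) (end-leaf covl₁))
        K₁ = proj₁ step₁
        same₁ = proj₂ (proj₂ step₁)
        outer-w₁ : Outer w x₃ r s (col K₁)
        outer-w₁ = keep {h = col K₁} (same₁ (differs κ₁ κ₂ w-outside)) (proj₂ (proj₂ outer-w))
        outer-c₁ : Outer c x₁ p q (col K₁)
        outer-c₁ = keep {h = col K₁} (same₁ (differs κ₁ κ₂ c-outside)) (proj₂ (proj₂ outer-c))
        y₁ : col K₁ x₁ c ≡ y
        y₁ = same₁ (differs′ κ₁ κ₂ c-outside)
        z₁ : col K₁ x₃ w ≡ z
        z₁ = same₁ (differs′ κ₁ κ₂ w-outside)

        step₂ = recolour G 4 A K₁ e₂
          (near-two cov₃ (outer-end outer-w₁ (fst E₂) (snd E₂)) (end-leaf covl₃))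
          (near-two (swap₁₂ ∘ cov₂) (end₂ cov₁ (λ _ → is y₁ (thd E₂)) (listed⇒ (inj₁ 2nd))) (end-leaf covl₂))
        K₂ = proj₁ step₂
        same₂ = proj₂ (proj₂ step₂)
        outer-w₂ : Outer w x₃ r s (col K₂)
        outer-w₂ = keep {h = col K₂} (same₂ (differs κ₂ κ₃ w-outside)) outer-w₁
        outer-c₂ : Outer c x₁ p q (col K₂)
        outer-c₂ = keep {h = col K₂} (same₂ (differs κ₂ κ₃ c-outside)) outer-c₁
        x₂x₁ : col K₂ x₂ x₁ ≡ e₁
        x₂x₁ = trans (same₂ (λ { (inj₁ (_ , e)) → x₁≢x₃ e ; (inj₂ (e , _)) → x₂≢x₃ e }))
          (trans (col-sym K₁ x₂ x₁) (proj₁ (proj₂ step₁)))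

        step₃ = recolour G 4 A K₂ m₁ (near-leaf {f = col K₂} covl₁)
          (near-two (rotate ∘ rotate ∘ cov₁)
            (end₂ cov₂ (λ _ → is (proj₁ (proj₂ step₂)) (thd M₁)) (listed⇒ (inj₁ 3rd)))
            (outer-end outer-c₂ (fst M₁) (snd M₁)))
        K₃ = proj₁ step₃
        same₃ = proj₂ (proj₂ step₃)
        x₂x₁₃ : col K₃ x₂ x₁ ≡ e₁
        x₂x₁₃ = trans (same₃ (λ { (inj₁ (e , _)) → x₁≢x₂ (sym e) ; (inj₂ (e , _)) → l₁≢x₂ (sym e) })) x₂x₁

        step₄ = recolour G 4 A K₃ m₃ (near-leaf {f = col K₃} covl₃)
          (near-two (rotate ∘ rotate ∘ cov₃)
            (end₂ (swap₁₂ ∘ cov₂) (λ _ → is x₂x₁₃ (thd M₃)) (listed⇒ (inj₁ 2nd)))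
            (outer-end (keep {h = col K₃} (same₃ (differs κ₁ λ₁ w-outside)) outer-w₂) (fst M₃) (snd M₃)))
        K₄ = proj₁ step₄
        same₄ = proj₂ (proj₂ step₄)
        y₄ : col K₄ x₁ c ≡ y
        y₄ = trans (same₄ (differs′ κ₃ λ₃ c-outside)) (trans (same₃ (differs′ κ₁ λ₁ c-outside))
          (trans (same₂ (differs′ κ₂ κ₃ c-outside)) y₁))
        z₄ : col K₄ x₃ w ≡ z
        z₄ = trans (same₄ (differs′ κ₃ λ₃ w-outside)) (trans (same₃ (differs′ κ₁ λ₁ w-outside))
          (trans (same₂ (differs′ κ₂ κ₃ w-outside)) z₁))
        x₁l₁ : col K₄ x₁ l₁ ≡ m₁
        x₁l₁ = trans (same₄ (λ { (inj₁ (e , _)) → x₁≢x₃ e ; (inj₂ (e , _)) → l₃≢x₁ (sym e) })) (proj₁ (proj₂ step₃))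

        K₅ : Colouring G 4 A []
        K₅ = proj₁ (recolour G 4 A K₄ m₂ (near-leaf {f = col K₄} covl₂)
          (near-two (rotate ∘ rotate ∘ cov₂)
            (end₂ cov₁ (λ _ → is y₄ (proj₁ M₂)) (λ _ → is x₁l₁ (proj₁ (proj₂ (proj₂ M₂)))))
            (end₂ cov₃ (λ _ → is z₄ (proj₁ (proj₂ M₂))) (λ _ → is (proj₁ (proj₂ step₄)) (proj₂ (proj₂ (proj₂ M₂)))))))

-- Reduction of a 3-vertex with three arms.

module Stars where

  open Ends
  open Arms
  open Induced
  open Walks using (loopless)
  open Colour
  open Reduce
  open import Data.Bool.Base using (Bool; T)
  open import Data.Empty using (⊥-elim)
  open import Data.Fin.Base as Fin using (Fin)
  import Data.Fin.Properties as Finₚ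
  open import Data.List.Base using (List; []; _∷_; _++_; length)
  open import Data.List.Membership.Propositional using (_∈_)
  open import Data.List.Membership.Propositional.Properties using (∈-++⁺ˡ; ∈-++⁺ʳ; ∈-++⁻)
  open import Data.List.Relation.Unary.Any using (here; there)
  open import Data.Nat.Base
  open import Data.Nat.Properties hiding (_≟_)
  open import Data.Product.Base using (_,_; proj₁; proj₂)
  open import Data.Sum.Base using (_⊎_; inj₁; inj₂; [_,_]′)
  open import Function.Base using (_∘_)
  open import Relation.Binary.PropositionalEquality
  open import Relation.Nullary using (¬_; yes; no)

  module _ (G : Graph) (A : Graph.Vertex G → Bool) (subcubic : ∀ v → length (nbrs G A v) ≤ 3)
           (triangle-free : ∀ {a b c} → Graph.Adj G a b → Graph.Adj G b c → ¬ Graph.Adj G c a) where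
    open Graph G using (Vertex; Adj)
    open Around G A subcubic triangle-free
    open Limbs G A subcubic triangle-free

    record Tripod : Set where
      field
        {a u₁ u₂ u₃} : Vertex
        aa   : T (A a)
        u₁∈  : u₁ ∈ N a
        u₂∈  : u₂ ∈ N a
        u₃∈  : u₃ ∈ N a
        cova : Cov a (u₁ ∷ u₂ ∷ u₃ ∷ [])
        arm₁ : Arm a u₁
        arm₂ : Arm a u₂
        arm₃ : Arm a u₃

    -- All three edges at the centre get one colour, avoiding the three edges
    -- leaving the arms; the arms are then completed greedily.
    module _ (P : Tripod) where
      open Tripod P

      tripodVertices : List Vertex
      tripodVertices = a ∷ u₁ ∷ u₂ ∷ u₃ ∷ armLeaves arm₁ ++ armLeaves arm₂ ++ armLeaves arm₃

      private
        arms = armEdges arm₁ ++ armEdges arm₂ ++ armEdges arm₃ ++ []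
        U = (a , u₁) ∷ (a , u₂) ∷ (a , u₃) ∷ arms

        sub₁ : ∀ {e} → e ∈ armEdges arm₁ → e ∈ arms
        sub₁ = ∈-++⁺ˡ
        sub₂ : ∀ {e} → e ∈ armEdges arm₂ → e ∈ arms
        sub₂ = ∈-++⁺ʳ (armEdges arm₁) ∘ ∈-++⁺ˡ
        sub₃ : ∀ {e} → e ∈ armEdges arm₃ → e ∈ arms
        sub₃ = ∈-++⁺ʳ (armEdges arm₁) ∘ ∈-++⁺ʳ (armEdges arm₂) ∘ ∈-++⁺ˡ

        lift : ∀ {v d V W} → (∀ {e} → e ∈ V → e ∈ W) → Lst v d V → Lst v d W
        lift sub (inj₁ h) = inj₁ (sub h)
        lift sub (inj₂ h) = inj₂ (sub h)

        deeper : ∀ {v d} → Lst v d arms → Lst v d U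
        deeper = lift (there ∘ there ∘ there)

        arm-vertex : ∀ {u} (arm : Arm a u) → Lst u a U → (∀ {e} → e ∈ armEdges arm → e ∈ arms) → ∀ {d} → d ∈ N u → Lst u d U
        arm-vertex arm la sub {d} d∈ with d Finₚ.≟ a
        ... | yes refl = la
        ... | no d≢a = deeper (lift sub (arm-listed arm d∈ d≢a))

        listed : ∀ {r v} → r ∈ tripodVertices → v ∈ N r → Lst r v U
        listed 1st v∈ = by (cova v∈)
          where
          by : ∀ {v} → v ∈ u₁ ∷ u₂ ∷ u₃ ∷ [] → Lst a v U
          by 1st = inj₁ 1st
          by 2nd = inj₁ 2nd
          by 3rd = inj₁ 3rd
        listed 2nd v∈ = arm-vertex arm₁ (inj₂ 1st) sub₁ v∈
        listed 3rd v∈ = arm-vertex arm₂ (inj₂ 2nd) sub₂ v∈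
        listed (there 3rd) v∈ = arm-vertex arm₃ (inj₂ 3rd) sub₃ v∈
        listed (there (there (there (there h)))) v∈ = deeper ([ (λ h₁ → lift sub₁ (leaves-listed arm₁ h₁ v∈))
          , (λ h₂₃ → [ (λ h₂ → lift sub₂ (leaves-listed arm₂ h₂ v∈)) , (λ h₃ → lift sub₃ (leaves-listed arm₃ h₃ v∈)) ]′
              (split (armLeaves arm₂) h₂₃)) ]′ (split (armLeaves arm₁) h))
          where
          split : ∀ (xs : List Vertex) {ys z} → z ∈ xs ++ ys → z ∈ xs ⊎ z ∈ ys
          split xs = ∈-++⁻ xs

        -- The inner end of an arm is not the centre, and it is not a neighbour of the centre
        -- either, for lack of triangles. So the colours that `x` avoids survive while the star is
        -- being coloured.
        far-kept : ∀ {u v} (arm : Arm a u) → u ∈ N a → v ∈ N a → ¬ Same G 4 A a v (innerEnd arm) (outerEnd arm)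
        far-kept arm u∈ v∈ (inj₁ (e , _)) = proj₁ (inner-joined arm) (sym e)
        far-kept arm u∈ v∈ (inj₂ (refl , _)) =
          triangle-free (joined u∈) (proj₂ (inner-joined arm)) (Adj-sym G (joined v∈))

        centre-end : ∀ {v V f x} (arm : Arm a v) → (∀ {e} → e ∈ armEdges arm → e ∈ V) → End V v a f x
        centre-end arm sub = end λ d∈ d≢a l → ⊥-elim (l (lift sub (arm-listed arm d∈ d≢a)))

      remove-star : Removable tripodVertices
      remove-star K = proj₁ finished₃
        where
        K₀ : Colouring G 4 A U
        K₀ = restore G 4 {A = A} {R = tripodVertices} {U = U} listed K
        far : ∀ {u V} → Arm a u → Colouring G 4 A V → Fin 4
        far arm K = col K (innerEnd arm) (outerEnd arm)
        -- Three forbidden colours out of four: all other edges seen from the star are still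
        -- uncoloured, and two edges at `a` would conflict only in a triangle.
        fresh = fresh-colour (far arm₁ K₀ ∷ far arm₂ K₀ ∷ far arm₃ K₀ ∷ []) ≤-refl
        x = proj₁ fresh
        x∉ = proj₂ fresh
        step₁ = recolour G 4 A K₀ x
          (arm-near arm₁ {f = col K₀} (there ∘ there ∘ there ∘ sub₁) (λ e → x∉ (here (sym e))))
          (near-two {f = col K₀} cova (centre-end arm₂ (there ∘ there ∘ there ∘ sub₂)) (centre-end arm₃ (there ∘ there ∘ there ∘ sub₃)))
        K₁ = proj₁ step₁
        step₂ = recolour G 4 A K₁ x
          (arm-near arm₂ {f = col K₁} (there ∘ there ∘ sub₂) (λ e → x∉ (there (here (sym (trans (sym (proj₂ (proj₂ step₁) (far-kept arm₂ u₂∈ u₁∈))) e))))))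
          (near-two {f = col K₁} (swap₁₂ ∘ cova) (centre-end arm₁ (there ∘ there ∘ sub₁)) (centre-end arm₃ (there ∘ there ∘ sub₃)))
        K₂ = proj₁ step₂
        step₃ = recolour G 4 A K₂ x
          (arm-near arm₃ {f = col K₂} (there ∘ sub₃) (λ e → x∉ (there (there (here (sym
            (trans (sym (trans (proj₂ (proj₂ step₂) (far-kept arm₃ u₃∈ u₂∈)) (proj₂ (proj₂ step₁) (far-kept arm₃ u₃∈ u₁∈)))) e)))))))
          (near-two {f = col K₂} (rotate ∘ rotate ∘ cova) (centre-end arm₁ (there ∘ sub₁)) (centre-end arm₂ (there ∘ sub₂)))
        K₃ = proj₁ step₃
        persist : ∀ {u v V W} (K : Colouring G 4 A V) (K′ : Colouring G 4 A W) → u ∈ N a → col K′ a v ≡ x →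
          (∀ {c d} → ¬ Same G 4 A a v c d → col K′ c d ≡ col K c d) → col K a u ≡ x → col K′ a u ≡ x
        persist {u} {v} K K′ u∈ new same old with same? G 4 A a v a u
        ... | no ¬s = trans (same ¬s) old
        ... | yes (inj₁ (_ , refl)) = new
        ... | yes (inj₂ (_ , refl)) = ⊥-elim (loopless G (joined u∈))
        star : ∀ {d} → d ∈ N a → col K₃ a d ≡ x
        star d∈ = by (cova d∈)
          where
          by : ∀ {d} → d ∈ u₁ ∷ u₂ ∷ u₃ ∷ [] → col K₃ a d ≡ x
          by 1st = persist K₂ K₃ u₁∈ (proj₁ (proj₂ step₃)) (proj₂ (proj₂ step₃))
            (persist K₁ K₂ u₁∈ (proj₁ (proj₂ step₂)) (proj₂ (proj₂ step₂)) (proj₁ (proj₂ step₁)))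
          by 2nd = persist K₂ K₃ u₂∈ (proj₁ (proj₂ step₃)) (proj₂ (proj₂ step₃)) (proj₁ (proj₂ step₂))
          by 3rd = proj₁ (proj₂ step₃)
        finished₁ = complete-arm arm₁ (alive u₁∈) (joined u₁∈) {U = armEdges arm₂ ++ armEdges arm₃ ++ []} {x} K₃ star
        finished₂ = complete-arm arm₂ (alive u₂∈) (joined u₂∈) {U = armEdges arm₃ ++ []} {x} (proj₁ finished₁) (proj₂ finished₁)
        finished₃ = complete-arm arm₃ (alive u₃∈) (joined u₃∈) {U = []} {x} (proj₁ finished₂) (proj₂ finished₂)

-- Induction over vertex sets, and the cases of five, six and seven colours.

module Reduction where

  open Drawing using (PlaneArcs)
  open Above using (true-does)
  open Induced
  open Orbits using (unique-⊆-length)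
  open Euler using (TwoOrThree)
  open Discharge
  open Colour
  open Reduce
  open LeafyPaths
  open Stars
  open import Data.Bool.Base using (Bool; true; false; T; if_then_else_; not)
  open import Data.Bool.Properties using (T?; T-∧)
  open import Data.Empty using (⊥-elim)
  open import Data.Fin.Base as Fin using (Fin)
  import Data.Fin.Properties as Finₚ
  open import Data.List.Base using (List; []; _∷_; length; filter; allFin)
  open import Data.List.Membership.Propositional using (_∈_; _∉_)
  open import Data.List.Membership.Propositional.Properties using (∈-filter⁺; ∈-filter⁻; ∈-allFin)
  import Data.List.Relation.Unary.All as All
  import Data.List.Relation.Unary.AllPairs as AllPairs
  open import Data.List.Relation.Unary.Any as Any using (there)
  open import Data.List.Relation.Unary.Unique.Propositional using (Unique)
  import Data.List.Relation.Unary.Unique.Propositional.Properties as Uniqueₚ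
  open import Data.Nat.Base
  open import Data.Nat.Induction using (<-wellFounded)
  open import Data.Nat.Properties
  open import Data.Product.Base using (_×_; _,_; proj₁; proj₂; ∃-syntax)
  open import Data.Sum.Base using (_⊎_; inj₁; inj₂)
  open import Function.Base using (_∘_; id)
  open import Function.Bundles using (Equivalence)
  open import Induction.WellFounded using (Acc; acc)
  open import Relation.Binary.PropositionalEquality
  open import Relation.Nullary using (yes; no; contradiction; _×-dec_)

  module _ (G : Graph) (k : ℕ) where
    open Graph G

    private
      V = allFin order

    -- At least one vertex of `R` has to belong to `A`, so that the induction on the number of
    -- vertices makes progress.
    Reducible : (Vertex → Bool) → Set
    Reducible A = ∃[ R ] ((∃[ r ] (r ∈ R × T (A r))) × (Colourable G k (_∖_ G k A R) → Colourable G k A))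

    private
      members : (Vertex → Bool) → List Vertex
      members A = filter (λ v → T? (A v)) V

      ∈-members : ∀ {A v} → T (A v) → v ∈ members A
      ∈-members {A} {v} = ∈-filter⁺ (λ v → T? (A v)) (∈-allFin v)

      members-∈ : ∀ {A v} → v ∈ members A → T (A v)
      members-∈ {A} h = proj₂ (∈-filter⁻ (λ v → T? (A v)) {xs = V} h)

      ∖-⊆ : ∀ {A R v} → T (_∖_ G k A R v) → T (A v)
      ∖-⊆ h = proj₁ (Equivalence.to T-∧ h)

      ∖-fresh : ∀ {A R v} → T (_∖_ G k A R v) → v ∉ R
      ∖-fresh {A} {R} {v} h v∈ with Any.any? (v Finₚ.≟_) R
      ... | yes _ = proj₂ (Equivalence.to (T-∧ {A v}) h)
      ... | no v∉ = v∉ v∈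

      shrinks : ∀ {A R r} → r ∈ R → T (A r) → length (members (_∖_ G k A R)) < length (members A)
      shrinks {A} {R} {r} r∈ ar = unique-⊆-length {xs = r ∷ members (_∖_ G k A R)}
        (All.tabulate (λ { {v} h refl → ∖-fresh {A} {R} {v} (members-∈ {_∖_ G k A R} h) r∈ }) AllPairs.∷ Uniqueₚ.filter⁺ _ (Uniqueₚ.allFin⁺ order))
        λ { 1st → ∈-members {A} ar ; (there {x = _} {xs = _} h) → ∈-members {A} (∖-⊆ {A} {R} (members-∈ {_∖_ G k A R} h)) }

    colour-all : Fin k → (∀ A → ∃[ v ] T (A v) → Reducible A) → ∀ A → Colourable G k A
    colour-all x₀ reduce A = go A (<-wellFounded (length (members A)))
      where
      go : ∀ A → Acc _<_ (length (members A)) → Colourable G k A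
      go A (acc rec) with Finₚ.any? (λ v → T? (A v))
      -- Without vertices the colouring is vacuous, but its function still needs a value.
      ... | no empty = record { col = λ _ _ → x₀ ; col-sym = λ _ _ → refl
                              ; valid = λ _ _ _ (a , _) _ _ _ → ⊥-elim (empty (_ , a)) }
      ... | yes nonempty with reduce A nonempty
      ... | R , (r , r∈ , ar) , extend = extend (go (_∖_ G k A R) (rec (shrinks {A} {R} r∈ ar)))

    everything : Vertex → Bool
    everything _ = true

    -- A conflict in `valid` asks only for `a ≢ c` and `b ≢ d`, so it covers paths of length three
    -- and triangles at once.
    colorable : Colourable G k everything → InjectivelyEdgeColorable G k
    colorable K = (λ e → col K (src e) (tgt e)) , proper
      where
      joined-col : ∀ e {u v} → Joins e u v → col K (src e) (tgt e) ≡ col K u v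
      joined-col e (inj₁ (refl , refl)) = refl
      joined-col e (inj₂ (refl , refl)) = col-sym K _ _
      joins-Adj : ∀ e {u v} → Joins e u v → Adj u v
      joins-Adj e (inj₁ (refl , refl)) = adjacent e
      joins-Adj e (inj₂ (refl , refl)) = Adj-sym G (adjacent e)
      differ : ∀ e₁ e₂ e₃ {a b c d} → Joins e₁ a b → Joins e₂ b c → Joins e₃ c d → a ≢ c → b ≢ d →
        col K (src e₁) (tgt e₁) ≢ col K (src e₃) (tgt e₃)
      differ e₁ e₂ e₃ j₁ j₂ j₃ a≢c b≢d e = valid K (joins-Adj e₂ j₂) a≢c b≢d
        (_ , _ , joins-Adj e₁ j₁) (λ { (inj₁ ()) ; (inj₂ ()) }) (_ , _ , joins-Adj e₃ j₃) (λ { (inj₁ ()) ; (inj₂ ()) })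
        (trans (sym (joined-col e₁ j₁)) (trans e (joined-col e₃ j₃)))
      proper : IsInjectiveEdgeColoring G (λ e → col K (src e) (tgt e))
      proper e₁ e₂ e₃ (a , b , c , d , j₁ , j₂ , j₃ , inj₁ ((_ All.∷ a≢c All.∷ _) AllPairs.∷ (_ All.∷ b≢d All.∷ _) AllPairs.∷ _)) =
        differ e₁ e₂ e₃ j₁ j₂ j₃ a≢c b≢d
      proper e₁ e₂ e₃ (a , b , c , d , j₁ , j₂ , j₃ , inj₂ (((a≢b All.∷ a≢c All.∷ _) AllPairs.∷ _) , refl)) =
        differ e₁ e₂ e₃ j₁ j₂ j₃ a≢c (a≢b ∘ sym)

  module _ (G : Graph) (subcubic : Subcubic G) where
    open Graph G

    at-most-three : ∀ A v → length (nbrs G A v) ≤ 3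
    at-most-three A v = ≤-trans (unique-⊆-length (nbrs-unique G A v)
      (λ {u} h → ∈-filter⁺ (λ u → T? (adj v u)) (∈-allFin u) (proj₂ (∈-nbrs⁻ G A h)))) (subcubic v)

    two-or-three : ∀ A v → 2 ≤ length (nbrs G A v) → TwoOrThree (nbrs G A v)
    two-or-three A v = shape (nbrs G A v) (at-most-three A v)
      where
      shape : ∀ (N : List Vertex) → length N ≤ 3 → 2 ≤ length N → TwoOrThree N
      shape (a ∷ c ∷ []) _ _ = inj₁ (a , c , refl)
      shape (a ∷ c ∷ d ∷ []) _ _ = inj₂ (a , c , d , refl)
      shape (_ ∷ []) _ (s≤s ())
      shape (_ ∷ _ ∷ _ ∷ _ ∷ _) (s≤s (s≤s (s≤s ()))) _

    module _ (C : Vertex → Bool) where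
      private
        N = nbrs G C

      two⇒deg : ∀ {v} → two G C v ≡ true → deg G C v ≡ 2
      two⇒deg {v} = true-does (deg G C v ≟ 2)

      other : ∀ {x u} → deg G C x ≡ 2 → u ∈ N x → ∃[ y ] (y ∈ N x × (∀ {z} → z ∈ N x → z ∈ u ∷ y ∷ []) × u ≢ y)
      other {x} {u} e u∈ = by (N x) e u∈ (nbrs-unique G C x)
        where
        by : ∀ (L : List Vertex) → length L ≡ 2 → u ∈ L → Unique L → ∃[ y ] (y ∈ L × (∀ {z} → z ∈ L → z ∈ u ∷ y ∷ []) × u ≢ y)
        by (_ ∷ y ∷ []) _ 1st ((u≢y All.∷ _) AllPairs.∷ _) = y , 2nd , id , u≢y
        by (y ∷ _ ∷ []) _ 2nd ((y≢u All.∷ _) AllPairs.∷ _) = y , 1st , swap₂ , y≢u ∘ sym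

      three-list : ∀ {u} → deg G C u ≡ 3 → ∃[ a ] ∃[ c ] ∃[ d ] N u ≡ a ∷ c ∷ d ∷ []
      three-list {u} e = by (N u) e
        where
        by : ∀ (L : List Vertex) → length L ≡ 3 → ∃[ a ] ∃[ c ] ∃[ d ] L ≡ a ∷ c ∷ d ∷ []
        by (a ∷ c ∷ d ∷ []) _ = a , c , d , refl

      not-three-two : ∀ {u} → deg G C u ≡ 3 → two G C u ≡ false
      not-three-two {u} e with two G C u in eq
      ... | false = refl
      ... | true = contradiction (trans (sym e) (two⇒deg eq)) λ ()

      -- A neighbour x of the 3-vertex u: not a 2-vertex, or a 2-vertex on a
      -- thread of length one, or a 2-vertex on a longer thread.
      data Kind (u x : Vertex) : Set where
        big   : demand G C x ≡ 0 → Kind u x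
        short : ∀ {y} → deg G C x ≡ 2 → y ∈ N x → (∀ {z} → z ∈ N x → z ∈ u ∷ y ∷ []) → u ≢ y →
                demand G C x ≡ 1 → Kind u x
        long  : ∀ {y} → deg G C x ≡ 2 → y ∈ N x → (∀ {z} → z ∈ N x → z ∈ u ∷ y ∷ []) → u ≢ y →
                deg G C y ≡ 2 → demand G C x ≡ 2 → Kind u x

      kind : ∀ {u x} → T (C u) → deg G C u ≡ 3 → x ∈ N u → Kind u x
      kind {u} {x} cu du x∈ = by (two G C x) refl
        where
        u∈ : u ∈ N x
        u∈ = ∈-nbrs⁺ G C cu (Adj-sym G (proj₂ (∈-nbrs⁻ G C x∈)))
        by : ∀ b → two G C x ≡ b → Kind u x
        by false e = big (cong (λ b → if b then 1 + twoNbrs G C x else 0) e)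
        by true e = go (other (two⇒deg e) u∈)
          where
          weight : Vertex → ℕ
          weight z = if two G C z then 1 else 0
          count : ∀ {y} → u ≢ y → y ∈ N x → (∀ {z} → z ∈ N x → z ∈ u ∷ y ∷ []) → twoNbrs G C x ≡ weight y
          count {y} u≢y y∈ cov = shape (N x) (two⇒deg e) u∈ y∈ cov
            where
            big-u : weight u ≡ 0
            big-u = cong (λ b → if b then 1 else 0) (not-three-two du)
            shape : ∀ (L : List Vertex) → length L ≡ 2 → u ∈ L → y ∈ L → (∀ {z} → z ∈ L → z ∈ u ∷ y ∷ []) →
              Euler.ℕ∑.∑ L weight ≡ weight y
            shape (_ ∷ _ ∷ []) _ 1st 1st _ = ⊥-elim (u≢y refl)
            shape (_ ∷ _ ∷ []) _ 1st 2nd _ = trans (cong (_+ (weight y + 0)) big-u) (+-identityʳ _)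
            shape (_ ∷ _ ∷ []) _ 2nd 1st _ = trans (cong (λ n → weight y + (n + 0)) big-u) (+-identityʳ _)
            shape (_ ∷ _ ∷ []) _ 2nd 2nd _ = ⊥-elim (u≢y refl)
          go : ∃[ y ] (y ∈ N x × (∀ {z} → z ∈ N x → z ∈ u ∷ y ∷ []) × u ≢ y) → Kind u x
          go (y , y∈ , cov , u≢y) = last (two G C y) refl
            where
            total : ∀ {n} → weight y ≡ n → demand G C x ≡ suc n
            total h = trans (cong (λ b → if b then 1 + twoNbrs G C x else 0) e) (cong suc (trans (count u≢y y∈ cov) h))
            last : ∀ b → two G C y ≡ b → Kind u x
            last false h = short (two⇒deg e) y∈ cov u≢y (total (cong (λ b → if b then 1 else 0) h))
            last true h = long (two⇒deg e) y∈ cov u≢y (two⇒deg h) (total (cong (λ b → if b then 1 else 0) h))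

      both-two : ∀ {v} → deg G C v ≡ 2 → 2 ≤ twoNbrs G C v →
        ∃[ a ] ∃[ c ] (a ∈ N v × c ∈ N v × (∀ {z} → z ∈ N v → z ∈ a ∷ c ∷ []) × a ≢ c × deg G C a ≡ 2 × deg G C c ≡ 2)
      both-two {v} e h = by (N v) e h (nbrs-unique G C v)
        where
        by : ∀ (L : List Vertex) → length L ≡ 2 → 2 ≤ Euler.ℕ∑.∑ L (λ u → if two G C u then 1 else 0) → Unique L →
          ∃[ a ] ∃[ c ] (a ∈ L × c ∈ L × (∀ {z} → z ∈ L → z ∈ a ∷ c ∷ []) × a ≢ c × deg G C a ≡ 2 × deg G C c ≡ 2)
        by (a ∷ c ∷ []) _ h ((a≢c All.∷ _) AllPairs.∷ _) with two G C a in p | two G C c in q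
        ... | true | true = a , c , 1st , 2nd , id , a≢c , two⇒deg p , two⇒deg q
        by (a ∷ c ∷ []) _ (s≤s ()) _ | true | false
        by (a ∷ c ∷ []) _ (s≤s ()) _ | false | true
        by (a ∷ c ∷ []) _ () _ | false | false

      overload : ∀ {u a c d s} → N u ≡ a ∷ c ∷ d ∷ [] → s < load G C u → ∀ {p q r} →
        demand G C a ≡ p → demand G C c ≡ q → demand G C d ≡ r → s < p + (q + r)
      overload {s = s} eq h refl refl refl = ≤-trans h (≤-reflexive (trans (cong (λ L → Euler.ℕ∑.∑ L (demand G C)) eq)
        (cong (λ n → demand G C _ + (demand G C _ + n)) (+-identityʳ _))))

  module _ {G : Graph} (subcubic : Subcubic G) (PA : PlaneArcs G) where
    open Graph G

    module _ {k : ℕ} (4<k : 4 < k) (A : Vertex → Bool) where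
      private
        N = nbrs G A

      delete-low : ∀ v → T (A v) → length (N v) ≤ 1 → Reducible G k A
      delete-low v av le = v ∷ [] , (v , 1st , av) , by (N v) refl le
        where
        by : ∀ L → N v ≡ L → length L ≤ 1 → Colourable G k (_∖_ G k A (v ∷ [])) → Colourable G k A
        by [] e _ = remove-isolated G k A (at-most-three G subcubic A) (λ {c} h → subst (c ∈_) e h)
        by (u ∷ []) e _ = remove-leaf G k A (at-most-three G subcubic A) av (subst (u ∈_) (sym e) 1st) (λ {c} h → subst (c ∈_) e h) 4<k
        by (_ ∷ _ ∷ _) _ (s≤s ())

      -- A pendant edge sees at most four edges, so with five colours vertices of degree at most one
      -- can always be deleted, and the discharging takes place in `A` itself.
      low-or-core : Reducible G k A ⊎ (∀ v → T (A v) → TwoOrThree (N v))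
      low-or-core with Finₚ.any? (λ v → T? (A v) ×-dec (length (N v) ≤? 1))
      ... | yes (v , av , le) = inj₁ (delete-low v av le)
      ... | no none = inj₂ λ v av → two-or-three G subcubic A v (≰⇒> λ le → none (v , av , le))

    private
      ∈-cons : ∀ {A v} {L : List Vertex} → nbrs G A v ≡ L → ∀ {x} → x ∈ L → x ∈ nbrs G A v
      ∈-cons e = subst (_ ∈_) (sym e)

      absurd : ∀ {P : Set} {m n} → m < n → n ≤ m → P
      absurd lt le = ⊥-elim (<-irrefl refl (<-≤-trans lt le))

    module _ (A : Vertex → Bool) where
      private
        N = nbrs G A
        cubic = at-most-three G subcubic A

      -- For `s = 0` either outcome of the discharging exhibits a 2-vertex, and seven colours can
      -- handle any 2-vertex.
      reduce-seven : (∀ c → IsCycle c → 6 ≤ length c) → ∃[ v ] T (A v) → Reducible G 7 A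
      reduce-seven girth (r , ar) with low-or-core (s≤s (s≤s (s≤s (s≤s (s≤s z≤n))))) A
      ... | inj₁ red = red
      ... | inj₂ degrees with configuration PA A degrees ar 0 girth
      ... | inj₁ (v , av , dv , _) = delete-two v av dv
        where
        delete-two : ∀ v → T (A v) → deg G A v ≡ 2 → Reducible G 7 A
        delete-two v av e = by (N v) refl e
          where
          by : ∀ L → N v ≡ L → length L ≡ 2 → Reducible G 7 A
          by (a ∷ b ∷ []) e _ = v ∷ [] , (v , 1st , av) ,
            remove-two G 7 A cubic av (∈-cons e 1st) (∈-cons e 2nd) (λ {c} h → subst (c ∈_) e h) ≤-refl
      ... | inj₂ (u , au , du , load>) with three-list G subcubic A du
      ... | a , c , d , e = by (kind G subcubic A au du (∈-cons e 1st)) (kind G subcubic A au du (∈-cons e 2nd)) (kind G subcubic A au du (∈-cons e 3rd))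
        where
        delete : ∀ {x y} → x ∈ N u → y ∈ N x → (∀ {z} → z ∈ N x → z ∈ u ∷ y ∷ []) → Reducible G 7 A
        delete {x} x∈ y∈ cov = let ax = proj₁ (∈-nbrs⁻ G A x∈) in x ∷ [] , (x , 1st , ax) ,
          remove-two G 7 A cubic ax (∈-nbrs⁺ G A au (Adj-sym G (proj₂ (∈-nbrs⁻ G A x∈)))) y∈ cov ≤-refl
        by : Kind G subcubic A u a → Kind G subcubic A u c → Kind G subcubic A u d → Reducible G 7 A
        by (short _ y∈ cov _ _) _ _ = delete (∈-cons e 1st) y∈ cov
        by (long _ y∈ cov _ _ _) _ _ = delete (∈-cons e 1st) y∈ cov
        by _ (short _ y∈ cov _ _) _ = delete (∈-cons e 2nd) y∈ cov
        by _ (long _ y∈ cov _ _ _) _ = delete (∈-cons e 2nd) y∈ cov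
        by _ _ (short _ y∈ cov _ _) = delete (∈-cons e 3rd) y∈ cov
        by _ _ (long _ y∈ cov _ _ _) = delete (∈-cons e 3rd) y∈ cov
        by (big p) (big q) (big r) = absurd (overload G subcubic A e load> p q r) z≤n

      -- For `s = 1` a load of two or more comes either from a neighbour on a longer thread, which
      -- has a 2-neighbour itself, or from two neighbours on threads of length one.
      reduce-six : (∀ c → IsCycle c → 8 ≤ length c) → ∃[ v ] T (A v) → Reducible G 6 A
      reduce-six girth (r , ar) with low-or-core (s≤s (s≤s (s≤s (s≤s (s≤s z≤n))))) A
      ... | inj₁ red = red
      ... | inj₂ degrees with configuration PA A degrees ar 1 girth
      ... | inj₁ (v , av , dv , h) with both-two G subcubic A dv h
      ... | a , c , a∈ , c∈ , cov , _ , _ , dc with other G subcubic A dc (∈-nbrs⁺ G A av (Adj-sym G (proj₂ (∈-nbrs⁻ G A c∈))))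
      ... | y , y∈ , covc , _ = v ∷ [] , (v , 1st , av) , remove-two-beside-two G 6 A cubic av a∈ c∈ cov y∈ covc ≤-refl
      reduce-six girth (r , ar) | inj₂ degrees | inj₂ (u , au , du , load>) with three-list G subcubic A du
      ... | a , c , d , e = by (kind G subcubic A au du (∈-cons e 1st)) (kind G subcubic A au du (∈-cons e 2nd)) (kind G subcubic A au du (∈-cons e 3rd))
        where
        back : ∀ {x} → x ∈ N u → u ∈ N x
        back x∈ = ∈-nbrs⁺ G A au (Adj-sym G (proj₂ (∈-nbrs⁻ G A x∈)))
        alive : ∀ {x v} → x ∈ N v → T (A x)
        alive x∈ = proj₁ (∈-nbrs⁻ G A x∈)
        thread : ∀ {x y} → x ∈ N u → y ∈ N x → (∀ {z} → z ∈ N x → z ∈ u ∷ y ∷ []) → deg G A y ≡ 2 → Reducible G 6 A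
        thread {x} {y} x∈ y∈ cov dy =
          let (z , z∈ , covy , _) = other G subcubic A dy (∈-nbrs⁺ G A (alive x∈) (Adj-sym G (proj₂ (∈-nbrs⁻ G A y∈))))
          in x ∷ [] , (x , 1st , alive x∈) , remove-two-beside-two G 6 A cubic (alive x∈) (back x∈) y∈ cov z∈ covy ≤-refl
        pair : ∀ {v w z b c} → v ∈ N u → w ∈ N u → z ∈ N u → (∀ {t} → t ∈ N u → t ∈ v ∷ w ∷ z ∷ []) →
          b ∈ N v → (∀ {t} → t ∈ N v → t ∈ u ∷ b ∷ []) → c ∈ N w → (∀ {t} → t ∈ N w → t ∈ u ∷ c ∷ []) → Reducible G 6 A
        pair {v} {w} v∈ w∈ z∈ cov b∈ covv c∈ covw = v ∷ w ∷ [] , (v , 1st , alive v∈) ,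
          remove-two-twos G 6 A cubic au v∈ w∈ z∈ cov b∈ covv c∈ covw ≤-refl
        cov : ∀ {t} → t ∈ N u → t ∈ a ∷ c ∷ d ∷ []
        cov {t} = subst (t ∈_) e
        by : Kind G subcubic A u a → Kind G subcubic A u c → Kind G subcubic A u d → Reducible G 6 A
        by (long _ y∈ covx _ dy _) _ _ = thread (∈-cons e 1st) y∈ covx dy
        by _ (long _ y∈ covx _ dy _) _ = thread (∈-cons e 2nd) y∈ covx dy
        by _ _ (long _ y∈ covx _ dy _) = thread (∈-cons e 3rd) y∈ covx dy
        by (short _ b∈ covv _ _) (short _ c∈ covw _ _) _ = pair (∈-cons e 1st) (∈-cons e 2nd) (∈-cons e 3rd) cov b∈ covv c∈ covw
        by (short _ b∈ covv _ _) _ (short _ c∈ covw _ _) = pair (∈-cons e 1st) (∈-cons e 3rd) (∈-cons e 2nd) (swap₁₂ ∘ rotate ∘ rotate ∘ cov) b∈ covv c∈ covw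
        by _ (short _ b∈ covv _ _) (short _ c∈ covw _ _) = pair (∈-cons e 2nd) (∈-cons e 3rd) (∈-cons e 1st) (rotate ∘ cov) b∈ covv c∈ covw
        by (big p) (big q) (big r) = absurd (overload G subcubic A e load> p q r) z≤n
        by (short _ _ _ _ p) (big q) (big r) = absurd (overload G subcubic A e load> p q r) ≤-refl
        by (big p) (short _ _ _ _ q) (big r) = absurd (overload G subcubic A e load> p q r) ≤-refl
        by (big p) (big q) (short _ _ _ _ r) = absurd (overload G subcubic A e load> p q r) ≤-refl

      -- For `s = 2` a single long thread gives only two units. A load of three or more has a long
      -- thread beside another 2-neighbour, or three threads of length one.
      reduce-five : (∀ c → IsCycle c → 10 ≤ length c) → ∃[ v ] T (A v) → Reducible G 5 A
      reduce-five girth (r , ar) with low-or-core (s≤s (s≤s (s≤s (s≤s (s≤s z≤n))))) A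
      ... | inj₁ red = red
      ... | inj₂ degrees with configuration PA A degrees ar 2 girth
      ... | inj₁ (v , av , dv , h) with both-two G subcubic A dv h
      ... | a , c , a∈ , c∈ , cov , _ , da , dc
        with other G subcubic A da (∈-nbrs⁺ G A av (Adj-sym G (proj₂ (∈-nbrs⁻ G A a∈)))) | other G subcubic A dc (∈-nbrs⁺ G A av (Adj-sym G (proj₂ (∈-nbrs⁻ G A c∈))))
      ... | x , x∈ , cova , _ | y , y∈ , covc , _ =
        v ∷ [] , (v , 1st , av) , remove-middle G 5 A cubic av a∈ c∈ cov x∈ y∈ cova covc (s≤s (s≤s (s≤s (s≤s z≤n))))
      reduce-five girth (r , ar) | inj₂ degrees | inj₂ (u , au , du , load>) with three-list G subcubic A du
      ... | a , c , d , e = by (kind G subcubic A au du (∈-cons e 1st)) (kind G subcubic A au du (∈-cons e 2nd)) (kind G subcubic A au du (∈-cons e 3rd))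
        where
        alive : ∀ {x v} → x ∈ N v → T (A x)
        alive x∈ = proj₁ (∈-nbrs⁻ G A x∈)
        cov : ∀ {t} → t ∈ N u → t ∈ a ∷ c ∷ d ∷ []
        cov {t} = subst (t ∈_) e
        thread : ∀ {v w z y y′} → v ∈ N u → w ∈ N u → z ∈ N u → (∀ {t} → t ∈ N u → t ∈ v ∷ w ∷ z ∷ []) →
          y ∈ N v → (∀ {t} → t ∈ N v → t ∈ u ∷ y ∷ []) → deg G A y ≡ 2 → (∀ {t} → t ∈ N w → t ∈ u ∷ y′ ∷ []) → Reducible G 5 A
        thread {v} {y = y} v∈ w∈ z∈ cov y∈ covv dy covw =
          let (b , b∈ , covy , _) = other G subcubic A dy (∈-nbrs⁺ G A (alive v∈) (Adj-sym G (proj₂ (∈-nbrs⁻ G A y∈))))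
          in v ∷ y ∷ [] , (v , 1st , alive v∈) ,
            remove-thread-beside-two G 5 A cubic au v∈ w∈ z∈ cov y∈ covv b∈ covy covw ≤-refl
        cov₁₃ : ∀ {t} → t ∈ N u → t ∈ a ∷ d ∷ c ∷ []
        cov₁₃ = swap₁₂ ∘ rotate ∘ rotate ∘ cov
        by : Kind G subcubic A u a → Kind G subcubic A u c → Kind G subcubic A u d → Reducible G 5 A
        by (long _ y∈ covv _ dy _) (short _ _ covw _ _) _ = thread (∈-cons e 1st) (∈-cons e 2nd) (∈-cons e 3rd) cov y∈ covv dy covw
        by (long _ y∈ covv _ dy _) (long _ _ covw _ _ _) _ = thread (∈-cons e 1st) (∈-cons e 2nd) (∈-cons e 3rd) cov y∈ covv dy covw
        by (long _ y∈ covv _ dy _) _ (short _ _ covw _ _) = thread (∈-cons e 1st) (∈-cons e 3rd) (∈-cons e 2nd) cov₁₃ y∈ covv dy covw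
        by (long _ y∈ covv _ dy _) _ (long _ _ covw _ _ _) = thread (∈-cons e 1st) (∈-cons e 3rd) (∈-cons e 2nd) cov₁₃ y∈ covv dy covw
        by (short _ _ covw _ _) (long _ y∈ covv _ dy _) _ = thread (∈-cons e 2nd) (∈-cons e 1st) (∈-cons e 3rd) (swap₁₂ ∘ cov) y∈ covv dy covw
        by _ (long _ y∈ covv _ dy _) (short _ _ covw _ _) = thread (∈-cons e 2nd) (∈-cons e 3rd) (∈-cons e 1st) (rotate ∘ cov) y∈ covv dy covw
        by _ (long _ y∈ covv _ dy _) (long _ _ covw _ _ _) = thread (∈-cons e 2nd) (∈-cons e 3rd) (∈-cons e 1st) (rotate ∘ cov) y∈ covv dy covw
        by (short _ _ covw _ _) _ (long _ y∈ covv _ dy _) = thread (∈-cons e 3rd) (∈-cons e 1st) (∈-cons e 2nd) (rotate ∘ rotate ∘ cov) y∈ covv dy covw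
        by _ (short _ _ covw _ _) (long _ y∈ covv _ dy _) = thread (∈-cons e 3rd) (∈-cons e 2nd) (∈-cons e 1st) (swap₁₂ ∘ rotate ∘ cov) y∈ covv dy covw
        by (short _ p∈ covp _ _) (short _ q∈ covq _ _) (short _ r∈ covr _ _) = u ∷ [] , (u , 1st , au) ,
          remove-centre G 5 A cubic au (∈-cons e 1st) (∈-cons e 2nd) (∈-cons e 3rd) cov p∈ covp q∈ covq r∈ covr ≤-refl
        by (big p) (big q) (big r) = absurd (overload G subcubic A e load> p q r) z≤n
        by (short _ _ _ _ p) (big q) (big r) = absurd (overload G subcubic A e load> p q r) (s≤s z≤n)
        by (big p) (short _ _ _ _ q) (big r) = absurd (overload G subcubic A e load> p q r) (s≤s z≤n)
        by (big p) (big q) (short _ _ _ _ r) = absurd (overload G subcubic A e load> p q r) (s≤s z≤n)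
        by (short _ _ _ _ p) (short _ _ _ _ q) (big r) = absurd (overload G subcubic A e load> p q r) ≤-refl
        by (short _ _ _ _ p) (big q) (short _ _ _ _ r) = absurd (overload G subcubic A e load> p q r) ≤-refl
        by (big p) (short _ _ _ _ q) (short _ _ _ _ r) = absurd (overload G subcubic A e load> p q r) ≤-refl
        by (long _ _ _ _ _ p) (big q) (big r) = absurd (overload G subcubic A e load> p q r) ≤-refl
        by (big p) (long _ _ _ _ _ q) (big r) = absurd (overload G subcubic A e load> p q r) ≤-refl
        by (big p) (big q) (long _ _ _ _ _ r) = absurd (overload G subcubic A e load> p q r) ≤-refl

-- Four colours: discharging on the graph without its leaves.

module Four where

  open Reduction
  open Drawing using (PlaneArcs)
  open Induced
  open Walks using (loopless)
  open Orbits using (unique-⊆-length)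
  open Euler using (TwoOrThree)
  open Discharge
  open Colour
  open Reduce
  open LeafyPaths
  open Arms
  open Stars
  open import Data.Bool.Base using (Bool; T; _∧_)
  open import Data.Bool.Properties using (T?; T-∧)
  open import Data.Empty using (⊥-elim)
  import Data.Fin.Properties as Finₚ
  open import Data.List.Base using (List; []; _∷_; length)
  open import Data.List.Membership.Propositional using (_∈_)
  import Data.List.Relation.Unary.All as All
  import Data.List.Relation.Unary.AllPairs as AllPairs
  open import Data.List.Relation.Unary.Any as Any using (here; there)
  open import Data.Nat.Base
  open import Data.Nat.Properties
  open import Data.Product.Base using (_×_; _,_; proj₁; proj₂; ∃-syntax)
  open import Data.Sum.Base using (_⊎_; inj₁; inj₂; [_,_]′)
  open import Function.Base using (_∘_; id)
  open import Function.Bundles using (Equivalence)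
  open import Relation.Binary.PropositionalEquality
  open import Relation.Nullary using (¬_; Dec; yes; no; _×-dec_; _⊎-dec_; ¬?)

  module _ (G : Graph) (subcubic : Subcubic G) (A : Graph.Vertex G → Bool) where
    open Graph G

    private
      N = nbrs G A
      cubic = at-most-three G subcubic A

      alive : ∀ {u v} → u ∈ N v → T (A u)
      alive h = proj₁ (∈-nbrs⁻ G A h)

      joined : ∀ {u v} → u ∈ N v → Adj v u
      joined h = proj₂ (∈-nbrs⁻ G A h)

      back : ∀ {u v} → T (A v) → u ∈ N v → v ∈ N u
      back av h = ∈-nbrs⁺ G A av (Adj-sym G (joined h))

    -- A leaf whose edge meets at most three coloured edges at distance one.
    Loose : Vertex → Vertex → Set
    Loose v u = length (N v) ≡ 1 × T (A v) × u ∈ N v ×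
      (length (N u) ≤ 2 ⊎ ∃[ c ] (c ∈ N u × c ≢ v × length (N c) ≤ 2))

    loose? : ∀ v u → Dec (Loose v u)
    loose? v u = (length (N v) ≟ 1) ×-dec T? (A v) ×-dec Any.any? (u Finₚ.≟_) (N v) ×-dec
      ((length (N u) ≤? 2) ⊎-dec Finₚ.any? λ c → Any.any? (c Finₚ.≟_) (N u) ×-dec ¬? (c Finₚ.≟ v) ×-dec (length (N c) ≤? 2))

    private
      only : ∀ {v u} → length (N v) ≡ 1 → u ∈ N v → ∀ {z} → z ∈ N v → z ∈ u ∷ []
      only {v} {u} e u∈ {z} = by (N v) e u∈
        where
        by : ∀ L → length L ≡ 1 → u ∈ L → z ∈ L → z ∈ u ∷ []
        by (_ ∷ []) _ 1st 1st = 1st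

    delete-loose : ∀ {v u} → Loose v u → Reducible G 4 A
    delete-loose {v} {u} (e , av , u∈ , slack) = v ∷ [] , (v , 1st , av) ,
      remove-pendant G 4 A cubic {m = 3} (only e u∈) (λ f → near slack f) ≤-refl
      where
      au = alive u∈
      v∈ : v ∈ N u
      v∈ = back av u∈
      widen : ∀ {f P m n} → m ≤ n → Bound G 4 A f P m → Bound G 4 A f P n
      widen le (xs , l , p) = xs , ≤-trans l le , p
      near : (length (N u) ≤ 2 ⊎ ∃[ c ] (c ∈ N u × c ≢ v × length (N c) ≤ 2)) → ∀ {U} f → Bound G 4 A f (Near G 4 A U u v) 3
      near slack {U} f = by (proj₁ split) (proj₁ (proj₂ split)) (proj₁ (proj₂ (proj₂ split))) (proj₂ (proj₂ (proj₂ split))) slack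
        where
        split = ∈-remove v∈
        two-at : ∀ {c} → c ∈ N u → Bound G 4 A f (Beyond G 4 A U c u) 2
        two-at {c} c∈ = at-degree G 4 A f (back au c∈) (cubic c)
        one-at : ∀ {c} → c ∈ N u → length (N c) ≤ 2 → Bound G 4 A f (Beyond G 4 A U c u) 1
        one-at c∈ le = at-degree G 4 A f (back au c∈) le
        by : ∀ ds → suc (length ds) ≡ length (N u) → Covers G 4 A u (v ∷ ds) → (∀ {z} → z ∈ ds → z ∈ N u) →
          (length (N u) ≤ 2 ⊎ ∃[ c ] (c ∈ N u × c ≢ v × length (N c) ≤ 2)) → Bound G 4 A f (Near G 4 A U u v) 3
        by [] _ cov _ _ = widen z≤n (near₀ G 4 A f cov)
        by (c ∷ []) _ cov from _ = widen (s≤s (s≤s z≤n)) (near₁ G 4 A f cov (two-at (from 1st)))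
        by (c ∷ d ∷ []) len cov from (inj₁ le) = ⊥-elim (<-irrefl refl (≤-trans (≤-reflexive len) le))
        by (c ∷ d ∷ []) len cov from (inj₂ (b , b∈ , b≢v , le)) = low (cov b∈) b≢v le
          where
          low : ∀ {b} → b ∈ v ∷ c ∷ d ∷ [] → b ≢ v → length (N b) ≤ 2 → Bound G 4 A f (Near G 4 A U u v) 3
          low 1st b≢v _ = ⊥-elim (b≢v refl)
          low 2nd _ le = near₂ G 4 A f cov (one-at (from 1st) le) (two-at (from 2nd))
          low 3rd _ le = near₂ G 4 A f cov (two-at (from 1st)) (one-at (from 2nd) le)
        by (_ ∷ _ ∷ _ ∷ _) len _ _ _ = ⊥-elim (<-irrefl refl (≤-trans (s≤s (s≤s (s≤s (s≤s z≤n)))) (≤-trans (≤-reflexive len) (cubic u))))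

    -- Leaves are cut off only once. When no leaf is loose this creates no new ones, by
    -- `core-degree`.
    core : Vertex → Bool
    core v = A v ∧ (2 ≤ᵇ length (N v))

    module _ (no-isolated : ∀ v → T (A v) → length (N v) ≢ 0) (no-loose : ∀ v u → ¬ Loose v u) where
      private
        M = nbrs G core

        core⁺ : ∀ {v} → T (A v) → 2 ≤ length (N v) → T (core v)
        core⁺ av le = Equivalence.from T-∧ (av , ≤⇒≤ᵇ le)

        core⁻ : ∀ {v} → T (core v) → T (A v) × 2 ≤ length (N v)
        core⁻ {v} h = let (av , le) = Equivalence.to (T-∧ {A v}) h in av , ≤ᵇ⇒≤ 2 (length (N v)) le

        M⁻ : ∀ {u v} → u ∈ M v → u ∈ N v × T (core u)
        M⁻ h = let (cu , e) = ∈-nbrs⁻ G core h in ∈-nbrs⁺ G A (proj₁ (core⁻ cu)) e , cu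

        M⁺ : ∀ {u v} → u ∈ N v → 2 ≤ length (N u) → u ∈ M v
        M⁺ h le = ∈-nbrs⁺ G core (core⁺ (alive h) le) (joined h)

        leaf-or-core : ∀ {u v} → u ∈ N v → length (N u) ≡ 1 ⊎ u ∈ M v
        leaf-or-core {u} {v} h = by (length (N u)) refl
          where
          by : ∀ n → length (N u) ≡ n → length (N u) ≡ 1 ⊎ u ∈ M v
          by 0 e = ⊥-elim (no-isolated u (alive h) e)
          by 1 e = inj₁ e
          by (suc (suc n)) e = inj₂ (M⁺ h (subst (2 ≤_) (sym e) (s≤s (s≤s z≤n))))

        data Type (v : Vertex) : Set where
          leafed   : ∀ {l} → l ∈ N v → length (N l) ≡ 1 → (∀ {z} → z ∈ N l → z ∈ v ∷ []) → 3 ≤ length (N v) →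
                     (∀ {c} → c ∈ N v → c ≢ l → 3 ≤ length (N c)) → Type v
          leafless : (∀ {c} → c ∈ N v → c ∈ M v) → Type v

        type : ∀ {v} → T (A v) → Type v
        type {v} av with Finₚ.any? (λ l → Any.any? (l Finₚ.≟_) (N v) ×-dec (length (N l) ≟ 1))
        ... | yes (l , l∈ , e) = leafed l∈ e (only e (back av l∈))
                (≰⇒> λ le → no-loose l v (e , alive l∈ , back av l∈ , inj₁ le))
                (λ {c} c∈ c≢l → ≰⇒> λ le → no-loose l v (e , alive l∈ , back av l∈ , inj₂ (c , c∈ , c≢l , le)))
        ... | no none = leafless λ {c} c∈ → [ (λ e → ⊥-elim (none (c , c∈ , e))) , id ]′ (leaf-or-core c∈)

        core≢leaf : ∀ {u l} → T (core u) → length (N l) ≡ 1 → u ≢ l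
        core≢leaf cu e refl = <-irrefl refl (≤-trans (proj₂ (core⁻ cu)) (≤-reflexive e))

        -- A leaf that is not loose hangs at a vertex of degree three whose two other neighbours
        -- also have degree three, so these two stay in the core.
        core-degree : ∀ v → T (core v) → 2 ≤ length (M v)
        core-degree v cv = by (type (proj₁ (core⁻ cv)))
          where
          by : Type v → 2 ≤ length (M v)
          by (leafless all) = ≤-trans (proj₂ (core⁻ cv)) (unique-⊆-length (nbrs-unique G A v) all)
          by (leafed {l} l∈ _ _ three others) with ∈-remove l∈ | nbrs-unique G A v
          ... | ds , len , to , from | u = s≤s⁻¹ (≤-trans (≤-trans three (unique-⊆-length u moved)) ≤-refl)
            where
            moved : ∀ {z} → z ∈ N v → z ∈ l ∷ M v
            moved {z} z∈ with z Finₚ.≟ l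
            ... | yes e = here e
            ... | no z≢l = there (M⁺ z∈ (<⇒≤ (others z∈ z≢l)))

        core-degrees : ∀ v → T (core v) → TwoOrThree (M v)
        core-degrees v cv = two-or-three G subcubic core v (core-degree v cv)

        Leaf : Vertex → Vertex → Set
        Leaf v l = l ∈ N v × length (N l) ≡ 1 × (∀ {z} → z ∈ N l → z ∈ v ∷ []) × (∀ {p q} → (∀ {z} → z ∈ M v → z ∈ p ∷ q ∷ []) →
          ∀ {z} → z ∈ N v → z ∈ p ∷ q ∷ l ∷ [])

        Bare : Vertex → Set
        Bare v = ∀ {z} → z ∈ N v → z ∈ M v

        leaf-of : ∀ {v l} → l ∈ N v → length (N l) ≡ 1 → (∀ {z} → z ∈ N l → z ∈ v ∷ []) →
          (∀ {c} → c ∈ N v → c ≢ l → 3 ≤ length (N c)) → Leaf v l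
        leaf-of {v} {l} l∈ e cov others = l∈ , e , cov , λ {p} {q} covM {z} z∈ → place covM z∈ (z Finₚ.≟ l)
          where
          place : ∀ {p q} → (∀ {z} → z ∈ M v → z ∈ p ∷ q ∷ []) → ∀ {z} → z ∈ N v → Dec (z ≡ l) → z ∈ p ∷ q ∷ l ∷ []
          place covM z∈ (yes refl) = 3rd
          place covM z∈ (no z≢l) = widen (covM (M⁺ z∈ (<⇒≤ (others z∈ z≢l))))
            where
            widen : ∀ {p q z} → z ∈ p ∷ q ∷ [] → z ∈ p ∷ q ∷ l ∷ []
            widen 1st = 1st
            widen 2nd = 2nd

        Alike : Vertex → Vertex → Set
        Alike v y = (Bare v × Bare y) ⊎ ((∃[ l ] Leaf v l) × (∃[ l′ ] Leaf y l′))

        -- If only one of the two carried a leaf, the other would have degree two in `A` and make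
        -- that leaf loose. Mixed configurations therefore need not be coloured.
        alike : ∀ {v y} → T (core v) → length (M v) ≡ 2 → y ∈ M v → length (M y) ≡ 2 → Alike v y
        alike {v} {y} cv dv y∈ dy = by (type (proj₁ (core⁻ cv))) (type (alive (proj₁ (M⁻ y∈))))
          where
          small : ∀ {w} → Bare w → length (M w) ≡ 2 → length (N w) ≤ 2
          small {w} bare e = ≤-trans (unique-⊆-length (nbrs-unique G A w) bare) (≤-reflexive e)
          by : Type v → Type y → Alike v y
          by (leafless f) (leafless g) = inj₁ (f , g)
          by (leafed l∈ e cov _ others) (leafed l′∈ e′ cov′ _ others′) =
            inj₂ ((_ , leaf-of l∈ e cov others) , (_ , leaf-of l′∈ e′ cov′ others′))
          by (leafed l∈ e _ _ others) (leafless g) = ⊥-elim (<-irrefl refl (≤-trans (others (proj₁ (M⁻ y∈)) (core≢leaf (proj₂ (M⁻ y∈)) e)) (small g dy)))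
          by (leafless f) (leafed l′∈ e′ _ _ others′) = ⊥-elim (<-irrefl refl (≤-trans
            (others′ (back (proj₁ (core⁻ cv)) (proj₁ (M⁻ y∈))) (core≢leaf cv e′)) (small f dv)))

        backM : ∀ {u v} → T (core v) → u ∈ M v → v ∈ M u
        backM cv h = ∈-nbrs⁺ G core cv (Adj-sym G (proj₂ (∈-nbrs⁻ G core h)))

      module _ (triangle-free : ∀ {a b c} → Adj a b → Adj b c → ¬ Adj c a) where
        open Limbs G A cubic triangle-free using (Arm; plain; leafy)

        -- By `alike` on either side of `v`, the three consecutive 2-vertices are all bare or all
        -- carry a leaf; the first case is greedy, the second needs the exhaustive search.
        path-case : ∀ {v} → T (core v) → deg G core v ≡ 2 → 2 ≤ twoNbrs G core v → Reducible G 4 A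
        path-case {v} cv dv h with both-two G subcubic core dv h
        ... | a , c , a∈ , c∈ , cov , a≢c , da , dc
          with other G subcubic core da (backM cv a∈) | other G subcubic core dc (backM cv c∈)
        ... | y , y∈ , cova , v≢y | z , z∈ , covc , v≢z = by (alike cv dv a∈ da) (alike cv dv c∈ dc)
          where
          av = proj₁ (core⁻ cv)
          by : Alike v a → Alike v c → Reducible G 4 A
          by (inj₁ (bv , ba)) (inj₁ (_ , bc)) = v ∷ [] , (v , 1st , av) ,
            remove-middle G 4 A cubic av (proj₁ (M⁻ a∈)) (proj₁ (M⁻ c∈)) (cov ∘ bv) (proj₁ (M⁻ y∈)) (proj₁ (M⁻ z∈)) (cova ∘ ba) (covc ∘ bc) ≤-refl
          by (inj₂ ((l₂ , L₂) , (l₁ , L₁))) (inj₂ (_ , (l₃ , L₃))) =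
            LeafyPath.removed path , (v , 1st , av) , remove-leafy-path G A cubic triangle-free path
            where
            path : LeafyPath G A cubic triangle-free
            path = record
              { ax₂ = av ; x₁∈ = proj₁ (M⁻ a∈) ; x₃∈ = proj₁ (M⁻ c∈)
              ; l₂∈ = proj₁ L₂ ; cov₂ = proj₂ (proj₂ (proj₂ L₂)) cov ; covl₂ = proj₁ (proj₂ (proj₂ L₂))
              ; c∈ = proj₁ (M⁻ y∈) ; l₁∈ = proj₁ L₁ ; cov₁ = proj₂ (proj₂ (proj₂ L₁)) cova ; covl₁ = proj₁ (proj₂ (proj₂ L₁))
              ; w∈ = proj₁ (M⁻ z∈) ; l₃∈ = proj₁ L₃ ; cov₃ = proj₂ (proj₂ (proj₂ L₃)) covc ; covl₃ = proj₁ (proj₂ (proj₂ L₃))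
              ; x₁≢x₃ = a≢c ; c≢x₂ = v≢y ∘ sym ; w≢x₂ = v≢z ∘ sym
              ; c≢l₁ = core≢leaf (proj₂ (M⁻ y∈)) (proj₁ (proj₂ L₁))
              ; w≢l₃ = core≢leaf (proj₂ (M⁻ z∈)) (proj₁ (proj₂ L₃))
              }
          by (inj₁ (bv , _)) (inj₂ ((l , l∈ , e , _) , _)) = ⊥-elim (core≢leaf (proj₂ (M⁻ (bv l∈))) e refl)
          by (inj₂ ((l , l∈ , e , _) , _)) (inj₁ (bv , _)) = ⊥-elim (core≢leaf (proj₂ (M⁻ (bv l∈))) e refl)

        arm : ∀ {a u y} → T (core a) → u ∈ M a → deg G core u ≡ 2 → y ∈ M u → (∀ {z} → z ∈ M u → z ∈ a ∷ y ∷ []) → a ≢ y →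
          deg G core y ≡ 2 → Arm a u
        arm {a} {u} {y} ca u∈ du y∈ cov a≢y dy = by (other G subcubic core dy (backM cu y∈)) (alike cu du y∈ dy)
          where
          cu = proj₂ (M⁻ u∈)
          by : ∃[ c ] (c ∈ M y × (∀ {z} → z ∈ M y → z ∈ u ∷ c ∷ []) × u ≢ c) → Alike u y → Arm a u
          by (c , c∈ , covy , _) (inj₁ (bu , by′)) = plain (proj₁ (M⁻ y∈)) (cov ∘ bu) (proj₁ (M⁻ c∈)) (covy ∘ by′) a≢y
          by (c , c∈ , covy , _) (inj₂ ((l , l∈ , e , covl , f) , (l′ , l′∈ , e′ , covl′ , g))) =
            leafy (proj₁ (M⁻ y∈)) l∈ (f cov) (proj₁ (M⁻ c∈)) l′∈ (g covy) covl covl′ a≢y (core≢leaf ca e) (core≢leaf ca e′)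

        -- No neighbour demands more than two units, so a load above five makes all three demands
        -- equal to two and each neighbour the start of an arm. The centre has no leaf, as its three
        -- core neighbours exhaust its degree.
        tripod-case : ∀ {u} → T (core u) → deg G core u ≡ 3 → 5 < load G core u → Reducible G 4 A
        tripod-case {u} cu du load> with three-list G subcubic core du
        ... | a , c , d , e = by (kind G subcubic core cu du a∈) (kind G subcubic core cu du c∈) (kind G subcubic core cu du d∈)
          where
          at : ∀ {x} → x ∈ a ∷ c ∷ d ∷ [] → x ∈ M u
          at {x} = subst (x ∈_) (sym e)
          a∈ = at 1st
          c∈ = at 2nd
          d∈ = at 3rd
          bare : Type u → Bare u
          bare (leafless f) = f
          bare (leafed {l} l∈ e₁ _ _ _) = ⊥-elim (<-irrefl refl (≤-trans (unique-⊆-length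
            (All.tabulate (λ { h refl → core≢leaf (proj₂ (M⁻ h)) e₁ refl }) AllPairs.∷ nbrs-unique G core u)
            (λ { (here refl) → l∈ ; (there h) → proj₁ (M⁻ h) })) (≤-trans (cubic u) (≤-reflexive (sym du)))))
          cov : ∀ {z} → z ∈ N u → z ∈ a ∷ c ∷ d ∷ []
          cov {z} z∈ = subst (z ∈_) e (bare (type (proj₁ (core⁻ cu))) z∈)
          light : ∀ {x} → Kind G subcubic core u x → demand G core x ≤ 2
          light (big p) = ≤-trans (≤-reflexive p) z≤n
          light (short _ _ _ _ p) = ≤-trans (≤-reflexive p) (s≤s z≤n)
          light (long _ _ _ _ _ p) = ≤-reflexive p
          sum> : 5 < demand G core a + (demand G core c + demand G core d)
          sum> = overload G subcubic core e load> refl refl refl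
          not-first : Kind G subcubic core u c → Kind G subcubic core u d → ¬ demand G core a ≤ 1
          not-first k₂ k₃ le = <-irrefl refl (<-≤-trans sum> (+-mono-≤ le (+-mono-≤ (light k₂) (light k₃))))
          not-second : Kind G subcubic core u a → Kind G subcubic core u d → ¬ demand G core c ≤ 1
          not-second k₁ k₃ le = <-irrefl refl (<-≤-trans sum> (+-mono-≤ (light k₁) (+-mono-≤ le (light k₃))))
          not-third : Kind G subcubic core u a → Kind G subcubic core u c → ¬ demand G core d ≤ 1
          not-third k₁ k₂ le = <-irrefl refl (<-≤-trans sum> (+-mono-≤ (light k₁) (+-mono-≤ (light k₂) le)))
          limb : ∀ {x} → x ∈ M u → Kind G subcubic core u x → ¬ demand G core x ≤ 1 → Arm u x
          limb x∈ (big p) h = ⊥-elim (h (≤-trans (≤-reflexive p) z≤n))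
          limb x∈ (short _ _ _ _ p) h = ⊥-elim (h (≤-reflexive p))
          limb x∈ (long dx y∈ covx u≢y dy _) _ = arm cu x∈ dx y∈ covx u≢y dy
          by : Kind G subcubic core u a → Kind G subcubic core u c → Kind G subcubic core u d → Reducible G 4 A
          by k₁ k₂ k₃ = tripodVertices G A cubic triangle-free tripod , (u , 1st , proj₁ (core⁻ cu)) ,
            remove-star G A cubic triangle-free tripod
            where
            tripod : Tripod G A cubic triangle-free
            tripod = record
              { aa = proj₁ (core⁻ cu) ; u₁∈ = proj₁ (M⁻ a∈) ; u₂∈ = proj₁ (M⁻ c∈) ; u₃∈ = proj₁ (M⁻ d∈) ; cova = cov
              ; arm₁ = limb a∈ k₁ (not-first k₂ k₃) ; arm₂ = limb c∈ k₂ (not-second k₁ k₃) ; arm₃ = limb d∈ k₃ (not-third k₁ k₂) }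

        -- If `v` is itself a leaf, its neighbour has degree at least three, since otherwise the
        -- leaf would be loose.
        nonempty-core : ∀ {v} → T (A v) → ∃[ r ] T (core r)
        nonempty-core {v} av = by (N v) refl
          where
          by : ∀ L → N v ≡ L → ∃[ r ] T (core r)
          by [] e = ⊥-elim (no-isolated v av (cong length e))
          by (u ∷ []) e = u , core⁺ (alive u∈) (<⇒≤ (≰⇒> λ le → no-loose v u (cong length e , av , u∈ , inj₁ le)))
            where
            u∈ = subst (u ∈_) (sym e) 1st
          by (_ ∷ _ ∷ _) e = v , core⁺ av (subst (λ L → 2 ≤ length L) (sym e) (s≤s (s≤s z≤n)))

        reduce-core : PlaneArcs G → (∀ c → IsCycle c → 16 ≤ length c) → ∃[ v ] T (A v) → Reducible G 4 A
        reduce-core PA girth (v , av) with nonempty-core av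
        ... | r , cr with configuration PA core core-degrees cr 5 girth
        ... | inj₁ (w , cw , dw , h) = path-case cw dw h
        ... | inj₂ (w , cw , dw , h) = tripod-case cw dw h

    reduce-four : (∀ {a b c} → Adj a b → Adj b c → ¬ Adj c a) → PlaneArcs G → (∀ c → IsCycle c → 16 ≤ length c) →
      ∃[ v ] T (A v) → Reducible G 4 A
    reduce-four triangle-free PA girth nonempty
      with Finₚ.any? (λ v → T? (A v) ×-dec (length (N v) ≟ 0)) | Finₚ.any? (λ v → Finₚ.any? (loose? v))
    ... | yes (v , av , e) | _ = v ∷ [] , (v , 1st , av) , remove-isolated G 4 A cubic (λ {z} h → empty (N v) e h)
      where
      empty : ∀ L → length L ≡ 0 → ∀ {z} → z ∈ L → z ∈ []
      empty [] _ h = h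
    ... | no _ | yes (v , u , loose) = delete-loose loose
    ... | no none | no none′ = reduce-core (λ v av e → none (v , av , e)) (λ v u l → none′ (v , u , l)) triangle-free PA girth nonempty

  module _ (G : Graph) where
    open Graph G

    no-triangle : (∀ c → IsCycle c → 6 ≤ length c) → ∀ {a b c} → Adj a b → Adj b c → ¬ Adj c a
    no-triangle girth {a} {b} {c} ab bc ca = too-short (girth (a ∷ b ∷ c ∷ [])
      (≤-refl , ((apart ab All.∷ apart ca ∘ sym All.∷ All.[]) AllPairs.∷ (apart bc All.∷ All.[]) AllPairs.∷ All.[] AllPairs.∷ AllPairs.[])
      , ab ∷ bc ∷ ca ∷ [-]))
      where
      open import Data.List.Relation.Unary.Linked using ([-]; _∷_)
      apart : ∀ {u v} → Adj u v → u ≢ v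
      apart e refl = loopless G e
      too-short : ¬ 6 ≤ 3
      too-short (s≤s (s≤s (s≤s ())))

-- Decidability of colourability and the least number of colours.

module Minimum where

  open Drawing using (edge-≡)
  open import Data.Bool.Properties using (T?)
  open import Data.Fin.Base as Fin using (Fin; funToFin; finToFun)
  import Data.Fin.Properties as Finₚ
  open import Data.List.Base
    using (List; []; _∷_; concatMap; cartesianProduct; allFin; length; lookup)
  open import Data.List.Membership.Propositional using (_∈_; lose)
  open import Data.List.Membership.Propositional.Properties
    using (∈-concatMap⁺; ∈-cartesianProduct⁺; ∈-allFin)
  open import Data.List.Relation.Unary.Any using (here; index)
  open import Data.List.Relation.Unary.Any.Properties using (lookup-index)
  open import Data.List.Relation.Unary.AllPairs using (allPairs?)
  open import Data.Nat.Base
  open import Data.Nat.Induction using (<-wellFounded)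
  open import Data.Nat.Properties hiding (_≟_)
  open import Data.Product.Base using (_×_; _,_; ∃-syntax)
  open import Function.Base using (_∘_)
  open import Induction.WellFounded using (Acc; acc)
  open import Relation.Binary.PropositionalEquality
  open import Relation.Nullary using (Dec; yes; no; contradiction; _×-dec_; _⊎-dec_; _→-dec_; ¬?)
  open import Relation.Nullary.Decidable using (map′)

  -- The index is defined as a minimum, and constructively an upper bound yields a minimum only for
  -- a decidable property; the finite search in `colorable?` provides this.
  least : ∀ {P : ℕ → Set} → (∀ n → Dec (P n)) → ∀ k → P k → ∃[ χ ] (IsMinimum P χ × χ ≤ k)
  least {P} P? k pk = go k (<-wellFounded k) pk
    where
    go : ∀ k → Acc _<_ k → P k → ∃[ χ ] (IsMinimum P χ × χ ≤ k)
    go k (acc rec) pk with anyUpTo? P? k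
    ... | yes (j , j<k , pj) = let (χ , min , le) = go j (rec j<k) pj in χ , min , ≤-trans le (<⇒≤ j<k)
    ... | no none = k , (pk , λ m pm → ≮⇒≥ λ m<k → none (m , m<k , pm)) , ≤-refl

  module _ (G : Graph) where
    open Graph G

    consecutive? : ∀ e₁ e₂ e₃ → Dec (Consecutive e₁ e₂ e₃)
    consecutive? e₁ e₂ e₃ = Finₚ.any? λ a → Finₚ.any? λ b → Finₚ.any? λ c → Finₚ.any? λ d →
      joins? e₁ a b ×-dec joins? e₂ b c ×-dec joins? e₃ c d ×-dec
      (unique? (a ∷ b ∷ c ∷ d ∷ []) ⊎-dec (unique? (a ∷ b ∷ c ∷ []) ×-dec (d Finₚ.≟ a)))
      where
      unique? = allPairs? (λ u v → ¬? (u Finₚ.≟ v))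
      joins? : ∀ e u v → Dec (Joins e u v)
      joins? e u v = ((src e Finₚ.≟ u) ×-dec (tgt e Finₚ.≟ v)) ⊎-dec ((src e Finₚ.≟ v) ×-dec (tgt e Finₚ.≟ u))

    edge? : ∀ u v → Dec (u Fin.< v × Adj u v)
    edge? u v = (u Finₚ.<? v) ×-dec T? (adj u v)

    edgesOn : ∀ {u v} → Dec (u Fin.< v × Adj u v) → List Edge
    edgesOn {u} {v} (yes (p , a)) = edge u v p a ∷ []
    edgesOn (no _) = []

    allEdges : List Edge
    allEdges = concatMap (λ (u , v) → edgesOn (edge? u v)) (cartesianProduct (allFin order) (allFin order))

    ∈-allEdges : ∀ e → e ∈ allEdges
    ∈-allEdges e = ∈-concatMap⁺ (λ (u , v) → edgesOn (edge? u v))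
      (lose (∈-cartesianProduct⁺ (∈-allFin (src e)) (∈-allFin (tgt e))) (on (edge? (src e) (tgt e))))
      where
      on : ∀ d → e ∈ edgesOn {src e} {tgt e} d
      on (yes (p , a)) = here (edge-≡ e (edge (src e) (tgt e) p a) refl refl)
      on (no ¬e) = contradiction (src<tgt e , adjacent e) ¬e

    -- An edge is located in `allEdges` up to equality of its ends, by `edge-≡`. So a colouring is a
    -- function on positions, and all such functions are numbered by `finToFun`.
    colorable? : ∀ m → Dec (InjectivelyEdgeColorable G m)
    colorable? m = map′ to from (Finₚ.any? λ i → valid? (finToFun {m} {E} i))
      where
      E = length allEdges
      Valid : (Fin E → Fin m) → Set
      Valid f = ∀ i j l → Consecutive (lookup allEdges i) (lookup allEdges j) (lookup allEdges l) → f i ≢ f l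
      valid? : ∀ f → Dec (Valid f)
      valid? f = Finₚ.all? λ i → Finₚ.all? λ j → Finₚ.all? λ l →
        consecutive? (lookup allEdges i) (lookup allEdges j) (lookup allEdges l) →-dec ¬? (f i Finₚ.≟ f l)
      number : Edge → Fin E
      number e = index (∈-allEdges e)
      numbered : ∀ e → e ≡ lookup allEdges (number e)
      numbered e = lookup-index (∈-allEdges e)
      to : ∃[ i ] Valid (finToFun {m} {E} i) → InjectivelyEdgeColorable G m
      to (i , v) = finToFun {m} {E} i ∘ number , λ e₁ e₂ e₃ con → v (number e₁) (number e₂) (number e₃)
        (subst₂ (λ e f → Consecutive e f (lookup allEdges (number e₃))) (numbered e₁) (numbered e₂)
          (subst (Consecutive e₁ e₂) (numbered e₃) con))
      from : InjectivelyEdgeColorable G m → ∃[ i ] Valid (finToFun {m} {E} i)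
      from (c , v) = funToFin (c ∘ lookup allEdges) , λ i j l con e → v (lookup allEdges i) (lookup allEdges j) (lookup allEdges l) con
        (trans (sym (Finₚ.finToFun-funToFin (c ∘ lookup allEdges) i)) (trans e (Finₚ.finToFun-funToFin (c ∘ lookup allEdges) l)))

    chromatic-index : ∀ k → InjectivelyEdgeColorable G k → ∃[ χ ] (IsInjectiveChromaticIndex G χ × χ ≤ k)
    chromatic-index = least colorable?

-- Assembly of the four bounds.

open Drawing using (planeArcs)
open Reduction
open Four
open Minimum
open import Data.Fin.Base using (zero)
open import Data.List.Base using (length)
open import Data.Nat.Base using (ℕ; _≤_; z≤n; s≤s)
open import Data.Nat.Properties using (≤-trans)
open import Data.Product.Base using (_×_; _,_; proj₂; ∃-syntax)
open import Relation.Binary.Construct.Add.Supremum.NonStrict _≤_ using (_≤⊤⁺) renaming ([_] to [_]≤)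
open import Relation.Binary.PropositionalEquality using (refl)
open import Relation.Nullary using (contradiction)
open import Relation.Nullary.Construct.Add.Supremum using (_⁺; [_]; ⊤⁺)

cycles-girth≥ : ∀ G g → IsGirth G g → ∀ {n} → [ n ] ≤∞ g → ∀ c → Graph.IsCycle G c → n ≤ length c
cycles-girth≥ G [ g ] girth [ n≤g ]≤ c cyc = ≤-trans n≤g (proj₂ girth (length c) (c , cyc , refl))
cycles-girth≥ G ⊤⁺ acyclic (_ ≤⊤⁺) c cyc = contradiction (c , cyc , refl) (acyclic (length c))

corollary1p18 : (G : Graph) → Subcubic G → Planar G → (g : ℕ ⁺) → IsGirth G g →
    ([ 16 ] ≤∞ g → ∃[ χ ] (IsInjectiveChromaticIndex G χ × χ ≤ 4))
    × ([ 10 ] ≤∞ g → ∃[ χ ] (IsInjectiveChromaticIndex G χ × χ ≤ 5))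
    × ([ 8 ] ≤∞ g → ∃[ χ ] (IsInjectiveChromaticIndex G χ × χ ≤ 6))
    × ([ 6 ] ≤∞ g → ∃[ χ ] (IsInjectiveChromaticIndex G χ × χ ≤ 7))
corollary1p18 G subcubic planar g girth =
    (λ le → chromatic-index G 4 (colorable G 4 (colour-all G 4 zero
      (λ A → reduce-four G subcubic A (no-triangle G (λ c cyc → ≤-trans (s≤s (s≤s (s≤s (s≤s (s≤s (s≤s z≤n)))))) (girth≥ le c cyc)))
        PA (girth≥ le)) (everything G 4))))
  , (λ le → chromatic-index G 5 (colorable G 5 (colour-all G 5 zero (λ A → reduce-five subcubic PA A (girth≥ le)) (everything G 5))))
  , (λ le → chromatic-index G 6 (colorable G 6 (colour-all G 6 zero (λ A → reduce-six subcubic PA A (girth≥ le)) (everything G 6))))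
  , (λ le → chromatic-index G 7 (colorable G 7 (colour-all G 7 zero (λ A → reduce-seven subcubic PA A (girth≥ le)) (everything G 7))))
  where
  PA = planeArcs planar
  girth≥ : ∀ {n} → [ n ] ≤∞ g → ∀ c → Graph.IsCycle G c → n ≤ length c
  girth≥ = cycles-girth≥ G g girth
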